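{- Let $t\geq 1$ be an integer and let $0 < c < 1/2$ be a real constant. For undirected unweighted graphs $G=(V,E)$ with $n=|V|$ and $m=|E|$, there is a distance oracle that uses $\tilde{O}(n^{2-c})$ space and that, given two query vertices $u,v\in V$, computes in $\tilde{O}(n^{c\cdot t})$ time a distance estimation $\hat{d}(u,v)$ satisfying $$d(u,v) \leq \hat{d}(u,v) \le d(u,v) + 2\left\lceil \frac{d(u,v)}{2t}\right\rceil.$$ The distance oracle is constructed in $\tilde{O}(mn^{1-c})$ time.
   Context: $d(u,v)$ is the length of a shortest path between $u$ and $v$ in $G$. A distance oracle is a data structure obtained by preprocessing $G$ (possibly with a randomized algorithm); a query algorithm, given any pair $u,v\in V$ and access only to the data structure, returns an estimate $\hat d(u,v)$. The space of the oracle is the size of the data structure; the construction time is the running time of the preprocessing. $\tilde{O}(\cdot)$ hides factors polylogarithmic in $n$. -}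

module Defs where

open import Data.Bool using (Bool; true; false; if_then_else_)
open import Data.Empty using (⊥)
open import Data.Fin using (Fin; toℕ) renaming (_<_ to _<ᶠ_)
open import Data.Integer using (+_)
open import Data.List using (List; []; _∷_; length; map; upTo)
open import Data.List.Membership.Propositional using (_∈_)
open import Data.List.Relation.Unary.All using (All)
open import Data.List.Relation.Unary.Unique.Propositional using (Unique)
open import Data.Maybe using (Maybe; just; nothing)
open import Data.Nat
  using (ℕ; zero; suc; _+_; _∸_; _*_; _^_; _/_; _%_; _≤_; _≡ᵇ_; _<ᵇ_; NonZero)
open import Data.Nat.Logarithm using (⌈log₂_⌉)
open import Data.Nat.Properties using (m^n≢0; m*n≢0)
open import Data.Product using (Σ; ∃-syntax; _×_; _,_; proj₁; proj₂)
open import Data.Rational as ℚ using (ℚ)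
open import Data.Sum using (_⊎_)
open import Data.Vec using (Vec; []; _∷_)
open import Relation.Binary.PropositionalEquality using (_≡_)
open import Relation.Nullary using (¬_)

-- Dedekind reals: L q means q < x, U q means x < q.
record ℝ : Set₁ where
  field
    L U     : ℚ → Set
    L-inh   : ∃[ q ] L q
    U-inh   : ∃[ q ] U q
    L-down  : ∀ {p q} → p ℚ.< q → L q → L p
    L-open  : ∀ {p} → L p → ∃[ q ] (p ℚ.< q × L q)
    U-up    : ∀ {p q} → p ℚ.< q → U p → U q
    U-open  : ∀ {q} → U q → ∃[ p ] (p ℚ.< q × U p)
    disjoint : ∀ {q} → L q → U q → ⊥
    located : ∀ {p q} → p ℚ.< q → L p ⊎ U q

open ℝ public using (L; U)

_<ˡ_ : ℚ → ℝ → Set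
q <ˡ x = L x q

_<ʳ_ : ℝ → ℚ → Set
x <ʳ q = U x q

-- A real exponent e ≥ 0, given by the rationals q > e.
Exponent : Set₁
Exponent = ℚ → Set

_−ᵉ_ : ℕ → ℝ → Exponent
(k −ᵉ c) q = L c ((+ k ℚ./ 1) ℚ.- q)

_·ᵉ_ : ℝ → (t : ℕ) .{{_ : NonZero t}} → Exponent
(c ·ᵉ t) q = U c (q ℚ.* (+ 1 ℚ./ t))

-- x ≤ y · n ^ e.  For n ≥ 1 the real number n ^ e is the infimum of the
-- n ^ (a / b) with a / b > e, and x ≤ y · n ^ (a / b) is
-- x ^ b ≤ y ^ b · n ^ a.
_≤_·_^ᵉ_ : ℕ → ℕ → ℕ → Exponent → Set
x ≤ y · n ^ᵉ E =
  ∀ (a b : ℕ) .{{_ : NonZero b}} → E (+ a ℚ./ b) → x ^ b ≤ y ^ b * n ^ a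

-- n ^ e < x.
_^ᵉ_<_ : ℕ → Exponent → ℕ → Set
n ^ᵉ E < x =
  ∃[ a ] Σ ℕ λ b → Σ (NonZero b) λ nz →
    E (ℚ._/_ (+ a) b {{nz}}) × suc (n ^ a) ≤ x ^ b

-- K · (1 + log n) ^ k; the summand 1 only serves to keep this positive at n = 1.
polylog : (K k n : ℕ) → ℕ
polylog K k n = K * (1 + ⌈log₂ n ⌉) ^ k

-- Every undirected edge is listed once, smaller endpoint first.
record Graph (n : ℕ) : Set where
  field
    edges   : List (Fin n × Fin n)
    ordered : All (λ e → proj₁ e <ᶠ proj₂ e) edges
    unique  : Unique edges

  Adjacent : Fin n → Fin n → Set
  Adjacent u v = (u , v) ∈ edges ⊎ (v , u) ∈ edges

  size : ℕ
  size = length edges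

open Graph public

-- Vertices may repeat; a shortest walk never repeats one.
data Walk {n : ℕ} (G : Graph n) : ℕ → Fin n → Fin n → Set where
  here : ∀ {u} → Walk G 0 u u
  step : ∀ {l u v w} → Adjacent G u v → Walk G l v w → Walk G (suc l) u w

IsDistance : ∀ {n} → Graph n → Fin n → Fin n → ℕ → Set
IsDistance G u v d = Walk G d u v × (∀ l → Walk G l u v → d ≤ l)

⌈_/2_⌉ : ℕ → (t : ℕ) .{{_ : NonZero t}} → ℕ
⌈ d /2 t ⌉ = ((d + (2 * t ∸ 1)) / (2 * t)) {{m*n≢0 2 t}}

-- Estimates and distances are infinite (nothing) between different components.
Approximates : (t : ℕ) .{{_ : NonZero t}} →
               ∀ {n} → Graph n → Fin n → Fin n → Maybe ℕ → Set
Approximates t G u v (just e) =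
  ∃[ d ] (IsDistance G u v d × d ≤ e × e ≤ d + 2 * ⌈ d /2 t ⌉)
Approximates t G u v nothing  = ∀ l → ¬ Walk G l u v

-- Programs use finitely many variables and arrays, both named by numerals.
-- Every step executes one command, whose expressions have constant size since
-- the program is fixed.

data Op : Set where
  add sub mul quo lt eq : Op

data Expr : Set where
  lit : ℕ → Expr
  var : ℕ → Expr
  get : (array : ℕ) → (index : Expr) → Expr
  bin : Op → Expr → Expr → Expr

infixr 5 _⨟_
data Cmd : Set where
  skip  : Cmd
  _≔_   : ℕ → Expr → Cmd
  put   : (array : ℕ) → (index value : Expr) → Cmd
  toss  : ℕ → Cmd
  _⨟_   : Cmd → Cmd → Cmd
  ifnz  : Expr → Cmd → Cmd → Cmd
  while : Expr → Cmd → Cmd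

record State : Set where
  constructor ⟨_,_,_⟩
  field
    vars   : ℕ → ℕ
    arrays : ℕ → ℕ → ℕ
    coins  : ℕ → Bool

open State public

update : {A : Set} → (ℕ → A) → ℕ → A → ℕ → A
update f i a j = if i ≡ᵇ j then a else f j

bit : Bool → ℕ
bit b = if b then 1 else 0

-- Reduction to a word of w bits.
wrap : (w : ℕ) → ℕ → ℕ
wrap w x = (x % (2 ^ w)) {{m^n≢0 2 w}}

-- Subtraction is truncated at 0, and division by 0 gives 0.
apply : (w : ℕ) → Op → ℕ → ℕ → ℕ
apply w add x y       = wrap w (x + y)
apply w sub x y       = x ∸ y
apply w mul x y       = wrap w (x * y)
apply w quo x zero    = 0
apply w quo x (suc y) = x / suc y
apply w lt  x y       = wrap w (bit (x <ᵇ y))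
apply w eq  x y       = wrap w (bit (x ≡ᵇ y))

eval : (w : ℕ) → State → Expr → ℕ
eval w s (lit k)     = wrap w k
eval w s (var x)     = vars s x
eval w s (get a i)   = arrays s a (eval w s i)
eval w s (bin o e f) = apply w o (eval w s e) (eval w s f)

setVar : ℕ → ℕ → State → State
setVar x k s = record s { vars = update (vars s) x k }

setCell : ℕ → ℕ → ℕ → State → State
setCell a i k s = record s { arrays = update (arrays s) a (update (arrays s a) i k) }

-- The commands still to be executed, and the current state.
Config : Set
Config = List Cmd × State

next : (w : ℕ) → Config → Config
next w ([]             , s) = [] , s
next w (skip ∷ k       , s) = k , s
next w ((x ≔ e) ∷ k    , s) = k , setVar x (eval w s e) s
next w (put a i e ∷ k  , s) = k , setCell a (eval w s i) (eval w s e) s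
next w (toss x ∷ k     , s) =
  k , setVar x (wrap w (bit (coins s 0))) (record s { coins = λ i → coins s (suc i) })
next w ((p ⨟ q) ∷ k    , s) = p ∷ q ∷ k , s
next w (ifnz e p q ∷ k , s) with eval w s e
... | zero  = q ∷ k , s
... | suc _ = p ∷ k , s
next w (while e p ∷ k  , s) with eval w s e
... | zero  = k , s
... | suc _ = p ∷ while e p ∷ k , s

run : (w τ : ℕ) → Config → Config
run w zero    C = C
run w (suc τ) C = run w τ (next w C)

running : Config → Bool
running ([]    , _) = false
running (_ ∷ _ , _) = true

Halts : (w τ : ℕ) → Cmd → State → State → Set
Halts w τ p s s′ = run w τ (p ∷ [] , s) ≡ ([] , s′)

-- The number of τ-bit strings satisfying P.
count : (τ : ℕ) → (Vec Bool τ → Bool) → ℕ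
count zero    P = bit (P [])
count (suc τ) P = count τ (λ ω → P (false ∷ ω)) + count τ (λ ω → P (true ∷ ω))

pad : ∀ {τ} → Vec Bool τ → ℕ → Bool
pad []      _       = false
pad (b ∷ ω) zero    = b
pad (b ∷ ω) (suc i) = pad ω i

-- Total lookup, with default z beyond the end of the list.
lookupOr : {A : Set} → A → List A → ℕ → A
lookupOr z []       _       = z
lookupOr z (x ∷ xs) zero    = x
lookupOr z (x ∷ xs) (suc i) = lookupOr z xs i

cells : List ℕ → ℕ → ℕ
cells = lookupOr 0

-- A real c is not a finite input.  Programs have access to it through a word κ
-- with κ ≤ n ^ c < 2κ.  ⌊n ^ c⌋ is one choice, but for an arbitrary Dedekind
-- real it cannot be computed constructively, whereas some κ in this range can.
record Instance (c : ℝ) : Set where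
  field
    n       : ℕ
    n≥1     : 1 ≤ n
    graph   : Graph n
    κ       : ℕ
    κ-lower : κ ≤ 1 · n ^ᵉ U c
    κ-upper : n ^ᵉ U c < (2 * κ)

  m : ℕ
  m = size graph

open Instance public using (n; m; graph; κ)

-- Words have wordFactor · (1 + ⌈log₂ n⌉) bits.
record Oracle : Set where
  field
    preprocess query : Cmd
    wordFactor       : ℕ

open Oracle public

wordSize : ∀ {c} → Oracle → Instance c → ℕ
wordSize A I = wordFactor A * (1 + ⌈log₂ n I ⌉)

-- Variables 0, 1, 2 hold n, m, κ; arrays 0 and 1 hold the two ends of each edge.
-- All other variables and cells are 0.
preStart : ∀ {c} → Instance c → (ℕ → Bool) → State
preStart I ω = ⟨ cells (n I ∷ m I ∷ κ I ∷ [])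
               , lookupOr (λ _ → 0)
                   ( cells (map (λ e → toℕ (proj₁ e)) (edges (graph I)))
                   ∷ cells (map (λ e → toℕ (proj₂ e)) (edges (graph I)))
                   ∷ [])
               , ω ⟩

-- The data structure is left in array 2, its number of words in variable 0.
output : State → List ℕ
output s = map (arrays s 2) (upTo (vars s 0))

-- D is the result of preprocessing for some outcome of the coin tosses.
Constructs : ∀ {c} → Oracle → Instance c → List ℕ → Set
Constructs A I D =
  ∃[ ω ] ∃[ τ ] ∃[ s ]
    (Halts (wordSize A I) τ (preprocess A) (preStart I ω) s × D ≡ output s)

-- The number of outcomes of τ coin tosses for which preprocessing is not
-- complete after τ steps; in that time at most τ coins can be tossed.
unfinished : ∀ {c} → Oracle → Instance c → ℕ → ℕ
unfinished A I τ =
  count τ λ ω → running (run (wordSize A I) τ (preprocess A ∷ [] , preStart I (pad ω)))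

-- Variables 0 and 1 hold the two vertices and array 0 the data structure.
-- Queries are deterministic: their coins always show false.
queryStart : ∀ {k} → List ℕ → Fin k → Fin k → State
queryStart D u v = ⟨ cells (toℕ u ∷ toℕ v ∷ [])
                   , lookupOr (λ _ → 0) (cells D ∷ [])
                   , (λ _ → false) ⟩

-- Variable 0 of the final state holds 0 for an infinite estimate, and otherwise
-- the successor of the estimate.
estimate : State → Maybe ℕ
estimate s with vars s 0
... | zero  = nothing
... | suc e = just e

Answers : ∀ {c} → (A : Oracle) → (I : Instance c) → List ℕ →
          Fin (n I) → Fin (n I) → (τ : ℕ) → Maybe ℕ → Set
Answers A I D u v τ e =
  ∃[ s ] (Halts (wordSize A I) τ (query A) (queryStart D u v) s × e ≡ estimate s)

-- Flooding the graph from all vertices at once, with lists truncated to about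
-- n ^ c entries, gives every vertex w a list of nearest vertices in time
-- m · n ^ c ≤ m · n ^ (1 − c).  The lists that are full are hit by Õ(n ^ (1 − c))
-- pivots, chosen greedily with a halving threshold, and a second flood stores the
-- distances to all pivots.  If x is at distance r from w, then either x is in the
-- list of w, or the pivot of w is at distance at most r from w.  A query follows
-- chains of t lists from both ends of a shortest path of length d ≤ 2tr with steps
-- of length r: either the chains meet, giving d, or some vertex of the path has a
-- pivot within r, and the detour through that pivot has length at most d + 2r.
-- No randomness is needed.
module Submission where

open import Defs
open import Data.Bool using (Bool; true; false; if_then_else_; _∧_; _∨_; T)
open import Data.Fin using (Fin; toℕ; combine)
open import Data.Fin.Properties using (toℕ<n; toℕ-injective; injective⇒≤; combine-injective; any?)
import Data.Integer as ℤ
import Data.Integer.Properties as ℤ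
open import Data.List using (List; []; _∷_; length; map; upTo; _++_; downFrom; _∷ʳ_; initLast; _∷ʳ′_; applyUpTo; lookup)
open import Data.List.Membership.Propositional using (_∈_)
open import Data.List.Membership.Propositional.Properties using (∈-downFrom⁻; ∈-downFrom⁺; ∈-++⁺ʳ; ∈-lookup)
open import Data.List.Properties using (length-++; ++-assoc; length-downFrom; ++-identityʳ; length-map; length-upTo; map-∘)
open import Data.List.Relation.Unary.All as All using (All; []; _∷_)
import Data.List.Relation.Unary.All.Properties as AllP
open import Data.List.Relation.Unary.AllPairs using (AllPairs; []; _∷_)
open import Data.List.Relation.Unary.Any using (here; there)
open import Data.List.Relation.Unary.Unique.Propositional using (Unique)
open import Data.Maybe using (just; nothing)
open import Data.Nat
open import Data.Nat.DivMod using (m<n⇒m%n≡m; m<n*o⇒m/o<n; m/n≤m; m≡m%n+[m/n]*n; m%n<n; m*n/n≡m; /-monoˡ-≤; m/n*n≤m)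
open import Data.Nat.Logarithm using (⌈log₂_⌉; ⌈log₂2^n⌉≡n; ⌈log₂⌉-mono-≤)
open import Data.Nat.Properties
open import Data.Nat.Tactic.RingSolver using (solve-∀)
open import Data.Product using (Σ; ∃-syntax; _×_; _,_; proj₁; proj₂)
open import Data.Product.Properties using (≡-dec)
open import Data.Rational as ℚ using (ℚ; 0ℚ; ½)
import Data.Rational.Properties as ℚ
open import Data.Rational.Unnormalised as ℚᵘ using (mkℚᵘ; *≡*)
import Data.Rational.Unnormalised.Properties as ℚᵘ
open import Data.Sum using (_⊎_; inj₁; inj₂)
open import Data.Unit using (⊤; tt)
open import Data.Vec using (Vec; []; _∷_)
open import Function using (_∘_; it)
open import Relation.Binary.Definitions using (tri<; tri≈; tri>)
open import Relation.Binary.PropositionalEquality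
open import Relation.Nullary using (¬_; Dec; yes; no; contradiction)
open import Relation.Nullary.Decidable using (_⊎-dec_; _×-dec_)
import Algebra.Properties.CommutativeSemigroup +-commutativeSemigroup as +-CS

-- A truncated list must still hold what is nearest. The flood refuses an item only if its key is
-- already there or the list is full of items no farther away, and a full vertex fills its
-- neighbours within one more step. So a key missing from a list always comes with a full list at no
-- greater distance, hence with a pivot. Time is counted in arcs, not vertices: memory is never
-- initialised and isolated vertices enter no queue. They have neither list nor pivot, so
-- completeness is claimed for paths of positive length. Always taking the best pivot would need a
-- priority queue. With threshold `θ`, one pass reads each list entry a bounded number of times,
-- every choice settles at least `θ` vertices, and the previous pass left at most `2 * θ` to each
-- key; so a pass adds at most 2n/κ pivots. From c < 1/2 follows κ² ≤ n, so that list length and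
-- number of pivots are both n ^ (1 - c) up to logarithms. A query does not know the step length
-- `r`: it opens all chains of `t` list entries, and `r` lives in the analysis alone.

≡ᵇ-refl : ∀ i → (i ≡ᵇ i) ≡ true
≡ᵇ-refl zero    = refl
≡ᵇ-refl (suc i) = ≡ᵇ-refl i

≢⇒≡ᵇ-false : ∀ {i j} → i ≢ j → (i ≡ᵇ j) ≡ false
≢⇒≡ᵇ-false {i} {j} i≢j with i ≡ᵇ j in e≡
... | false = refl
... | true  = contradiction (≡ᵇ⇒≡ i j (subst T (sym e≡) tt)) i≢j

≡ᵇ-true⇒≡ : ∀ i j → (i ≡ᵇ j) ≡ true → i ≡ j
≡ᵇ-true⇒≡ i j e≡ = ≡ᵇ⇒≡ i j (subst T (sym e≡) tt)

update-same : ∀ {A : Set} (f : ℕ → A) i v → update f i v i ≡ v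
update-same f i v rewrite ≡ᵇ-refl i = refl

update-other : ∀ {A : Set} (f : ℕ → A) {i j} v → i ≢ j → update f i v j ≡ f j
update-other f v i≢j rewrite ≢⇒≡ᵇ-false i≢j = refl

-- Indicators, row-major indices and lists laid out in memory

[_≣_] : ℕ → ℕ → ℕ
[ a ≣ b ] = bit (a ≡ᵇ b)

[≣]-refl : ∀ a → [ a ≣ a ] ≡ 1
[≣]-refl a rewrite ≡ᵇ-refl a = refl

[≣]-≢ : ∀ {a b} → a ≢ b → [ a ≣ b ] ≡ 0
[≣]-≢ ne rewrite ≢⇒≡ᵇ-false ne = refl

[≣]-≤1 : ∀ a b → [ a ≣ b ] ≤ 1
[≣]-≤1 a b with a ≡ᵇ b
... | true  = ≤-refl
... | false = z≤n

idx-< : ∀ {a b n y} → y < n → a < b → a * n + y < b * n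
idx-< {a} {b} {n} {y} y<n a<b = begin-strict
  a * n + y  <⟨ +-monoʳ-< (a * n) y<n ⟩
  a * n + n  ≡⟨ +-comm (a * n) n ⟩
  suc a * n  ≤⟨ *-monoˡ-≤ n a<b ⟩
  b * n      ∎
  where open ≤-Reasoning

idx-injective : ∀ {a b n y z} → y < n → z < n → a * n + y ≡ b * n + z → a ≡ b × y ≡ z
idx-injective {a} {b} {n} {y} {z} y<n z<n e≡ with <-cmp a b
... | tri≈ _ refl _ = refl , +-cancelˡ-≡ (a * n) y z e≡
... | tri< a<b _ _  = contradiction e≡ (<⇒≢ (<-≤-trans (idx-< y<n a<b) (m≤m+n (b * n) z)))
... | tri> _ _ b<a  = contradiction (sym e≡) (<⇒≢ (<-≤-trans (idx-< z<n b<a) (m≤m+n (a * n) y)))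

idx-≢ˡ : ∀ {a b n y z} → y < n → z < n → a ≢ b → a * n + y ≢ b * n + z
idx-≢ˡ {a} {b} y<n z<n a≢b e≡ = a≢b (proj₁ (idx-injective {a} {b} y<n z<n e≡))

idx-≢ʳ : ∀ {a b n y z} → y < n → z < n → y ≢ z → a * n + y ≢ b * n + z
idx-≢ʳ {a} {b} y<n z<n y≢z e≡ = y≢z (proj₂ (idx-injective {a} {b} y<n z<n e≡))

∑ : {A : Set} → (A → ℕ) → List A → ℕ
∑ f []      = 0
∑ f (q ∷ Q) = f q + ∑ f Q

-- A list built by prepending is laid out with its last element first: an
-- element is at the address of the number of elements after it.
Stored : {A : Set} → (ℕ → ℕ) → (A → ℕ) → (ℕ → ℕ) → List A → Set
Stored at val arr []      = ⊤
Stored at val arr (q ∷ Q) = arr (at (length Q)) ≡ val q × Stored at val arr Q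

stored-cong : ∀ {A : Set} {at val arr arr′} (Q : List A) →
  (∀ k → k < length Q → arr′ (at k) ≡ arr (at k)) →
  Stored at val arr Q → Stored at val arr′ Q
stored-cong []      e≡ st       = tt
stored-cong (q ∷ Q) e≡ (p , st) =
  trans (e≡ (length Q) ≤-refl) p , stored-cong Q (λ k k< → e≡ k (m≤n⇒m≤1+n k<)) st

stored-update : ∀ {A : Set} {at val arr i v} (Q : List A) →
  (∀ k → k < length Q → i ≢ at k) →
  Stored at val arr Q → Stored at val (update arr i v) Q
stored-update {arr = arr} {v = v} Q ne = stored-cong Q (λ k k< → update-other arr v (ne k k<))

stored-drop : ∀ {A : Set} {at val arr} (xs : List A) {ys} →
  Stored at val arr (xs ++ ys) → Stored at val arr ys
stored-drop []       st       = st
stored-drop (x ∷ xs) (_ , st) = stored-drop xs st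

-- Big-step semantics of toss-free commands

-- A syntactic over-approximation of the variables a command may write. Since it computes to a
-- Boolean, `refl` discharges the frame conditions of concrete programs.
modV : Cmd → ℕ → Bool
modV skip         _ = false
modV (x ≔ _)      y = x ≡ᵇ y
modV (put _ _ _)  _ = false
modV (toss _)     _ = true
modV (p ⨟ q)      y = modV p y ∨ modV q y
modV (ifnz _ p q) y = modV p y ∨ modV q y
modV (while _ p)  y = modV p y

modA : Cmd → ℕ → Bool
modA skip         _ = false
modA (_ ≔ _)      _ = false
modA (put a _ _)  b = a ≡ᵇ b
modA (toss _)     _ = false
modA (p ⨟ q)      b = modA p b ∨ modA q b
modA (ifnz _ p q) b = modA p b ∨ modA q b
modA (while _ p)  b = modA p b

-- The last index is the exact number of steps of `next`. Evaluated expressions enter through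
-- equations with a given value, so that later states mention mathematical values instead of `eval`
-- terms.
data Ex (w : ℕ) : Cmd → State → State → ℕ → Set where
  e-skip : ∀ {s} → Ex w skip s s 1
  e-asg  : ∀ {s x e v} → eval w s e ≡ v → Ex w (x ≔ e) s (setVar x v s) 1
  e-put  : ∀ {s a i e j v} → eval w s i ≡ j → eval w s e ≡ v →
           Ex w (put a i e) s (setCell a j v s) 1
  e-seq  : ∀ {s s₁ s₂ p q τ₁ τ₂} → Ex w p s s₁ τ₁ → Ex w q s₁ s₂ τ₂ →
           Ex w (p ⨟ q) s s₂ (suc (τ₁ + τ₂))
  e-if₁  : ∀ {s s′ e p q τ v} → eval w s e ≡ suc v → Ex w p s s′ τ →
           Ex w (ifnz e p q) s s′ (suc τ)
  e-if₀  : ∀ {s s′ e p q τ} → eval w s e ≡ 0 → Ex w q s s′ τ →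
           Ex w (ifnz e p q) s s′ (suc τ)
  e-wh₁  : ∀ {s s₁ s₂ e p τ₁ τ₂ v} → eval w s e ≡ suc v → Ex w p s s₁ τ₁ →
           Ex w (while e p) s₁ s₂ τ₂ → Ex w (while e p) s s₂ (suc (τ₁ + τ₂))
  e-wh₀  : ∀ {s e p} → eval w s e ≡ 0 → Ex w (while e p) s s 1

run-+ : ∀ w a b C → run w (a + b) C ≡ run w b (run w a C)
run-+ w zero    b C = refl
run-+ w (suc a) b C = run-+ w a b (next w C)

-- The continuation `k` is arbitrary because the first part of a sequence, or the body of a loop,
-- runs while the rest is still on the stack.
ex-sound : ∀ {w c s s′ τ} → Ex w c s s′ τ → ∀ k → run w τ (c ∷ k , s) ≡ (k , s′)
ex-sound e-skip k = refl
ex-sound (e-asg refl) k = refl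
ex-sound (e-put refl refl) k = refl
ex-sound {w} {p ⨟ q} {s} (e-seq {τ₁ = τ₁} {τ₂} d₁ d₂) k =
  trans (run-+ w τ₁ τ₂ (p ∷ q ∷ k , s))
        (trans (cong (run w τ₂) (ex-sound d₁ (q ∷ k))) (ex-sound d₂ k))
ex-sound {w} {ifnz e p q} {s} (e-if₁ {τ = τ} e≡ d) k with eval w s e
... | suc _ = ex-sound d k
ex-sound {w} {ifnz e p q} {s} (e-if₀ {τ = τ} e≡ d) k with eval w s e
... | zero = ex-sound d k
ex-sound {w} {while e p} {s} (e-wh₁ {τ₁ = τ₁} {τ₂} e≡ d₁ d₂) k with eval w s e
... | suc _ = trans (run-+ w τ₁ τ₂ (p ∷ while e p ∷ k , s))
                    (trans (cong (run w τ₂) (ex-sound d₁ (while e p ∷ k))) (ex-sound d₂ k))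
ex-sound {w} {while e p} {s} (e-wh₀ e≡) k with eval w s e
... | zero = refl

∨-false : ∀ {a b} → (a ∨ b) ≡ false → a ≡ false × b ≡ false
∨-false {false} e≡ = refl , e≡

frameV : ∀ {w c s s′ τ} → Ex w c s s′ τ → ∀ x → modV c x ≡ false → vars s′ x ≡ vars s x
frameV e-skip x m = refl
frameV {c = y ≔ _} (e-asg _) x m rewrite m = refl
frameV (e-put _ _) x m = refl
frameV (e-seq d₁ d₂) x m =
  trans (frameV d₂ x (proj₂ (∨-false m))) (frameV d₁ x (proj₁ (∨-false m)))
frameV (e-if₁ _ d) x m = frameV d x (proj₁ (∨-false m))
frameV (e-if₀ _ d) x m = frameV d x (proj₂ (∨-false m))
frameV (e-wh₁ _ d₁ d₂) x m = trans (frameV d₂ x m) (frameV d₁ x m)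
frameV (e-wh₀ _) x m = refl

frameA : ∀ {w c s s′ τ} → Ex w c s s′ τ → ∀ a → modA c a ≡ false → arrays s′ a ≡ arrays s a
frameA e-skip a m = refl
frameA (e-asg _) a m = refl
frameA {c = put b _ _} (e-put _ _) a m rewrite m = refl
frameA (e-seq d₁ d₂) a m =
  trans (frameA d₂ a (proj₂ (∨-false m))) (frameA d₁ a (proj₁ (∨-false m)))
frameA (e-if₁ _ d) a m = frameA d a (proj₁ (∨-false m))
frameA (e-if₀ _ d) a m = frameA d a (proj₂ (∨-false m))
frameA (e-wh₁ _ d₁ d₂) a m = trans (frameA d₂ a m) (frameA d₁ a m)
frameA (e-wh₀ _) a m = refl

-- A record and not a bare equation: `eval w s e` would reduce, and unification could no longer
-- recover `e` from the type.
record Ev (w : ℕ) (s : State) (e : Expr) (v : ℕ) : Set where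
  constructor ev
  field
    value : eval w s e ≡ v

bit<2 : ∀ b → bit b < 2
bit<2 true  = ≤-refl
bit<2 false = s≤s z≤n

-- A total-correctness triple with a time bound. The postcondition of one command may be a `Run` of
-- the next one, which is how sequences are composed.
Run : ℕ → Cmd → State → ℕ → (State → Set) → Set
Run w c s T P = Σ State λ s′ → Σ ℕ λ τ → Ex w c s s′ τ × τ ≤ T × P s′

FrameV FrameA : Cmd → State → State → Set
FrameV c s s′ = ∀ x → modV c x ≡ false → vars s′ x ≡ vars s x
FrameA c s s′ = ∀ a → modA c a ≡ false → arrays s′ a ≡ arrays s a

module _ {w : ℕ} where

  weaken : ∀ {c s T T′ P} → T ≤ T′ → Run w c s T P → Run w c s T′ P
  weaken le (s′ , τ , d , b , p) = s′ , τ , d , ≤-trans b le , p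

  framed : ∀ {c s T P P′} → Run w c s T P →
    (∀ s′ → FrameV c s s′ → FrameA c s s′ → P s′ → P′ s′) → Run w c s T P′
  framed (s′ , τ , d , b , p) f = s′ , τ , d , b , f s′ (frameV d) (frameA d) p

  skip-run : ∀ {s} {P : State → Set} → P s → Run w skip s 1 P
  skip-run {s} p = s , 1 , e-skip , ≤-refl , p

  asg : ∀ {s x e v} {P : State → Set} → Ev w s e v → P (setVar x v s) → Run w (x ≔ e) s 1 P
  asg (ev e≡) p = _ , 1 , e-asg e≡ , ≤-refl , p

  put-run : ∀ {s a i e j v} {P : State → Set} → Ev w s i j → Ev w s e v →
    P (setCell a j v s) → Run w (put a i e) s 1 P
  put-run (ev eqi) (ev e≡) p = _ , 1 , e-put eqi e≡ , ≤-refl , p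

  seq-run : ∀ {p q s T₁ T₂ P} → Run w p s T₁ (λ s₁ → Run w q s₁ T₂ P) →
    Run w (p ⨟ q) s (suc (T₁ + T₂)) P
  seq-run (s₁ , τ₁ , d₁ , b₁ , s₂ , τ₂ , d₂ , b₂ , p) = s₂ , suc (τ₁ + τ₂) , e-seq d₁ d₂ , s≤s (+-mono-≤ b₁ b₂) , p

  asg⨟ : ∀ {s x e v q T} {P : State → Set} → Ev w s e v → Run w q (setVar x v s) T P →
    Run w ((x ≔ e) ⨟ q) s (2 + T) P
  asg⨟ e≡ r = seq-run (asg e≡ r)

  put⨟ : ∀ {s a i e j v q T} {P : State → Set} → Ev w s i j → Ev w s e v →
    Run w q (setCell a j v s) T P → Run w (put a i e ⨟ q) s (2 + T) P
  put⨟ eqi e≡ r = seq-run (put-run eqi e≡ r)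

  call⨟ : ∀ {p q s T₁ T₂ P P′} → Run w p s T₁ P →
    (∀ s′ → FrameV p s s′ → FrameA p s s′ → P s′ → Run w q s′ T₂ P′) →
    Run w (p ⨟ q) s (suc (T₁ + T₂)) P′
  call⨟ r f = seq-run (framed r f)

  if₁ : ∀ {s e p q T v} {P : State → Set} → Ev w s e (suc v) → Run w p s T P →
    Run w (ifnz e p q) s (suc T) P
  if₁ (ev e≡) (s′ , τ , d , b , pr) = s′ , suc τ , e-if₁ e≡ d , s≤s b , pr

  if₀ : ∀ {s e p q T} {P : State → Set} → Ev w s e 0 → Run w q s T P →
    Run w (ifnz e p q) s (suc T) P
  if₀ (ev e≡) (s′ , τ , d , b , pr) = s′ , suc τ , e-if₀ e≡ d , s≤s b , pr

  -- The invariant is indexed by the time spent so far.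
  while-elapsed : ∀ {e c} {P : State → Set} (Inv : ℕ → State → Set) (B : ℕ) →
    (∀ b s → Inv b s → b ≤ B) →
    (∀ b s → Inv b s → (Ev w s e 0 × P s)
      ⊎ (∃[ v ] ∃[ T ] (Ev w s e (suc v) × Run w c s T (Inv (b + suc T))))) →
    ∀ {s} → Inv 0 s → Run w (while e c) s (suc B) P
  while-elapsed {e} {c} {P} Inv B bound stp {s₀} inv₀ = go B 0 s₀ inv₀ (≤-reflexive (+-comm 0 B))
    where
    -- `f` is fuel: each round raises the elapsed time `b` by at least one, so with the fuel spent
    -- another round would push `b` past `B`.
    go : ∀ f b s → Inv b s → B ≤ f + b → Run w (while e c) s (suc (B ∸ b)) P
    go f b s inv le with stp b s inv
    ... | inj₁ (ev e≡ , p) = s , 1 , e-wh₀ e≡ , s≤s z≤n , p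
    go zero b s inv le | inj₂ (v , T , ev e≡ , s₁ , τ₁ , d₁ , b₁ , inv₁) =
      contradiction (≤-trans (bound (b + suc T) s₁ inv₁) le) (<⇒≱ (m<m+n b (s≤s z≤n)))
    go (suc f) b s inv le | inj₂ (v , T , ev e≡ , s₁ , τ₁ , d₁ , b₁ , inv₁)
      with go f (b + suc T) s₁ inv₁
             (≤-trans le (≤-trans (≤-reflexive (sym (+-suc f b))) (+-monoʳ-≤ f (subst (suc b ≤_) (sym (+-suc b T)) (s≤s (m≤m+n b T))))))
    ... | s₂ , τ₂ , d₂ , b₂ , p =
      s₂ , suc (τ₁ + τ₂) , e-wh₁ e≡ d₁ d₂ , s≤s (≤-trans (+-mono-≤ b₁ b₂) lem) , p
      where
      lem : T + suc (B ∸ (b + suc T)) ≤ B ∸ b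
      lem = ≤-reflexive (begin
        T + suc (B ∸ (b + suc T))   ≡⟨ +-suc T _ ⟩
        suc T + (B ∸ (b + suc T))   ≡⟨ cong (suc T +_) (sym (∸-+-assoc B b (suc T))) ⟩
        suc T + ((B ∸ b) ∸ suc T)   ≡⟨ m+[n∸m]≡n (m+n≤o⇒n≤o∸m′) ⟩
        B ∸ b                       ∎)
        where
        open ≡-Reasoning
        m+n≤o⇒n≤o∸m′ : suc T ≤ B ∸ b
        m+n≤o⇒n≤o∸m′ = m+n≤o⇒m≤o∸n (suc T) (subst (_≤ B) (+-comm b (suc T)) (bound _ s₁ inv₁))

  while-list : ∀ {A : Set} {e c} {P : State → Set} (Inv : List A → State → Set) (cost : A → ℕ) →
    (∀ s → Inv [] s → Ev w s e 0 × P s) →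
    (∀ q Q s → Inv (q ∷ Q) s → ∃[ v ] (Ev w s e (suc v) × Run w c s (cost q) (Inv Q))) →
    ∀ Q {s} → Inv Q s → Run w (while e c) s (suc (∑ (λ q → suc (cost q)) Q)) P
  while-list Inv cost stop stp [] {s} inv with stop s inv
  ... | ev e≡ , p = s , 1 , e-wh₀ e≡ , ≤-refl , p
  while-list Inv cost stop stp (q ∷ Q) {s} inv with stp q Q s inv
  ... | v , ev e≡ , s₁ , τ₁ , d₁ , b₁ , inv₁ with while-list Inv cost stop stp Q inv₁
  ... | s₂ , τ₂ , d₂ , b₂ , p = s₂ , suc (τ₁ + τ₂) , e-wh₁ e≡ d₁ d₂
      , s≤s (≤-trans (+-mono-≤ b₁ b₂) (≤-reflexive (+-suc (cost q) _))) , p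

  -- The index `r` only bounds the number of rounds: the loop may stop earlier, as it does when a
  -- threshold is halved down to 0.
  while-count : ∀ {e c} {P : State → Set} (Inv : ℕ → State → Set) (C : ℕ) →
    (∀ r s → Inv r s → (Ev w s e 0 × P s)
      ⊎ (∃[ r′ ] ∃[ v ] (r ≡ suc r′ × Ev w s e (suc v) × Run w c s C (Inv r′)))) →
    ∀ r {s} → Inv r s → Run w (while e c) s (suc (r * suc C)) P
  while-count Inv C stp r {s} inv with stp r s inv
  ... | inj₁ (ev e≡ , p) = s , 1 , e-wh₀ e≡ , s≤s z≤n , p
  while-count Inv C stp (suc r) {s} inv | inj₂ (r , v , refl , ev e≡ , s₁ , τ₁ , d₁ , b₁ , inv₁)
    with while-count Inv C stp r inv₁
  ... | s₂ , τ₂ , d₂ , b₂ , p = s₂ , suc (τ₁ + τ₂) , e-wh₁ e≡ d₁ d₂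
      , s≤s (≤-trans (+-mono-≤ b₁ b₂) (≤-reflexive (+-suc C _))) , p

  wrap-small : ∀ {x} → x < 2 ^ w → wrap w x ≡ x
  wrap-small = m<n⇒m%n≡m {{m^n≢0 2 w}}

  ev-lit : ∀ {s k} → k < 2 ^ w → Ev w s (lit k) k
  ev-lit l< = ev (wrap-small l<)

  ev-var : ∀ {s x v} → vars s x ≡ v → Ev w s (var x) v
  ev-var = ev

  ev-get : ∀ {s a e j v} → Ev w s e j → arrays s a j ≡ v → Ev w s (get a e) v
  ev-get (ev refl) e≡ = ev e≡

  ev-add : ∀ {s e f a b} → Ev w s e a → Ev w s f b → a + b < 2 ^ w → Ev w s (bin add e f) (a + b)
  ev-add (ev refl) (ev refl) l< = ev (wrap-small l<)

  ev-mul : ∀ {s e f a b} → Ev w s e a → Ev w s f b → a * b < 2 ^ w → Ev w s (bin mul e f) (a * b)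
  ev-mul (ev refl) (ev refl) l< = ev (wrap-small l<)

  ev-sub : ∀ {s e f a b} → Ev w s e a → Ev w s f b → Ev w s (bin sub e f) (a ∸ b)
  ev-sub (ev refl) (ev refl) = ev refl

  ev-half : ∀ {s e f a} → Ev w s e a → Ev w s f 2 → Ev w s (bin quo e f) (a / 2)
  ev-half {s} {f = f} (ev refl) (ev e≡) with eval w s f in e≡′
  ev-half {f = f} (ev refl) (ev refl) | suc (suc zero) = ev (quo-2 _ e≡′)
    where
    quo-2 : ∀ {y} x → y ≡ 2 → apply w quo x y ≡ x / 2
    quo-2 x refl = refl

  ev-eq : ∀ {s e f a b} → 2 ≤ 2 ^ w → Ev w s e a → Ev w s f b → Ev w s (bin eq e f) [ a ≣ b ]
  ev-eq le (ev refl) (ev refl) = ev (wrap-small (<-≤-trans (bit<2 _) le))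

  ev-lt : ∀ {s e f a b} → 2 ≤ 2 ^ w → Ev w s e a → Ev w s f b → Ev w s (bin lt e f) (bit (a <ᵇ b))
  ev-lt le (ev refl) (ev refl) = ev (wrap-small (<-≤-trans (bit<2 _) le))

  ev-≡ : ∀ {s e a b} → a ≡ b → Ev w s e a → Ev w s e b
  ev-≡ refl v = v

-- Sums over lists and double counting

[≣]-sym : ∀ a b → [ a ≣ b ] ≡ [ b ≣ a ]
[≣]-sym a b with a ≟ b
... | yes refl = refl
... | no a≢b   = trans ([≣]-≢ a≢b) (sym ([≣]-≢ (a≢b ∘ sym)))

[≣]-positive : ∀ a b → 1 ≤ [ a ≣ b ] → a ≡ b
[≣]-positive a b le with a ≟ b
... | yes a≡b = a≡b
... | no a≢b  = contradiction le (subst (λ k → ¬ (1 ≤ k)) (sym ([≣]-≢ a≢b)) λ ())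

module _ {A : Set} where

  ∑-mono : ∀ {f g : A → ℕ} Q → (∀ {q} → q ∈ Q → f q ≤ g q) → ∑ f Q ≤ ∑ g Q
  ∑-mono []      le = z≤n
  ∑-mono (q ∷ Q) le = +-mono-≤ (le (here refl)) (∑-mono Q (le ∘ there))

  ∑-cong : ∀ {f g : A → ℕ} Q → (∀ {q} → q ∈ Q → f q ≡ g q) → ∑ f Q ≡ ∑ g Q
  ∑-cong []      e = refl
  ∑-cong (q ∷ Q) e = cong₂ _+_ (e (here refl)) (∑-cong Q (e ∘ there))

  ∑-zero : ∀ (Q : List A) → ∑ (λ _ → 0) Q ≡ 0
  ∑-zero []      = refl
  ∑-zero (q ∷ Q) = ∑-zero Q

  ∑-+ : ∀ (f g : A → ℕ) Q → ∑ (λ q → f q + g q) Q ≡ ∑ f Q + ∑ g Q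
  ∑-+ f g []      = refl
  ∑-+ f g (q ∷ Q) = trans (cong (f q + g q +_) (∑-+ f g Q)) (+-CS.interchange (f q) (g q) _ _)

  ∑-* : ∀ c (f : A → ℕ) Q → ∑ (λ q → c * f q) Q ≡ c * ∑ f Q
  ∑-* c f []      = sym (*-zeroʳ c)
  ∑-* c f (q ∷ Q) = trans (cong (c * f q +_) (∑-* c f Q)) (sym (*-distribˡ-+ c (f q) _))

  ∑-const : ∀ c (Q : List A) → ∑ (λ _ → c) Q ≡ length Q * c
  ∑-const c []      = refl
  ∑-const c (q ∷ Q) = cong (c +_) (∑-const c Q)

  ∑-≤-const : ∀ {f : A → ℕ} {c} Q → (∀ {q} → q ∈ Q → f q ≤ c) → ∑ f Q ≤ length Q * c
  ∑-≤-const {c = c} Q le = ≤-trans (∑-mono Q le) (≤-reflexive (∑-const c Q))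

  ∑-++ : ∀ (f : A → ℕ) P Q → ∑ f (P ++ Q) ≡ ∑ f P + ∑ f Q
  ∑-++ f []      Q = refl
  ∑-++ f (p ∷ P) Q = trans (cong (f p +_) (∑-++ f P Q)) (sym (+-assoc (f p) _ _))

  ∑-∈ : ∀ (f : A → ℕ) {Q q} → q ∈ Q → f q ≤ ∑ f Q
  ∑-∈ f (here refl)         = m≤m+n _ _
  ∑-∈ f {p ∷ Q} (there q∈Q) = ≤-trans (∑-∈ f q∈Q) (m≤n+m _ (f p))

  ∑-positive : ∀ (f : A → ℕ) Q → 1 ≤ ∑ f Q → ∃[ q ] (q ∈ Q × 1 ≤ f q)
  ∑-positive f (q ∷ Q) le with f q in e≡
  ... | suc k = q , here refl , subst (1 ≤_) (sym e≡) (s≤s z≤n)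
  ... | zero with ∑-positive f Q le
  ...   | p , p∈Q , pos = p , there p∈Q , pos

  -- No term has slack with which to make up for a strict inequality elsewhere. This is the
  -- pigeonhole step that turns "the list is full" into a statement about every single item or key.
  ∑-tight : ∀ {f g : A → ℕ} Q → (∀ {q} → q ∈ Q → f q ≤ g q) → ∑ g Q ≤ ∑ f Q →
    ∀ {q} → q ∈ Q → g q ≤ f q
  ∑-tight {f} {g} (p ∷ Q) le ge (here refl) = +-cancelʳ-≤ (∑ f Q) _ _
    (≤-trans (+-monoʳ-≤ (g p) (∑-mono Q (le ∘ there))) ge)
  ∑-tight {f} {g} (p ∷ Q) le ge (there q∈Q) = ∑-tight Q (le ∘ there)
    (+-cancelˡ-≤ (f p) _ _ (≤-trans (+-monoˡ-≤ (∑ g Q) (le (here refl))) ge)) q∈Q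

  ∑-swap : ∀ {B : Set} (R : A → B → ℕ) Q P →
    ∑ (λ a → ∑ (R a) P) Q ≡ ∑ (λ b → ∑ (λ a → R a b) Q) P
  ∑-swap R []      P = sym (trans (∑-cong′ P) (∑-zero′ P))
    where
    ∑-cong′ : ∀ P → ∑ (λ b → ∑ (λ a → R a b) []) P ≡ ∑ (λ _ → 0) P
    ∑-cong′ P = refl
    ∑-zero′ : ∀ P → ∑ (λ _ → 0) P ≡ 0
    ∑-zero′ []      = refl
    ∑-zero′ (_ ∷ P) = ∑-zero′ P
  ∑-swap {B} R (q ∷ Q) P = trans (cong (∑ (R q) P +_) (∑-swap R Q P)) (sym (plus P))
    where
    plus : ∀ P → ∑ (λ b → R q b + ∑ (λ a → R a b) Q) P ≡ ∑ (R q) P + ∑ (λ b → ∑ (λ a → R a b) Q) P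
    plus []      = refl
    plus (b ∷ P) = trans (cong (R q b + _ +_) (plus P)) (+-CS.interchange (R q b) _ _ _)

∑-delta : ∀ {n y} (g : ℕ → ℕ) → y < n → ∑ (λ x → [ y ≣ x ] * g x) (downFrom n) ≡ g y
∑-delta {suc n} {y} g y<1+n with y ≟ n
... | yes refl = begin
  [ y ≣ y ] * g y + ∑ (λ x → [ y ≣ x ] * g x) (downFrom y)
    ≡⟨ cong₂ (λ a b → a * g y + b) ([≣]-refl y) (∑-cong (downFrom y) below) ⟩
  1 * g y + ∑ (λ _ → 0) (downFrom y)
    ≡⟨ cong₂ _+_ (*-identityˡ (g y)) (∑-zero (downFrom y)) ⟩
  g y + 0 ≡⟨ +-identityʳ (g y) ⟩
  g y ∎
  where
  open ≡-Reasoning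
  below : ∀ {x} → x ∈ downFrom y → [ y ≣ x ] * g x ≡ 0
  below x∈ = cong (_* g _) ([≣]-≢ (λ y≡x → <⇒≢ (∈-downFrom⁻ x∈) (sym y≡x)))
... | no y≢n = trans (cong (λ a → a * g n + ∑ (λ x → [ y ≣ x ] * g x) (downFrom n)) ([≣]-≢ y≢n))
                     (∑-delta g (≤∧≢⇒< (s≤s⁻¹ y<1+n) y≢n))

-- `∑-delta` spreads each term over `downFrom X`, and then the two sums are exchanged. Most counting
-- arguments below are instances, with the vertex or the key of an item as `k`.
∑-fiber : ∀ {A : Set} {X} (k : A → ℕ) (g : A → ℕ) Q → (∀ {q} → q ∈ Q → k q < X) →
  ∑ g Q ≡ ∑ (λ x → ∑ (λ q → [ k q ≣ x ] * g q) Q) (downFrom X)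
∑-fiber {X = X} k g Q bound = trans
  (∑-cong Q (λ {q} q∈Q → sym (∑-delta (λ _ → g q) (bound q∈Q))))
  (∑-swap (λ q x → [ k q ≣ x ] * g q) Q (downFrom X))

-- The order is preserved, since `Stored` derives addresses from positions.
sel : {A : Set} → (A → ℕ) → ℕ → List A → List A
sel k y []      = []
sel k y (q ∷ Q) = if k q ≡ᵇ y then q ∷ sel k y Q else sel k y Q

module _ {A : Set} (k : A → ℕ) where

  sel-yes : ∀ {y q} Q → k q ≡ y → sel k y (q ∷ Q) ≡ q ∷ sel k y Q
  sel-yes {q = q} Q refl rewrite ≡ᵇ-refl (k q) = refl

  sel-no : ∀ {y q} Q → k q ≢ y → sel k y (q ∷ Q) ≡ sel k y Q
  sel-no Q ne rewrite ≢⇒≡ᵇ-false ne = refl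

  ∑-sel : ∀ y (g : A → ℕ) Q → ∑ g (sel k y Q) ≡ ∑ (λ q → [ k q ≣ y ] * g q) Q
  ∑-sel y g []      = refl
  ∑-sel y g (q ∷ Q) with k q ≡ᵇ y
  ... | true  = cong₂ _+_ (sym (+-identityʳ (g q))) (∑-sel y g Q)
  ... | false = ∑-sel y g Q

  length-sel : ∀ y Q → length (sel k y Q) ≡ ∑ (λ q → [ k q ≣ y ]) Q
  length-sel y []      = refl
  length-sel y (q ∷ Q) with k q ≡ᵇ y
  ... | true  = cong suc (length-sel y Q)
  ... | false = length-sel y Q

  length-sel-≤ : ∀ y Q → length (sel k y Q) ≤ length Q
  length-sel-≤ y []      = z≤n
  length-sel-≤ y (q ∷ Q) with k q ≡ᵇ y
  ... | true  = s≤s (length-sel-≤ y Q)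
  ... | false = m≤n⇒m≤1+n (length-sel-≤ y Q)

  ∈-sel⁺ : ∀ {y q Q} → q ∈ Q → k q ≡ y → q ∈ sel k y Q
  ∈-sel⁺ {Q = q ∷ Q} (here refl) refl rewrite ≡ᵇ-refl (k q) = here refl
  ∈-sel⁺ {y} {Q = p ∷ Q} (there q∈Q) e≡ with k p ≡ᵇ y
  ... | true  = there (∈-sel⁺ q∈Q e≡)
  ... | false = ∈-sel⁺ q∈Q e≡

  ∈-sel⁻ : ∀ {y q} Q → q ∈ sel k y Q → q ∈ Q × k q ≡ y
  ∈-sel⁻ {y} (p ∷ Q) q∈ with k p ≡ᵇ y in e≡
  ∈-sel⁻ {y} (p ∷ Q) (here refl) | true = here refl , ≡ᵇ-true⇒≡ (k p) y e≡
  ∈-sel⁻ {y} (p ∷ Q) (there q∈)  | true = there (proj₁ (∈-sel⁻ Q q∈)) , proj₂ (∈-sel⁻ Q q∈)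
  ∈-sel⁻ {y} (p ∷ Q) q∈          | false = there (proj₁ (∈-sel⁻ Q q∈)) , proj₂ (∈-sel⁻ Q q∈)

-- Paths, items and their multiplicities

data Path (arcs : List (ℕ × ℕ)) : ℕ → ℕ → ℕ → Set where
  nil  : ∀ {u} → Path arcs 0 u u
  cons : ∀ {l u v w} → (u , v) ∈ arcs → Path arcs l v w → Path arcs (suc l) u w

-- dst is the length of a walk from vtx to the source numbered key.
record Item : Set where
  constructor item
  field
    vtx key dst : ℕ

open Item public

mult : List Item → ℕ → ℕ → ℕ
mult Q y x = ∑ (λ q → [ vtx q ≣ y ] * [ key q ≣ x ]) Q

multLe : List Item → ℕ → ℕ → ℕ → ℕ
multLe Q y x l = ∑ (λ q → [ vtx q ≣ y ] * ([ key q ≣ x ] * bit (dst q ≤ᵇ l))) Q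

cnt : List Item → ℕ → ℕ
cnt Q y = length (sel vtx y Q)

cntLe : List Item → ℕ → ℕ → ℕ
cntLe Q y l = ∑ (λ q → [ vtx q ≣ y ] * bit (dst q ≤ᵇ l)) Q

bit-mono : ∀ d {k l} → k ≤ l → bit (d ≤ᵇ k) ≤ bit (d ≤ᵇ l)
bit-mono d {k} {l} k≤l with d ≤ᵇ k in e≡
... | false = z≤n
... | true with d ≤ᵇ l in e≡′
...   | true  = ≤-refl
...   | false = contradiction (≤⇒≤ᵇ (≤-trans (≤ᵇ⇒≤ d k (subst T (sym e≡) tt)) k≤l)) (subst (λ b → ¬ T b) (sym e≡′) λ ())

bit-≤1 : ∀ b → bit b ≤ 1
bit-≤1 true  = ≤-refl
bit-≤1 false = z≤n

bit-≤ᵇ : ∀ {d l} → d ≤ l → bit (d ≤ᵇ l) ≡ 1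
bit-≤ᵇ {d} {l} d≤l with d ≤ᵇ l | ≤⇒≤ᵇ d≤l
... | true | _ = refl

bit-≤ᵇ⁻ : ∀ d l → 1 ≤ bit (d ≤ᵇ l) → d ≤ l
bit-≤ᵇ⁻ d l pos with d ≤ᵇ l in e≡
... | true = ≤ᵇ⇒≤ d l (subst T (sym e≡) tt)

*-positive : ∀ a b → 1 ≤ a * b → 1 ≤ a × 1 ≤ b
*-positive (suc a) (suc b) _ = s≤s z≤n , s≤s z≤n
*-positive (suc a) zero    p = contradiction (subst (1 ≤_) (*-zeroʳ a) p) λ ()

multLe-≤ : ∀ Q y x l → multLe Q y x l ≤ mult Q y x
multLe-≤ Q y x l = ∑-mono Q λ {q} _ →
  *-monoʳ-≤ [ vtx q ≣ y ] (≤-trans (*-monoʳ-≤ [ key q ≣ x ] (bit-≤1 (dst q ≤ᵇ l))) (≤-reflexive (*-identityʳ _)))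

mult⁺ : ∀ {Q q} → q ∈ Q → 1 ≤ mult Q (vtx q) (key q)
mult⁺ {Q} {q} q∈Q = ≤-trans (≤-reflexive (sym (cong₂ _*_ ([≣]-refl (vtx q)) ([≣]-refl (key q)))))
  (∑-∈ (λ p → [ vtx p ≣ vtx q ] * [ key p ≣ key q ]) q∈Q)

mult⁻ : ∀ Q y x → 1 ≤ mult Q y x → ∃[ k ] item y x k ∈ Q
mult⁻ Q y x pos with ∑-positive _ Q pos
... | item y′ x′ k , q∈Q , p with *-positive [ y′ ≣ y ] [ x′ ≣ x ] p
...   | p₁ , p₂ with [≣]-positive y′ y p₁ | [≣]-positive x′ x p₂
...     | refl | refl = k , q∈Q

multLe⁺ : ∀ {Q y x k l} → item y x k ∈ Q → k ≤ l → 1 ≤ multLe Q y x l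
multLe⁺ {Q} {y} {x} {k} {l} q∈Q k≤l = ≤-trans
  (≤-reflexive (sym (cong₂ _*_ ([≣]-refl y) (cong₂ _*_ ([≣]-refl x) (bit-≤ᵇ k≤l)))))
  (∑-∈ (λ p → [ vtx p ≣ y ] * ([ key p ≣ x ] * bit (dst p ≤ᵇ l))) q∈Q)

multLe⁻ : ∀ Q y x l → 1 ≤ multLe Q y x l → ∃[ k ] (k ≤ l × item y x k ∈ Q)
multLe⁻ Q y x l pos with ∑-positive _ Q pos
... | item y′ x′ k , q∈Q , p with *-positive [ y′ ≣ y ] _ p
...   | p₁ , p₂ with *-positive [ x′ ≣ x ] _ p₂
...     | p₃ , p₄ with [≣]-positive y′ y p₁ | [≣]-positive x′ x p₃
...       | refl | refl = k , bit-≤ᵇ⁻ k l p₄ , q∈Q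

cntLe-mono : ∀ Q y {k l} → k ≤ l → cntLe Q y k ≤ cntLe Q y l
cntLe-mono Q y k≤l = ∑-mono Q λ {q} _ → *-monoʳ-≤ [ vtx q ≣ y ] (bit-mono (dst q) k≤l)

cntLe-≤cnt : ∀ Q y l → cntLe Q y l ≤ cnt Q y
cntLe-≤cnt Q y l = ≤-trans
  (∑-mono Q λ {q} _ → ≤-trans (*-monoʳ-≤ [ vtx q ≣ y ] (bit-≤1 (dst q ≤ᵇ l))) (≤-reflexive (*-identityʳ _)))
  (≤-reflexive (sym (length-sel vtx y Q)))

cntLe-all : ∀ Q y l → All (λ q → dst q ≤ l) Q → cnt Q y ≤ cntLe Q y l
cntLe-all Q y l le = ≤-reflexive (trans (length-sel vtx y Q)
  (∑-cong Q λ {q} q∈Q → sym (trans (cong ([ vtx q ≣ y ] *_) (bit-≤ᵇ (All.lookup le q∈Q))) (*-identityʳ _))))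

cntLe-fiber : ∀ {X} Q y l → (∀ {q} → q ∈ Q → key q < X) →
  cntLe Q y l ≡ ∑ (λ x → multLe Q y x l) (downFrom X)
cntLe-fiber {X} Q y l bound = trans (∑-fiber key _ Q bound)
  (∑-cong (downFrom X) λ {x} _ → ∑-cong Q λ {q} _ → lemma [ key q ≣ x ] [ vtx q ≣ y ] (bit (dst q ≤ᵇ l)))
  where
  lemma : ∀ a b c → a * (b * c) ≡ b * (a * c)
  lemma a b c = trans (sym (*-assoc a b c)) (trans (cong (_* c) (*-comm a b)) (*-assoc b a c))

-- Truncated flooding

deg : List (ℕ × ℕ) → ℕ → ℕ
deg arcs y = length (sel proj₁ y arcs)

deg-positive : ∀ {arcs y w} → (y , w) ∈ arcs → 1 ≤ deg arcs y
deg-positive {arcs} {y} {w} yw∈ with sel proj₁ y arcs | ∈-sel⁺ proj₁ yw∈ refl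
... | _ ∷ _ | _ = s≤s z≤n

-- Both floods are instances. For the lists, keys are vertices, `root` is the identity and `cap` is
-- `κ`. For the pivots, keys are pivot numbers, `root` looks up the pivot, and `cap` equals `X`.
-- `IsKey` lets the first flood remember that each key belongs to a source.
module Flood (n : ℕ) (arcs : List (ℕ × ℕ))
             (arcs-sym : ∀ {y w} → (y , w) ∈ arcs → (w , y) ∈ arcs)
             (arcs-< : ∀ {y w} → (y , w) ∈ arcs → y < n)
             (X cap : ℕ) (root : ℕ → ℕ) (IsKey : ℕ → Set) where

  record Valid (q : Item) : Set where
    constructor valid
    field
      vtx<n : vtx q < n
      key<X : key q < X
      deg≥1 : 1 ≤ deg arcs (vtx q)
      isKey : IsKey (key q)
      walk  : Path arcs (dst q) (vtx q) (root (key q))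

  open Valid public

  -- A child lies one step beyond its parent, which was queued before it; so distances never exceed
  -- queue positions. With `length-≤` this keeps every stored distance within a word.
  Shallow : List Item → Set
  Shallow []      = ⊤
  Shallow (q ∷ Q) = dst q ≤ length Q × Shallow Q

  record Good (Q : List Item) : Set where
    constructor good
    field
      all-valid : All Valid Q
      mult≤1    : ∀ y x → mult Q y x ≤ 1
      cnt≤cap   : ∀ y → cnt Q y ≤ cap
      shallow   : Shallow Q

  open Good public

  -- A refusal carries its reason, because completeness treats a key already present and a list
  -- already full differently.
  data Pushed (Q : List Item) (q : Item) : List Item → Set where
    pushed : mult Q (vtx q) (key q) ≡ 0 → cnt Q (vtx q) < cap → Pushed Q q (q ∷ Q)
    kept   : 1 ≤ mult Q (vtx q) (key q) ⊎ cap ≤ cnt Q (vtx q) → Pushed Q q Q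

  good-[] : Good []
  good-[] = good [] (λ _ _ → z≤n) (λ _ → z≤n) tt

  good-push : ∀ {Q q Q′} → Good Q → Valid q → dst q ≤ length Q → Pushed Q q Q′ → Good Q′
  good-push g v d (kept _) = g
  good-push {Q} {q} g v d (pushed fresh room) = good (v ∷ all-valid g) once few (d , shallow g)
    where
    once : ∀ y x → mult (q ∷ Q) y x ≤ 1
    once y x with vtx q ≟ y | key q ≟ x
    ... | no y≢ | _ = ≤-trans (≤-reflexive (cong (λ a → a * [ key q ≣ x ] + mult Q y x) ([≣]-≢ y≢))) (mult≤1 g y x)
    ... | yes _ | no x≢ = ≤-trans (≤-reflexive (cong (_+ mult Q y x)
          (trans (cong ([ vtx q ≣ y ] *_) ([≣]-≢ x≢)) (*-zeroʳ [ vtx q ≣ y ])))) (mult≤1 g y x)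
    ... | yes refl | yes refl = ≤-trans (≤-reflexive (cong₂ (λ a b → a * b + mult Q y x) ([≣]-refl y) ([≣]-refl x)))
          (≤-reflexive (cong suc fresh))
    few : ∀ y → cnt (q ∷ Q) y ≤ cap
    few y with vtx q ≡ᵇ y in e≡
    ... | false = cnt≤cap g y
    ... | true  = subst (λ z → suc (cnt Q z) ≤ cap) (≡ᵇ-true⇒≡ (vtx q) y e≡) room

  length-≤ : ∀ {Q} → Good Q → length Q ≤ n * cap
  length-≤ {Q} g = begin
    length Q                                       ≡⟨ *-identityʳ _ ⟨
    length Q * 1                                   ≡⟨ ∑-const 1 Q ⟨
    ∑ (λ _ → 1) Q                                  ≡⟨ ∑-fiber vtx (λ _ → 1) Q (λ q∈Q → vtx<n (All.lookup (all-valid g) q∈Q)) ⟩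
    ∑ (λ y → ∑ (λ q → [ vtx q ≣ y ] * 1) Q) (downFrom n)
      ≤⟨ ∑-≤-const (downFrom n) (λ {y} _ → ≤-trans (≤-reflexive (trans (∑-cong Q λ _ → *-identityʳ _) (sym (length-sel vtx y Q)))) (cnt≤cap g y)) ⟩
    length (downFrom n) * cap                      ≡⟨ cong (_* cap) (length-downFrom n) ⟩
    n * cap                                        ∎
    where open ≤-Reasoning

  -- Charge each scanned neighbour to its arc: an arc out of `y` is scanned once for every item at
  -- `y`, hence at most `cap` times.
  ∑-deg-≤ : ∀ {Q} → Good Q → ∑ (λ q → deg arcs (vtx q)) Q ≤ length arcs * cap
  ∑-deg-≤ {Q} g = begin
    ∑ (λ q → deg arcs (vtx q)) Q
      ≡⟨ ∑-cong Q (λ {q} _ → length-sel proj₁ (vtx q) arcs) ⟩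
    ∑ (λ q → ∑ (λ e → [ proj₁ e ≣ vtx q ]) arcs) Q
      ≡⟨ ∑-swap (λ q e → [ proj₁ e ≣ vtx q ]) Q arcs ⟩
    ∑ (λ e → ∑ (λ q → [ proj₁ e ≣ vtx q ]) Q) arcs
      ≤⟨ ∑-≤-const arcs (λ {e} _ → ≤-trans (≤-reflexive (trans (∑-cong Q λ {q} _ → [≣]-sym (proj₁ e) (vtx q)) (sym (length-sel vtx (proj₁ e) Q)))) (cnt≤cap g (proj₁ e))) ⟩
    length arcs * cap ∎
    where open ≤-Reasoning

  -- Every queued vertex has an arc, so the constant cost `a` of an item is absorbed by its degree.
  -- The bound then involves the number of arcs but not `n`.
  cost-≤ : ∀ a b {Q} → Good Q → ∑ (λ q → a + b * deg arcs (vtx q)) Q ≤ (a + b) * (length arcs * cap)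
  cost-≤ a b {Q} g = begin
    ∑ (λ q → a + b * deg arcs (vtx q)) Q
      ≤⟨ ∑-mono Q (λ {q} q∈Q → ≤-trans (+-monoˡ-≤ _ (≤-trans (≤-reflexive (sym (*-identityʳ a))) (*-monoʳ-≤ a (deg≥1 (All.lookup (all-valid g) q∈Q)))))
           (≤-reflexive (sym (*-distribʳ-+ (deg arcs (vtx q)) a b)))) ⟩
    ∑ (λ q → (a + b) * deg arcs (vtx q)) Q ≡⟨ ∑-* (a + b) _ Q ⟩
    (a + b) * ∑ (λ q → deg arcs (vtx q)) Q ≤⟨ *-monoʳ-≤ (a + b) (∑-deg-≤ g) ⟩
    (a + b) * (length arcs * cap) ∎
    where open ≤-Reasoning

  -- A full vertex has enough items already and needs no item for the remaining keys.
  Full : List Item → ℕ → ℕ → Set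
  Full Q y l = cap ≤ cntLe Q y l

  Reached : List Item → ℕ → ℕ → ℕ → Set
  Reached Q y x l = (∃[ k ] (k ≤ l × item y x k ∈ Q)) ⊎ Full Q y l

  reached-∷ : ∀ {Q y x l} p → Reached Q y x l → Reached (p ∷ Q) y x l
  reached-∷ p (inj₁ (k , k≤l , q∈Q)) = inj₁ (k , k≤l , there q∈Q)
  reached-∷ p (inj₂ full)            = inj₂ (≤-trans full (m≤n+m _ _))

  reached-push : ∀ {Q q Q′ y x l} → Pushed Q q Q′ → Reached Q y x l → Reached Q′ y x l
  reached-push (pushed _ _) r = reached-∷ _ r
  reached-push (kept _)     r = r

  Closed : List Item → Item → ℕ → Set
  Closed Q q y = Reached Q y (key q) (suc (dst q))

  Settled : List Item → Item → Set
  Settled Q q = ∀ y → (vtx q , y) ∈ arcs → Closed Q q y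

  -- The invariant of breadth-first search. Lists grow at the front, so the next item to visit is
  -- the last of `new`. By `sorted` it is the nearest of the pending items, and by `near` nothing
  -- queued is more than one step beyond it.
  record Loop (Q new old : List Item) : Set where
    field
      split   : Q ≡ new ++ old
      isGood  : Good Q
      closed  : All (Settled Q) old
      sorted  : AllPairs (λ p q → dst q ≤ dst p) new
      near    : All (λ q → All (λ p → dst p ≤ suc (dst q)) Q) new

  record Visit (Q new : List Item) (q : Item) (old : List Item) (rest : List (ℕ × ℕ)) : Set where
    field
      split   : Q ≡ new ++ q ∷ old
      isGood  : Good Q
      closed  : All (Settled Q) old
      sorted  : AllPairs (λ p q → dst q ≤ dst p) new
      above   : All (λ p → dst q ≤ dst p) new
      near    : All (λ p → dst p ≤ suc (dst q)) Q
      done    : ∀ {y} → (vtx q , y) ∈ arcs → (vtx q , y) ∈ rest ⊎ Closed Q q y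
      todo    : All (λ e → e ∈ arcs × proj₁ e ≡ vtx q) rest

  ∈-split : ∀ {Q new old} {q : Item} → Q ≡ new ++ q ∷ old → q ∈ Q
  ∈-split {new = new} refl = ∈-++⁺ʳ new (here refl)

  -- Nothing queued is farther than the new item, so a duplicate is at most as far, and a list that
  -- refuses the item is full of items at most as far. Here the breadth-first order does its work.
  pushed-∈⊎full : ∀ {Q q Q′} → Good Q → All (λ p → dst p ≤ dst q) Q → Pushed Q q Q′ →
    Reached Q′ (vtx q) (key q) (dst q)
  pushed-∈⊎full {q = q} g le (pushed _ _) = inj₁ (dst q , ≤-refl , here refl)
  pushed-∈⊎full {Q} {q} g le (kept (inj₁ m≥1)) with mult⁻ Q (vtx q) (key q) m≥1
  ... | k , q∈Q = inj₁ (k , All.lookup le q∈Q , q∈Q)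
  pushed-∈⊎full {Q} {q} g le (kept (inj₂ full)) = inj₂ (≤-trans full (cntLe-all Q (vtx q) (dst q) le))

  sorted-last : ∀ {new q} → AllPairs (λ p q → dst q ≤ dst p) (new ∷ʳ q) →
    AllPairs (λ p q → dst q ≤ dst p) new × All (λ p → dst q ≤ dst p) new
  sorted-last {[]}      _        = [] , []
  sorted-last {p ∷ new} (a ∷ as) with AllP.++⁻ new a | sorted-last as
  ... | a₁ , (b ∷ []) | s , t = (a₁ ∷ s) , (b ∷ t)

  visit-start : ∀ {Q new q old} → Loop Q (new ∷ʳ q) old → Visit Q new q old (sel proj₁ (vtx q) arcs)
  visit-start {Q} {new} {q} {old} l = record
    { split  = trans (Loop.split l) (++-assoc new (q ∷ []) old)
    ; isGood = Loop.isGood l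
    ; closed = Loop.closed l
    ; sorted = proj₁ (sorted-last (Loop.sorted l))
    ; above  = proj₂ (sorted-last (Loop.sorted l))
    ; near   = All.lookup (Loop.near l) (∈-++⁺ʳ new (here refl))
    ; done   = λ e∈ → inj₁ (∈-sel⁺ proj₁ e∈ refl)
    ; todo   = All.tabulate (∈-sel⁻ proj₁ arcs)
    }

  visit-valid : ∀ {Q new q old y z rest} → Visit Q new q old ((y , z) ∷ rest) →
    Valid (item z (key q) (suc (dst q)))
  visit-valid {q = q} v with All.lookup (all-valid (Visit.isGood v)) (∈-split (Visit.split v)) | Visit.todo v
  ... | valid _ b _ d walk | (e∈ , refl) ∷ _ = valid (arcs-< (arcs-sym e∈)) b (deg-positive (arcs-sym e∈)) d (cons (arcs-sym e∈) walk)

  shallow-split : ∀ new {q old} → Shallow (new ++ q ∷ old) → dst q < length (new ++ q ∷ old)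
  shallow-split []        (d , _) = s≤s d
  shallow-split (p ∷ new) (_ , s) = m≤n⇒m≤1+n (shallow-split new s)

  shallow-∈ : ∀ {Q q} → Shallow Q → q ∈ Q → dst q ≤ length Q
  shallow-∈ (d , _)  (here refl) = ≤-trans d (n≤1+n _)
  shallow-∈ (_ , sh) (there q∈)  = ≤-trans (shallow-∈ sh q∈) (n≤1+n _)

  visit-dst : ∀ {Q new q old rest} → Visit Q new q old rest → suc (dst q) ≤ length Q
  visit-dst {new = new} v = subst (λ Q → Shallow Q → _ < length Q) (sym (Visit.split v))
    (shallow-split new) (shallow (Visit.isGood v))

  visit-step : ∀ {Q new q old y z rest} → Visit Q new q old ((y , z) ∷ rest) →
    ∀ {Q′} → Pushed Q (item z (key q) (suc (dst q))) Q′ → ∃[ new′ ] Visit Q′ new′ q old rest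
  visit-step {Q} {new} {q} {old} {y} {z} {rest} v {Q′} p = proj₁ (extend p) , record
    { split  = proj₁ (proj₂ (extend p))
    ; isGood = good-push (Visit.isGood v) (visit-valid v) (visit-dst v) p
    ; closed = All.map (λ {r} c y e∈ → reached-push {y = y} {key r} {suc (dst r)} p (c y e∈)) (Visit.closed v)
    ; sorted = proj₁ (proj₂ (proj₂ (extend p)))
    ; above  = proj₁ (proj₂ (proj₂ (proj₂ (extend p))))
    ; near   = proj₂ (proj₂ (proj₂ (proj₂ (extend p))))
    ; done   = done′
    ; todo   = All.tail (Visit.todo v)
    }
    where
    extend : ∀ {Q′} → Pushed Q (item z (key q) (suc (dst q))) Q′ → ∃[ new′ ] (Q′ ≡ new′ ++ q ∷ old
      × AllPairs (λ p q → dst q ≤ dst p) new′ × All (λ p → dst q ≤ dst p) new′ × All (λ p → dst p ≤ suc (dst q)) Q′)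
    extend (kept _)     = new , Visit.split v , Visit.sorted v , Visit.above v , Visit.near v
    extend (pushed _ _) = _ ∷ new , cong (_ ∷_) (Visit.split v)
      , AllP.++⁻ˡ new (subst (All _) (Visit.split v) (Visit.near v)) ∷ Visit.sorted v
      , n≤1+n _ ∷ Visit.above v , ≤-refl ∷ Visit.near v
    done′ : ∀ {y} → (vtx q , y) ∈ arcs → (vtx q , y) ∈ rest ⊎ Closed Q′ q y
    done′ e∈ with Visit.done v e∈
    ... | inj₁ (here refl)  = inj₂ (pushed-∈⊎full (Visit.isGood v) (Visit.near v) p)
    ... | inj₁ (there e∈′)  = inj₁ e∈′
    ... | inj₂ c            = inj₂ (reached-push p c)

  visit-end : ∀ {Q new q old} → Visit Q new q old [] → Loop Q new (q ∷ old)
  visit-end {Q} {new} {q} v = record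
    { split  = Visit.split v
    ; isGood = Visit.isGood v
    ; closed = close ∷ Visit.closed v
    ; sorted = Visit.sorted v
    ; near   = All.map (λ le → All.map (λ b → ≤-trans b (s≤s le)) (Visit.near v)) (Visit.above v)
    }
    where
    close : Settled Q q
    close y e∈ with Visit.done v e∈
    ... | inj₂ c = c

  loop-start : ∀ {Q} → Good Q → All (λ q → dst q ≡ 0) Q → Loop Q Q []
  loop-start {Q} g zeros = record
    { split  = sym (++-identityʳ Q)
    ; isGood = g
    ; closed = []
    ; sorted = sorted₀ zeros
    ; near   = All.map (λ _ → All.map (λ d≡0 → subst (_≤ _) (sym d≡0) z≤n) zeros) zeros
    }
    where
    sorted₀ : ∀ {Q} → All (λ q → dst q ≡ 0) Q → AllPairs (λ p q → dst q ≤ dst p) Q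
    sorted₀ []       = []
    sorted₀ (_ ∷ zs) = All.map (λ d≡0 → subst (_≤ _) (sym d≡0) z≤n) zs ∷ sorted₀ zs

  -- A neighbour of a full vertex receives all of its keys.
  full-step : ∀ {Q y w l} → Good Q → All (Settled Q) Q →
    (w , y) ∈ arcs → Full Q w l → Full Q y (suc l)
  full-step {Q} {y} {w} {l} g closed e∈ full with cap ≤? cntLe Q y (suc l)
  ... | yes f  = f
  ... | no ¬f = ≤-trans full (begin
    cntLe Q w l                                      ≡⟨ cntLe-fiber Q w l key< ⟩
    ∑ (λ x → multLe Q w x l) (downFrom X)            ≤⟨ ∑-mono (downFrom X) (λ {x} _ → transfer x) ⟩
    ∑ (λ x → multLe Q y x (suc l)) (downFrom X)      ≡⟨ cntLe-fiber Q y (suc l) key< ⟨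
    cntLe Q y (suc l)                                ∎)
    where
    open ≤-Reasoning
    key< : ∀ {q} → q ∈ Q → key q < X
    key< q∈Q = key<X (All.lookup (all-valid g) q∈Q)
    transfer : ∀ x → multLe Q w x l ≤ multLe Q y x (suc l)
    transfer x with multLe Q w x l in e≡
    ... | zero = z≤n
    ... | suc j with multLe⁻ Q w x l (subst (1 ≤_) (sym e≡) (s≤s z≤n))
    ...   | k , k≤l , q∈Q with All.lookup closed q∈Q y e∈
    ...     | inj₁ (k′ , k′≤ , q′∈Q) = ≤-trans (subst (_≤ 1) e≡ (≤-trans (multLe-≤ Q w x l) (mult≤1 g w x)))
                                               (multLe⁺ q′∈Q (≤-trans k′≤ (s≤s k≤l)))
    ...     | inj₂ f = contradiction (≤-trans f (cntLe-mono Q y (s≤s k≤l))) ¬f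

  -- Induction along the path, from the root outward. The neighbour `w` either has an item for `x`,
  -- whose visit settled `y`, or is full, and then `y` is full within one more step.
  complete : ∀ {Q} → Loop Q [] Q → ∀ {x} → item (root x) x 0 ∈ Q →
    ∀ {l y} → Path arcs l y (root x) → Reached Q y x l
  complete lp src nil = inj₁ (0 , z≤n , src)
  complete {Q} lp {x} src {suc l} {y} (cons {v = w} e∈ p) with complete lp src p
  ... | inj₂ full = inj₂ (full-step (Loop.isGood lp) (Loop.closed lp) (arcs-sym e∈) full)
  ... | inj₁ (k , k≤l , q∈Q) with All.lookup (Loop.closed lp) q∈Q y (arcs-sym e∈)
  ...   | inj₁ (k′ , k′≤ , q′∈Q) = inj₁ (k′ , ≤-trans k′≤ (s≤s k≤l) , q′∈Q)
  ...   | inj₂ full = inj₂ (≤-trans full (cntLe-mono Q y (s≤s k≤l)))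

  -- The list has at most `cap` items, and `cap` of them lie within `l`; so none is left to lie
  -- farther away.
  full-dst : ∀ {Q y l} → Good Q → Full Q y l → ∀ {q} → q ∈ Q → vtx q ≡ y → dst q ≤ l
  full-dst {Q} {y} {l} g full {q} q∈Q refl = bit-≤ᵇ⁻ (dst q) l
    (≤-trans (≤-trans (≤-reflexive (sym ([≣]-refl y))) (∑-tight Q le tight q∈Q))
             (≤-reflexive (trans (cong (_* bit (dst q ≤ᵇ l)) ([≣]-refl y)) (+-identityʳ _))))
    where
    le : ∀ {p} → p ∈ Q → [ vtx p ≣ y ] * bit (dst p ≤ᵇ l) ≤ [ vtx p ≣ y ]
    le {p} _ = ≤-trans (*-monoʳ-≤ [ vtx p ≣ y ] (bit-≤1 (dst p ≤ᵇ l))) (≤-reflexive (*-identityʳ _))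
    tight : ∑ (λ p → [ vtx p ≣ y ]) Q ≤ cntLe Q y l
    tight = ≤-trans (≤-reflexive (sym (length-sel vtx y Q))) (≤-trans (cnt≤cap g y) full)

  -- With room for all X keys nothing is ever refused.
  full-all : ∀ {Q y l x} → Good Q → X ≤ cap → Full Q y l → x < X → ∃[ k ] (k ≤ l × item y x k ∈ Q)
  full-all {Q} {y} {l} {x} g X≤cap full x<X = multLe⁻ Q y x l
    (∑-tight (downFrom X) le tight (∈-downFrom⁺ x<X))
    where
    le : ∀ {x} → x ∈ downFrom X → multLe Q y x l ≤ 1
    le {x} _ = ≤-trans (multLe-≤ Q y x l) (mult≤1 g y x)
    tight : ∑ (λ _ → 1) (downFrom X) ≤ ∑ (λ x → multLe Q y x l) (downFrom X)
    tight = ≤-trans (≤-reflexive (trans (∑-const 1 (downFrom X)) (trans (*-identityʳ _) (length-downFrom X))))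
      (≤-trans X≤cap (≤-trans full (≤-reflexive (cntLe-fiber Q y l (λ q∈Q → key<X (All.lookup (all-valid g) q∈Q))))))

  -- Keys do not repeat in a list, so a list with `X` items would contain every key, `x` included.
  room-for-fresh : ∀ {Q y x} → Good Q → X ≤ cap → x < X → mult Q y x ≡ 0 → cnt Q y < cap
  room-for-fresh {Q} {y} {x} g X≤cap x<X fresh with suc (cnt Q y) ≤? cap
  ... | yes r = r
  ... | no ¬r = contradiction (∑-tight (downFrom X) (λ {x} _ → mult≤1 g y x) tight (∈-downFrom⁺ x<X))
                              (subst (λ k → ¬ (1 ≤ k)) (sym fresh) λ ())
    where
    tight : ∑ (λ _ → 1) (downFrom X) ≤ ∑ (mult Q y) (downFrom X)
    tight = begin
      ∑ (λ _ → 1) (downFrom X) ≡⟨ trans (∑-const 1 (downFrom X)) (trans (*-identityʳ _) (length-downFrom X)) ⟩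
      X ≤⟨ X≤cap ⟩
      cap ≤⟨ ≮⇒≥ ¬r ⟩
      cnt Q y ≡⟨ length-sel vtx y Q ⟩
      ∑ (λ q → [ vtx q ≣ y ]) Q ≡⟨ ∑-fiber key _ Q (λ q∈Q → key<X (All.lookup (all-valid g) q∈Q)) ⟩
      ∑ (λ x → ∑ (λ q → [ key q ≣ x ] * [ vtx q ≣ y ]) Q) (downFrom X)
        ≡⟨ ∑-cong (downFrom X) (λ {x} _ → ∑-cong Q (λ {q} _ → *-comm [ key q ≣ x ] [ vtx q ≣ y ])) ⟩
      ∑ (mult Q y) (downFrom X) ∎
      where open ≤-Reasoning

-- Words and memory layout

-- Row `ρ` of class `c` in four interleaved tables whose rows have length `n`. As the class is the
-- low digit, every class can grow before the number of pivots is known. Opacity confines address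
-- arithmetic to the separation lemmas.
opaque
  addr : ℕ → ℕ → ℕ → ℕ → ℕ
  addr n c ρ y = (ρ * 4 + c) * n + y

  addr-≢ᶜ : ∀ n {c c′ ρ ρ′ y z} → c < 4 → c′ < 4 → y < n → z < n → c ≢ c′ →
    addr n c ρ y ≢ addr n c′ ρ′ z
  addr-≢ᶜ n {c} {c′} {ρ} {ρ′} c<4 c′<4 y<n z<n ne =
    idx-≢ˡ {ρ * 4 + c} {ρ′ * 4 + c′} y<n z<n (idx-≢ʳ {ρ} {ρ′} c<4 c′<4 ne)

  addr-≢ʳ : ∀ n {c ρ ρ′ y z} → y < n → z < n → ρ ≢ ρ′ → addr n c ρ y ≢ addr n c ρ′ z
  addr-≢ʳ n {c} {ρ} {ρ′} y<n z<n ne =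
    idx-≢ˡ {ρ * 4 + c} {ρ′ * 4 + c} y<n z<n (λ e≡ → ne (*-cancelʳ-≡ ρ ρ′ 4 (+-cancelʳ-≡ c (ρ * 4) (ρ′ * 4) e≡)))

  addr-≢ʸ : ∀ n {c ρ ρ′ y z} → y < n → z < n → y ≢ z → addr n c ρ y ≢ addr n c ρ′ z
  addr-≢ʸ n {c} {ρ} {ρ′} y<n z<n ne = idx-≢ʳ {ρ * 4 + c} {ρ′ * 4 + c} y<n z<n ne

  addr-< : ∀ {n c ρ b y} → c < 4 → y < n → ρ < b → addr n c ρ y < b * 4 * n
  addr-< {n} {c} {ρ} {b} c<4 y<n ρ<b = idx-< {ρ * 4 + c} {b * 4} y<n (idx-< {ρ} {b} c<4 ρ<b)

  addr-header : ∀ n → addr n 0 0 0 ≡ 0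
  addr-header n = refl

addrE : ℕ → ℕ → Expr → Expr → Expr
addrE nv c ρ y = bin add (bin mul (bin add (bin mul ρ (lit 4)) (lit c)) (var nv)) y

-- Values are kept below `j * n³` with `j < 64`. The cube is for addresses that combine a position
-- of size up to a multiple of n² with a vertex.
module Words (w n : ℕ) (n≥1 : 1 ≤ n) (room : 64 * (n * (n * n)) ≤ 2 ^ w) where

  n³ : ℕ
  n³ = n * (n * n)

  n≤n² : n ≤ n * n
  n≤n² = m≤m*n n n {{>-nonZero n≥1}}

  n²≤n³ : n * n ≤ n³
  n²≤n³ = m≤n*m (n * n) n {{>-nonZero n≥1}}

  n≤n³ : n ≤ n³
  n≤n³ = ≤-trans n≤n² n²≤n³

  1≤n³ : 1 ≤ n³
  1≤n³ = ≤-trans n≥1 n≤n³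

  fit : ∀ {v} j → v ≤ j * n³ → j < 64 → v < 2 ^ w
  fit {v} j v≤ j<64 = <-≤-trans (≤-<-trans v≤ (*-monoˡ-< n³ {{>-nonZero 1≤n³}} j<64)) room

  fit-lit : ∀ {v} → v < 64 → v < 2 ^ w
  fit-lit {v} v<64 = fit v (≤-trans (≤-reflexive (sym (*-identityʳ v))) (*-monoʳ-≤ v 1≤n³)) v<64

  2≤2^w : 2 ≤ 2 ^ w
  2≤2^w = fit-lit (s≤s (s≤s z≤n))

  ev-const : ∀ {s} k → k < 64 → Ev w s (lit k) k
  ev-const k k<64 = ev-lit (fit-lit k<64)

  ev-one : ∀ {s} → Ev w s (lit 1) 1
  ev-one = ev-const 1 (s≤s (s≤s z≤n))

  ev-zero : ∀ {s} → Ev w s (lit 0) 0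
  ev-zero = ev-const 0 (s≤s z≤n)

  ev-suc : ∀ {s e a} j → Ev w s e a → a ≤ j * n³ → suc j < 64 → Ev w s (bin add e (lit 1)) (suc a)
  ev-suc {a = a} j ea a≤ j<64 = ev-≡ (+-comm a 1) (ev-add ea ev-one
    (fit (suc j) (≤-trans (≤-reflexive (+-comm a 1)) (+-mono-≤ 1≤n³ a≤)) j<64))

  ev-pred : ∀ {s e a} → Ev w s e (suc a) → Ev w s (bin sub e (lit 1)) a
  ev-pred ea = ev-sub ea ev-one

  ev-idx : ∀ {s a e nv y f} j → Ev w s e a → Ev w s (var nv) n → Ev w s f y →
    y < n → suc a * n ≤ j * n³ → j < 64 → Ev w s (bin add (bin mul e (var nv)) f) (a * n + y)
  ev-idx {a = a} j ea en ef y<n le j<64 =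
    ev-add (ev-mul ea en (fit j (≤-trans (m≤n+m (a * n) n) le) j<64)) ef
      (fit j (≤-trans (<⇒≤ (idx-< {a} {suc a} y<n ≤-refl)) le) j<64)

  row-fit : ∀ {c ρ} → c < 4 → ρ < 4 * n → ρ * 4 + c < 16 * n
  row-fit {c} {ρ} c<4 ρ< = subst (ρ * 4 + c <_) (trans (*-comm (4 * n) 4) (sym (*-assoc 4 4 n)))
    (idx-< {ρ} {4 * n} c<4 ρ<)

  opaque
    unfolding addr

    ev-addr : ∀ {s c ρ e nv y f} → c < 4 → Ev w s e ρ → Ev w s (var nv) n → Ev w s f y →
      ρ < 4 * n → y < n → Ev w s (addrE nv c e f) (addr n c ρ y)
    ev-addr {c = c} {ρ} c<4 ee en ef ρ< y<n =
      ev-idx 16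
        (ev-add (ev-mul ee (ev-const 4 (m≤m+n 5 59)) (fit 16 (≤-trans (m≤m+n _ c) a≤) 16<64))
          (ev-const c (<-≤-trans c<4 (m≤m+n 4 60))) (fit 16 a≤ 16<64))
        en ef y<n
        (≤-trans (*-monoˡ-≤ n (row-fit c<4 ρ<)) (≤-trans (≤-reflexive (*-assoc 16 n n)) (*-monoʳ-≤ 16 n²≤n³)))
        16<64
      where
      16<64 : 16 < 64
      16<64 = m≤m+n 17 47
      a≤ : ρ * 4 + c ≤ 16 * n³
      a≤ = ≤-trans (<⇒≤ (row-fit c<4 ρ<)) (*-monoʳ-≤ 16 n≤n³)

module Update₄ (D : ℕ → ℕ) (i₁ v₁ i₂ v₂ i₃ v₃ i₄ v₄ : ℕ) where

  D₁ D₂ D₃ D₄ : ℕ → ℕ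
  D₁ = update D i₁ v₁
  D₂ = update D₁ i₂ v₂
  D₃ = update D₂ i₃ v₃
  D₄ = update D₃ i₄ v₄

  at₄ : D₄ i₄ ≡ v₄
  at₄ = update-same D₃ i₄ v₄

  at₃ : i₄ ≢ i₃ → D₄ i₃ ≡ v₃
  at₃ n₄ = trans (update-other D₃ v₄ n₄) (update-same D₂ i₃ v₃)

  at₂ : i₃ ≢ i₂ → i₄ ≢ i₂ → D₄ i₂ ≡ v₂
  at₂ n₃ n₄ = trans (update-other D₃ v₄ n₄) (trans (update-other D₂ v₃ n₃) (update-same D₁ i₂ v₂))

  at₁ : i₂ ≢ i₁ → i₃ ≢ i₁ → i₄ ≢ i₁ → D₄ i₁ ≡ v₁
  at₁ n₂ n₃ n₄ = trans (update-other D₃ v₄ n₄) (trans (update-other D₂ v₃ n₃)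
    (trans (update-other D₁ v₂ n₂) (update-same D i₁ v₁)))

  other : ∀ {j} → i₁ ≢ j → i₂ ≢ j → i₃ ≢ j → i₄ ≢ j → D₄ j ≡ D j
  other n₁ n₂ n₃ n₄ = trans (update-other D₃ v₄ n₄) (trans (update-other D₂ v₃ n₃)
    (trans (update-other D₁ v₂ n₂) (update-other D v₁ n₁)))

-- Distances are stored plus one and 0 means absent, which agrees with memory that starts out as
-- zero and is never cleared.
mval : List Item → ℕ → ℕ → ℕ
mval []      y x = 0
mval (q ∷ Q) y x = if (vtx q ≡ᵇ y) ∧ (key q ≡ᵇ x) then suc (dst q) else mval Q y x

mval-zero : ∀ Q y x → mval Q y x ≡ 0 → mult Q y x ≡ 0
mval-zero []      y x e≡ = refl
mval-zero (q ∷ Q) y x e≡ with vtx q ≡ᵇ y | key q ≡ᵇ x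
... | true  | false = mval-zero Q y x e≡
... | false | _     = mval-zero Q y x e≡

mval-suc : ∀ Q y x {d} → mval Q y x ≡ suc d → item y x d ∈ Q
mval-suc (q ∷ Q) y x e≡ with vtx q ≡ᵇ y in e₁ | key q ≡ᵇ x in e₂
mval-suc (item y′ x′ d ∷ Q) y x refl | true | true
  with ≡ᵇ-true⇒≡ y′ y e₁ | ≡ᵇ-true⇒≡ x′ x e₂
... | refl | refl = here refl
mval-suc (q ∷ Q) y x e≡ | true  | false = there (mval-suc Q y x e≡)
mval-suc (q ∷ Q) y x e≡ | false | _     = there (mval-suc Q y x e≡)

mval-mult : ∀ Q y x → mult Q y x ≡ 0 → mval Q y x ≡ 0
mval-mult Q y x e≡ with mval Q y x in e≡′
... | zero  = refl
... | suc d = contradiction (mult⁺ (mval-suc Q y x e≡′)) (subst (λ k → ¬ (1 ≤ k)) (sym e≡) λ ())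

mval-∈ : ∀ Q y x {d} → mult Q y x ≤ 1 → item y x d ∈ Q → mval Q y x ≡ suc d
mval-∈ (q ∷ Q) y x le q∈ with vtx q ≡ᵇ y in e₁ | key q ≡ᵇ x in e₂
mval-∈ (q ∷ Q) y x le       (here refl)  | true  | true  = refl
mval-∈ (q ∷ Q) y x (s≤s le) (there q∈Q)  | true  | true  = contradiction (≤-trans (mult⁺ q∈Q) le) λ ()
mval-∈ (q ∷ Q) y x le       (here refl)  | true  | false = contradiction (trans (sym e₂) (≡ᵇ-refl x)) λ ()
mval-∈ (q ∷ Q) y x le       (there q∈Q)  | true  | false = mval-∈ Q y x le q∈Q
mval-∈ (q ∷ Q) y x le       (here refl)  | false | _     = contradiction (trans (sym e₁) (≡ᵇ-refl y)) λ ()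
mval-∈ (q ∷ Q) y x le       (there q∈Q)  | false | _     = mval-∈ Q y x le q∈Q

-- Variables: 0 n, 3 cap, 4 xb, 5 crow, 6 lrow, 7 tail, 8-10 the item, 18 icb.
-- Array 2 is the data structure, 3-5 the queue, 8 and 9 the vertices by key.
store-row store-queue store-key push : Cmd
store-row =
    11 ≔ get 2 (addrE 0 0 (var 5) (var 8))
  ⨟ put 2 (addrE 0 2 (bin add (var 6) (var 11)) (var 8)) (var 9)
  ⨟ put 2 (addrE 0 3 (bin add (var 6) (var 11)) (var 8)) (var 10)
  ⨟ put 2 (addrE 0 0 (var 5) (var 8)) (bin add (var 11) (lit 1))
  ⨟ put 2 (addrE 0 1 (bin add (var 4) (var 9)) (var 8)) (bin add (var 10) (lit 1))
store-queue =
    put 3 (var 7) (var 8)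
  ⨟ put 4 (var 7) (var 9)
  ⨟ put 5 (var 7) (var 10)
store-key =
    11 ≔ get 8 (bin add (var 18) (var 9))
  ⨟ put 9 (bin add (bin mul (var 11) (var 0)) (var 9)) (var 8)
  ⨟ put 8 (bin add (var 18) (var 9)) (bin add (var 11) (lit 1))
  ⨟ 7 ≔ bin add (var 7) (lit 1)
push =
  ifnz (bin mul (bin eq (get 2 (addrE 0 1 (bin add (var 4) (var 9)) (var 8))) (lit 0))
                (bin lt (get 2 (addrE 0 0 (var 5) (var 8))) (var 3)))
    (store-row ⨟ store-queue ⨟ store-key)
    skip

-- The rows of the data structure are counters (class 0), distances (class 1)
-- and lists of keys and distances (classes 2 and 3); xb, crow and lrow say
-- which rows this flood uses, and base is what the other rows contain.
module FloodMem (n X cap xb crow lrow icb : ℕ) (base : ℕ → ℕ) where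

  record Mem (D QV QK QD IC IV : ℕ → ℕ) (Q : List Item) : Set where
    field
      queue-vtx : Stored (λ k → k) vtx QV Q
      queue-key : Stored (λ k → k) key QK Q
      queue-dst : Stored (λ k → k) dst QD Q
      counts    : ∀ {y} → y < n → D (addr n 0 crow y) ≡ cnt Q y
      keys      : ∀ {y} → y < n → Stored (λ k → addr n 2 (lrow + k) y) key D (sel vtx y Q)
      dists     : ∀ {y} → y < n → Stored (λ k → addr n 3 (lrow + k) y) dst D (sel vtx y Q)
      matrix    : ∀ {y x} → x < n → y < n → D (addr n 1 (xb + x) y) ≡ mval Q y x
      frame₀    : ∀ {ρ y} → y < n → ρ ≢ crow → D (addr n 0 ρ y) ≡ base (addr n 0 ρ y)
      frame₁    : ∀ {ρ y} → y < n → ρ < xb → D (addr n 1 ρ y) ≡ base (addr n 1 ρ y)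
      frame₂    : ∀ {ρ y} → y < n → ρ < lrow → D (addr n 2 ρ y) ≡ base (addr n 2 ρ y)
      frame₃    : ∀ {ρ y} → y < n → ρ < lrow → D (addr n 3 ρ y) ≡ base (addr n 3 ρ y)
      key-count : ∀ {x} → x < n → IC (icb + x) ≡ length (sel key x Q)
      key-vtxs  : ∀ {x} → x < n → Stored (λ k → k * n + x) vtx IV (sel key x Q)
      -- Counters beyond the block in use stay zero, so the second flood can start at `icb = n`
      -- without clearing anything.
      ic-fresh  : ∀ {i} → icb + n ≤ i → IC i ≡ 0

  record Regs (v₀ v₃ v₄ v₅ v₆ v₇ v₁₈ : ℕ) (Q : List Item) : Set where
    field
      r-n    : v₀ ≡ n
      r-cap  : v₃ ≡ cap
      r-xb   : v₄ ≡ xb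
      r-crow : v₅ ≡ crow
      r-lrow : v₆ ≡ lrow
      r-tail : v₇ ≡ length Q
      r-icb  : v₁₈ ≡ icb

  regs-cong : ∀ {v₀ v₃ v₄ v₅ v₆ v₇ v₁₈ v₀′ v₃′ v₄′ v₅′ v₆′ v₇′ v₁₈′ Q} →
    v₀′ ≡ v₀ → v₃′ ≡ v₃ → v₄′ ≡ v₄ → v₅′ ≡ v₅ → v₆′ ≡ v₆ → v₇′ ≡ v₇ → v₁₈′ ≡ v₁₈ →
    Regs v₀ v₃ v₄ v₅ v₆ v₇ v₁₈ Q → Regs v₀′ v₃′ v₄′ v₅′ v₆′ v₇′ v₁₈′ Q
  regs-cong refl refl refl refl refl refl refl R = R

  Rep : State → List Item → Set
  Rep s Q = Mem (arrays s 2) (arrays s 3) (arrays s 4) (arrays s 5) (arrays s 8) (arrays s 9) Q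
    × Regs (vars s 0) (vars s 3) (vars s 4) (vars s 5) (vars s 6) (vars s 7) (vars s 18) Q

  mem-cong : ∀ {D D′ QV QV′ QK QK′ QD QD′ IC IC′ IV IV′ Q} →
    D′ ≡ D → QV′ ≡ QV → QK′ ≡ QK → QD′ ≡ QD → IC′ ≡ IC → IV′ ≡ IV →
    Mem D QV QK QD IC IV Q → Mem D′ QV′ QK′ QD′ IC′ IV′ Q
  mem-cong refl refl refl refl refl refl M = M

  pushD : (ℕ → ℕ) → List Item → Item → (ℕ → ℕ)
  pushD D Q (item y x d) = Update₄.D₄ D
    (addr n 2 (lrow + cnt Q y) y) x (addr n 3 (lrow + cnt Q y) y) d
    (addr n 0 crow y) (suc (cnt Q y)) (addr n 1 (xb + x) y) (suc d)

  0<4 : 0 < 4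
  0<4 = s≤s z≤n
  1<4 : 1 < 4
  1<4 = s≤s (s≤s z≤n)
  2<4 : 2 < 4
  2<4 = s≤s (s≤s (s≤s z≤n))
  3<4 : 3 < 4
  3<4 = ≤-refl

  module _ {D QV QK QD IC IV : ℕ → ℕ} {Q : List Item} (M : Mem D QV QK QD IC IV Q) {y x d : ℕ} (y<n : y < n) (x<n : x < n) where

    open Mem M

    open Update₄ D (addr n 2 (lrow + cnt Q y) y) x (addr n 3 (lrow + cnt Q y) y) d
      (addr n 0 crow y) (suc (cnt Q y)) (addr n 1 (xb + x) y) (suc d)

    D′ : ℕ → ℕ
    D′ = pushD D Q (item y x d)

    other₀ : ∀ {ρ z} → z < n → (ρ ≡ crow → y ≢ z) → D′ (addr n 0 ρ z) ≡ D (addr n 0 ρ z)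
    other₀ {ρ} {z} z<n ne = other (addr-≢ᶜ n 2<4 0<4 y<n z<n λ ()) (addr-≢ᶜ n 3<4 0<4 y<n z<n λ ()) same
      (addr-≢ᶜ n 1<4 0<4 y<n z<n λ ())
      where
      same : addr n 0 crow y ≢ addr n 0 ρ z
      same with ρ ≟ crow
      ... | yes ρ≡ = addr-≢ʸ n y<n z<n (ne ρ≡)
      ... | no ρ≢  = addr-≢ʳ n y<n z<n (ρ≢ ∘ sym)

    other₁ : ∀ {ρ z} → z < n → (ρ ≡ xb + x → y ≢ z) → D′ (addr n 1 ρ z) ≡ D (addr n 1 ρ z)
    other₁ {ρ} {z} z<n ne = other (addr-≢ᶜ n 2<4 1<4 y<n z<n λ ()) (addr-≢ᶜ n 3<4 1<4 y<n z<n λ ())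
      (addr-≢ᶜ n 0<4 1<4 y<n z<n λ ()) same
      where
      same : addr n 1 (xb + x) y ≢ addr n 1 ρ z
      same with ρ ≟ xb + x
      ... | yes ρ≡ = addr-≢ʸ n y<n z<n (ne ρ≡)
      ... | no ρ≢  = addr-≢ʳ n y<n z<n (ρ≢ ∘ sym)

    other₂ : ∀ {ρ z} → z < n → (ρ ≡ lrow + cnt Q y → y ≢ z) → D′ (addr n 2 ρ z) ≡ D (addr n 2 ρ z)
    other₂ {ρ} {z} z<n ne = other same (addr-≢ᶜ n 3<4 2<4 y<n z<n λ ())
      (addr-≢ᶜ n 0<4 2<4 y<n z<n λ ()) (addr-≢ᶜ n 1<4 2<4 y<n z<n λ ())
      where
      same : addr n 2 (lrow + cnt Q y) y ≢ addr n 2 ρ z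
      same with ρ ≟ lrow + cnt Q y
      ... | yes ρ≡ = addr-≢ʸ n y<n z<n (ne ρ≡)
      ... | no ρ≢  = addr-≢ʳ n y<n z<n (ρ≢ ∘ sym)

    other₃ : ∀ {ρ z} → z < n → (ρ ≡ lrow + cnt Q y → y ≢ z) → D′ (addr n 3 ρ z) ≡ D (addr n 3 ρ z)
    other₃ {ρ} {z} z<n ne = other (addr-≢ᶜ n 2<4 3<4 y<n z<n λ ()) same
      (addr-≢ᶜ n 0<4 3<4 y<n z<n λ ()) (addr-≢ᶜ n 1<4 3<4 y<n z<n λ ())
      where
      same : addr n 3 (lrow + cnt Q y) y ≢ addr n 3 ρ z
      same with ρ ≟ lrow + cnt Q y
      ... | yes ρ≡ = addr-≢ʸ n y<n z<n (ne ρ≡)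
      ... | no ρ≢  = addr-≢ʳ n y<n z<n (ρ≢ ∘ sym)

    mem-push : Mem D′ (update QV (length Q) y) (update QK (length Q) x) (update QD (length Q) d)
                   (update IC (icb + x) (suc (length (sel key x Q))))
                   (update IV (length (sel key x Q) * n + x) y) (item y x d ∷ Q)
    mem-push = record
      { queue-vtx = update-same QV (length Q) y , stored-update Q (λ k k< → <⇒≢ k< ∘ sym) queue-vtx
      ; queue-key = update-same QK (length Q) x , stored-update Q (λ k k< → <⇒≢ k< ∘ sym) queue-key
      ; queue-dst = update-same QD (length Q) d , stored-update Q (λ k k< → <⇒≢ k< ∘ sym) queue-dst
      ; counts = count′
      ; keys = keys′
      ; dists = dists′
      ; matrix = matrix′
      ; frame₀ = λ z<n ρ≢ → trans (other₀ z<n (λ ρ≡ → contradiction ρ≡ ρ≢)) (frame₀ z<n ρ≢)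
      ; frame₁ = λ {ρ} z<n ρ< → trans (other₁ z<n (λ ρ≡ → contradiction (≤-trans ρ< (m≤m+n xb x)) (<⇒≱ (≤-reflexive (cong suc (sym ρ≡)))))) (frame₁ z<n ρ<)
      ; frame₂ = λ {ρ} z<n ρ< → trans (other₂ z<n (λ ρ≡ → contradiction (≤-trans ρ< (m≤m+n lrow (cnt Q y))) (<⇒≱ (≤-reflexive (cong suc (sym ρ≡)))))) (frame₂ z<n ρ<)
      ; frame₃ = λ {ρ} z<n ρ< → trans (other₃ z<n (λ ρ≡ → contradiction (≤-trans ρ< (m≤m+n lrow (cnt Q y))) (<⇒≱ (≤-reflexive (cong suc (sym ρ≡)))))) (frame₃ z<n ρ<)
      ; key-count = key-count′
      ; key-vtxs = key-vtxs′
      ; ic-fresh = λ {i} le → trans (update-other IC _ (<⇒≢ (<-≤-trans (+-monoʳ-< icb x<n) le))) (ic-fresh le)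
      }
      where
      q : Item
      q = item y x d
      count′ : ∀ {z} → z < n → D′ (addr n 0 crow z) ≡ cnt (q ∷ Q) z
      count′ {z} z<n with y ≟ z
      ... | yes refl = trans (at₃ (addr-≢ᶜ n 1<4 0<4 y<n z<n λ ()))
                             (sym (cong length (sel-yes vtx {q = q} Q refl)))
      ... | no y≢z   = trans (other₀ z<n (λ _ → y≢z)) (trans (counts z<n) (sym (cong length (sel-no vtx {q = q} Q y≢z))))
      keys′ : ∀ {z} → z < n → Stored (λ k → addr n 2 (lrow + k) z) key D′ (sel vtx z (q ∷ Q))
      keys′ {z} z<n with y ≟ z
      ... | yes refl = subst (Stored _ key D′) (sym (sel-yes vtx {q = q} Q refl))
            ( at₁ (addr-≢ᶜ n 3<4 2<4 y<n z<n λ ()) (addr-≢ᶜ n 0<4 2<4 y<n z<n λ ()) (addr-≢ᶜ n 1<4 2<4 y<n z<n λ ())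
            , stored-cong (sel vtx y Q) (λ k k< → other₂ z<n (λ e≡ → contradiction (+-cancelˡ-≡ lrow k _ e≡) (<⇒≢ k<))) (keys z<n))
      ... | no y≢z   = subst (Stored _ key D′) (sym (sel-no vtx {q = q} Q y≢z))
            (stored-cong (sel vtx z Q) (λ k k< → other₂ z<n (λ _ → y≢z)) (keys z<n))
      dists′ : ∀ {z} → z < n → Stored (λ k → addr n 3 (lrow + k) z) dst D′ (sel vtx z (q ∷ Q))
      dists′ {z} z<n with y ≟ z
      ... | yes refl = subst (Stored _ dst D′) (sym (sel-yes vtx {q = q} Q refl))
            ( at₂ (addr-≢ᶜ n 0<4 3<4 y<n z<n λ ()) (addr-≢ᶜ n 1<4 3<4 y<n z<n λ ())
            , stored-cong (sel vtx y Q) (λ k k< → other₃ z<n (λ e≡ → contradiction (+-cancelˡ-≡ lrow k _ e≡) (<⇒≢ k<))) (dists z<n))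
      ... | no y≢z   = subst (Stored _ dst D′) (sym (sel-no vtx {q = q} Q y≢z))
            (stored-cong (sel vtx z Q) (λ k k< → other₃ z<n (λ _ → y≢z)) (dists z<n))
      matrix′ : ∀ {z x′} → x′ < n → z < n → D′ (addr n 1 (xb + x′) z) ≡ mval (q ∷ Q) z x′
      matrix′ {z} {x′} x′<n z<n with y ≟ z | x ≟ x′
      ... | yes refl | yes refl rewrite ≡ᵇ-refl y | ≡ᵇ-refl x = at₄
      ... | yes refl | no x≢ rewrite ≡ᵇ-refl y | ≢⇒≡ᵇ-false x≢ =
            trans (other₁ z<n (λ e≡ → contradiction (sym (+-cancelˡ-≡ xb x′ x e≡)) x≢)) (matrix x′<n z<n)
      ... | no y≢ | _ rewrite ≢⇒≡ᵇ-false y≢ = trans (other₁ z<n (λ _ → y≢)) (matrix x′<n z<n)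
      key-count′ : ∀ {x′} → x′ < n → update IC (icb + x) (suc (length (sel key x Q))) (icb + x′) ≡ length (sel key x′ (q ∷ Q))
      key-count′ {x′} x′<n with x ≟ x′
      ... | yes refl = trans (update-same IC (icb + x) _) (sym (cong length (sel-yes key {q = q} Q refl)))
      ... | no x≢    = trans (update-other IC _ (x≢ ∘ +-cancelˡ-≡ icb x x′)) (trans (key-count x′<n) (sym (cong length (sel-no key {q = q} Q x≢))))
      key-vtxs′ : ∀ {x′} → x′ < n → Stored (λ k → k * n + x′) vtx (update IV (length (sel key x Q) * n + x) y) (sel key x′ (q ∷ Q))
      key-vtxs′ {x′} x′<n with x ≟ x′
      ... | yes refl = subst (Stored _ vtx _) (sym (sel-yes key {q = q} Q refl))
            ( update-same IV _ y
            , stored-update (sel key x Q) (λ k k< → idx-≢ˡ {length (sel key x Q)} {k} x<n x<n (<⇒≢ k< ∘ sym)) (key-vtxs x<n))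
      ... | no x≢ = subst (Stored _ vtx _) (sym (sel-no key {q = q} Q x≢))
            (stored-update (sel key x′ Q) (λ k k< → idx-≢ʳ {length (sel key x Q)} {k} x<n x′<n x≢) (key-vtxs x′<n))

bit-<ᵇ : ∀ {a b} → a < b → bit (a <ᵇ b) ≡ 1
bit-<ᵇ {a} {b} a<b with a <ᵇ b | <⇒<ᵇ a<b
... | true | _ = refl

bit-≮ᵇ : ∀ {a b} → ¬ (a < b) → bit (a <ᵇ b) ≡ 0
bit-≮ᵇ {a} {b} ¬a<b with a <ᵇ b in e≡
... | false = refl
... | true  = contradiction (<ᵇ⇒< a b (subst T (sym e≡) tt)) ¬a<b

-- Variables: 13 head, 14 vertex of the visited item, 17 neighbours left.
-- Arrays 6 and 7 hold the degrees and the neighbours.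
flood : Cmd
flood =
  while (bin lt (var 13) (var 7))
    ( 14 ≔ get 3 (var 13)
    ⨟ 9 ≔ get 4 (var 13)
    ⨟ 10 ≔ bin add (get 5 (var 13)) (lit 1)
    ⨟ 17 ≔ get 6 (var 14)
    ⨟ while (var 17)
        ( 17 ≔ bin sub (var 17) (lit 1)
        ⨟ 8 ≔ get 7 (bin add (bin mul (var 17) (var 0)) (var 14))
        ⨟ push )
    ⨟ 13 ≔ bin add (var 13) (lit 1) )

-- Neighbour number `k` of `y` sits at `k * n + y`: all adjacency lists can grow side by side
-- without the degrees being known, and cells never written cost no time.
AdjMem : ℕ → List (ℕ × ℕ) → (ℕ → ℕ) → (ℕ → ℕ) → Set
AdjMem n arcs DG NB = ∀ y → y < n →
  DG y ≡ deg arcs y × Stored (λ k → k * n + y) proj₂ NB (sel proj₁ y arcs)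

module FloodRun (w n : ℕ) (n≥1 : 1 ≤ n) (room : 64 * (n * (n * n)) ≤ 2 ^ w)
  (arcs : List (ℕ × ℕ)) (arcs-sym : ∀ {y z} → (y , z) ∈ arcs → (z , y) ∈ arcs)
  (arcs-< : ∀ {y z} → (y , z) ∈ arcs → y < n) (arcs-few : length arcs ≤ 2 * (n * n))
  (X cap : ℕ) (root : ℕ → ℕ) (IsKey : ℕ → Set)
  (xb crow lrow icb : ℕ) (base : ℕ → ℕ)
  (X≤n : X ≤ n) (cap≤n : cap ≤ n) (xb≤n : xb ≤ n) (crow<4 : crow < 4) (lrow≤n : lrow ≤ n) (icb≤n : icb ≤ n)
  where

  open Words w n n≥1 room
  open Flood n arcs arcs-sym arcs-< X cap root IsKey
  open FloodMem n X cap xb crow lrow icb base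

  length-≤n² : ∀ {Q} → Good Q → length Q ≤ n * n
  length-≤n² g = ≤-trans (length-≤ g) (*-monoʳ-≤ n cap≤n)

  length-≤n³ : ∀ {Q} → Good Q → length Q ≤ n³
  length-≤n³ g = ≤-trans (length-≤n² g) n²≤n³

  1*-≤ : ∀ {v} → v ≤ n³ → v ≤ 1 * n³
  1*-≤ v≤ = ≤-trans v≤ (≤-reflexive (sym (*-identityˡ n³)))

  +-≤2n³ : ∀ {a b} → a ≤ n → b ≤ n → a + b ≤ 2 * n³
  +-≤2n³ a≤ b≤ = +-mono-≤ (≤-trans a≤ n≤n³) (≤-trans b≤ (≤-trans n≤n³ (m≤m+n n³ 0)))

  row-< : ∀ {a b} → a ≤ n → b ≤ n → a + b < 4 * n
  row-< {a} {b} a≤ b≤ = begin-strict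
    a + b        ≤⟨ +-mono-≤ a≤ b≤ ⟩
    n + n        <⟨ m<m+n (n + n) (≤-trans n≥1 (m≤m+n n n)) ⟩
    n + n + (n + n) ≡⟨ trans (+-assoc n n (n + n)) (cong (λ k → n + (n + (n + k))) (sym (+-identityʳ n))) ⟩
    4 * n        ∎
    where open ≤-Reasoning

  crow<4n : crow < 4 * n
  crow<4n = <-≤-trans crow<4 (m≤m*n 4 n {{>-nonZero n≥1}})

  col-fit : ∀ {k} → k ≤ n * n → suc k * n ≤ 2 * n³
  col-fit {k} k≤ = +-mono-≤ n≤n³ (≤-trans (*-monoˡ-≤ n k≤) (≤-reflexive (trans (*-assoc n n n) (sym (+-identityʳ n³)))))

  -- The 24 steps are one for the test, 9, 5 and 7 for the three groups of stores, and two for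
  -- sequencing.
  push-run : ∀ {s Q y x d} → Rep s Q → Good Q → Valid (item y x d) → d ≤ length Q →
    vars s 8 ≡ y → vars s 9 ≡ x → vars s 10 ≡ d →
    Run w push s 24 (λ s′ → ∃[ Q′ ] (Pushed Q (item y x d) Q′ × Rep s′ Q′))
  push-run {s} {Q} {y} {x} {d} (M , R) g v d≤ v₈ v₉ v₁₀ = go (mult Q y x ≟ 0) (suc (cnt Q y) ≤? cap)
    where
    open Mem M
    open Regs R
    y<n : y < n
    y<n = vtx<n v
    x<n : x < n
    x<n = ≤-trans (key<X v) X≤n
    cnt≤n : cnt Q y ≤ n
    cnt≤n = ≤-trans (cnt≤cap g y) cap≤n
    value : ℕ
    value = [ mval Q y x ≣ 0 ] * bit (cnt Q y <ᵇ cap)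
    value≤1 : value ≤ 1
    value≤1 = *-mono-≤ ([≣]-≤1 (mval Q y x) 0) (bit-≤1 (cnt Q y <ᵇ cap))
    condition : ∀ {v} → value ≡ v → Ev w s (bin mul (bin eq (get 2 (addrE 0 1 (bin add (var 4) (var 9)) (var 8))) (lit 0))
                (bin lt (get 2 (addrE 0 0 (var 5) (var 8))) (var 3))) v
    condition e≡ = ev-≡ e≡ (ev-mul
      (ev-eq 2≤2^w (ev-get (ev-addr 1<4 (ev-add (ev-var r-xb) (ev-var v₉) (fit 2 (+-≤2n³ xb≤n (<⇒≤ x<n)) (m≤m+n 3 61)))
                      (ev-var r-n) (ev-var v₈) (row-< xb≤n (<⇒≤ x<n)) y<n) (matrix x<n y<n)) ev-zero)
      (ev-lt 2≤2^w (ev-get (ev-addr 0<4 (ev-var r-crow) (ev-var r-n) (ev-var v₈) crow<4n y<n) (counts y<n)) (ev-var r-cap))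
      (fit-lit (≤-<-trans value≤1 (m≤m+n 2 62))))
    stop : value ≡ 0 → 1 ≤ mult Q y x ⊎ cap ≤ cnt Q y →
      Run w push s 24 (λ s′ → ∃[ Q′ ] (Pushed Q (item y x d) Q′ × Rep s′ Q′))
    stop e≡ why = weaken (m≤m+n 2 22) (if₀ (condition e≡) (skip-run (Q , kept why , M , R)))
    ℓ : ℕ
    ℓ = length (sel key x Q)
    ℓ≤ : ℓ ≤ n * n
    ℓ≤ = ≤-trans (length-sel-≤ key x Q) (length-≤n² g)
    go : _ → _ → Run w push s 24 (λ s′ → ∃[ Q′ ] (Pushed Q (item y x d) Q′ × Rep s′ Q′))
    go (no m≢0) _ = stop (cong (_* bit (cnt Q y <ᵇ cap)) ([≣]-≢ (λ e≡ → m≢0 (mval-zero Q y x e≡)))) (inj₁ (n≢0⇒n>0 m≢0))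
    go (yes _) (no ¬r) = stop (trans (cong ([ mval Q y x ≣ 0 ] *_) (bit-≮ᵇ ¬r)) (*-zeroʳ [ mval Q y x ≣ 0 ])) (inj₂ (≮⇒≥ ¬r))
    go (yes m≡0) (yes r) = if₁ (condition (cong₂ (λ a b → [ a ≣ 0 ] * b) (mval-mult Q y x m≡0) (bit-<ᵇ r)))
      (call⨟ row-run λ s₁ V₁ A₁ D₁ →
       call⨟ (queue-run (trans (V₁ 7 refl) r-tail) (trans (V₁ 8 refl) v₈) (trans (V₁ 9 refl) v₉) (trans (V₁ 10 refl) v₁₀))
         λ s₂ V₂ A₂ (e₃ , e₄ , e₅) →
       framed (key-run (trans (V₂ 0 refl) (trans (V₁ 0 refl) r-n)) (trans (V₂ 7 refl) (trans (V₁ 7 refl) r-tail))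
           (trans (V₂ 8 refl) (trans (V₁ 8 refl) v₈)) (trans (V₂ 9 refl) (trans (V₁ 9 refl) v₉))
           (trans (V₂ 18 refl) (trans (V₁ 18 refl) r-icb))
           (trans (cong-app (A₂ 8 refl) (icb + x)) (trans (cong-app (A₁ 8 refl) (icb + x)) (key-count x<n))))
         λ s₃ V₃ A₃ (e₈ , e₉ , e₇) →
           let v₇ : ∀ j → modV store-row j ≡ false → modV store-queue j ≡ false → modV store-key j ≡ false → vars s₃ j ≡ vars s j
               v₇ j m₁ m₂ m₃ = trans (V₃ j m₃) (trans (V₂ j m₂) (V₁ j m₁))
           in item y x d ∷ Q , pushed m≡0 r
            , mem-cong (trans (A₃ 2 refl) (trans (A₂ 2 refl) D₁))
                (trans (A₃ 3 refl) (trans e₃ (cong (λ f → update f (length Q) y) (A₁ 3 refl))))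
                (trans (A₃ 4 refl) (trans e₄ (cong (λ f → update f (length Q) x) (A₁ 4 refl))))
                (trans (A₃ 5 refl) (trans e₅ (cong (λ f → update f (length Q) d) (A₁ 5 refl))))
                (trans e₈ (cong (λ f → update f (icb + x) (suc ℓ)) (trans (A₂ 8 refl) (A₁ 8 refl))))
                (trans e₉ (cong (λ f → update f (ℓ * n + x) y) (trans (A₂ 9 refl) (A₁ 9 refl))))
                (mem-push M y<n x<n)
            , record { r-n = trans (v₇ 0 refl refl refl) r-n ; r-cap = trans (v₇ 3 refl refl refl) r-cap
                     ; r-xb = trans (v₇ 4 refl refl refl) r-xb ; r-crow = trans (v₇ 5 refl refl refl) r-crow
                     ; r-lrow = trans (v₇ 6 refl refl refl) r-lrow ; r-tail = e₇
                     ; r-icb = trans (v₇ 18 refl refl refl) r-icb })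
      where
      row-run : Run w store-row s 9 (λ s′ → arrays s′ 2 ≡ pushD (arrays s 2) Q (item y x d))
      row-run =
        asg⨟ (ev-get (ev-addr 0<4 (ev-var r-crow) (ev-var r-n) (ev-var v₈) crow<4n y<n) (counts y<n))
        (put⨟ (ev-addr 2<4 (ev-add (ev-var r-lrow) (ev-var refl) (fit 2 (+-≤2n³ lrow≤n cnt≤n) (m≤m+n 3 61)))
                (ev-var r-n) (ev-var v₈) (row-< lrow≤n cnt≤n) y<n) (ev-var v₉)
        (put⨟ (ev-addr 3<4 (ev-add (ev-var r-lrow) (ev-var refl) (fit 2 (+-≤2n³ lrow≤n cnt≤n) (m≤m+n 3 61)))
                (ev-var r-n) (ev-var v₈) (row-< lrow≤n cnt≤n) y<n) (ev-var v₁₀)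
        (put⨟ (ev-addr 0<4 (ev-var r-crow) (ev-var r-n) (ev-var v₈) crow<4n y<n)
                (ev-suc 1 (ev-var refl) (1*-≤ (≤-trans cnt≤n n≤n³)) (m≤m+n 3 61))
        (put-run (ev-addr 1<4 (ev-add (ev-var r-xb) (ev-var v₉) (fit 2 (+-≤2n³ xb≤n (<⇒≤ x<n)) (m≤m+n 3 61)))
                (ev-var r-n) (ev-var v₈) (row-< xb≤n (<⇒≤ x<n)) y<n)
                (ev-suc 1 (ev-var v₁₀) (1*-≤ (≤-trans d≤ (length-≤n³ g))) (m≤m+n 3 61)) refl))))
      queue-run : ∀ {s} → vars s 7 ≡ length Q → vars s 8 ≡ y → vars s 9 ≡ x → vars s 10 ≡ d →
        Run w store-queue s 5 (λ s′ → arrays s′ 3 ≡ update (arrays s 3) (length Q) y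
          × arrays s′ 4 ≡ update (arrays s 4) (length Q) x × arrays s′ 5 ≡ update (arrays s 5) (length Q) d)
      queue-run h₇ h₈ h₉ h₁₀ = put⨟ (ev-var h₇) (ev-var h₈) (put⨟ (ev-var h₇) (ev-var h₉)
        (put-run (ev-var h₇) (ev-var h₁₀) (refl , refl , refl)))
      key-run : ∀ {s} → vars s 0 ≡ n → vars s 7 ≡ length Q → vars s 8 ≡ y → vars s 9 ≡ x → vars s 18 ≡ icb →
        arrays s 8 (icb + x) ≡ ℓ →
        Run w store-key s 7 (λ s′ → arrays s′ 8 ≡ update (arrays s 8) (icb + x) (suc ℓ)
          × arrays s′ 9 ≡ update (arrays s 9) (ℓ * n + x) y × vars s′ 7 ≡ suc (length Q))
      key-run h₀ h₇ h₈ h₉ h₁₈ hℓ =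
        asg⨟ (ev-get (ev-add (ev-var h₁₈) (ev-var h₉) (fit 2 (+-≤2n³ icb≤n (<⇒≤ x<n)) (m≤m+n 3 61))) hℓ)
        (put⨟ (ev-idx {a = ℓ} 2 (ev-var refl) (ev-var h₀) (ev-var h₉) x<n (col-fit ℓ≤) (m≤m+n 3 61)) (ev-var h₈)
        (put⨟ (ev-add (ev-var h₁₈) (ev-var h₉) (fit 2 (+-≤2n³ icb≤n (<⇒≤ x<n)) (m≤m+n 3 61)))
                (ev-suc 1 (ev-var refl) (1*-≤ (≤-trans ℓ≤ n²≤n³)) (m≤m+n 3 61))
        (asg (ev-suc 1 (ev-var h₇) (1*-≤ (length-≤n³ g)) (m≤m+n 3 61)) (refl , refl , refl))))

  record Inner (Q₀ : List Item) (q : Item) (old : List Item) (rest : List (ℕ × ℕ)) (s : State) : Set where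
    field
      {Q new} : List Item
      visit   : Visit Q new q old rest
      rep     : Rep s Q
      i₁₄     : vars s 14 ≡ vtx q
      i₉      : vars s 9 ≡ key q
      i₁₀     : vars s 10 ≡ suc (dst q)
      i₁₇     : vars s 17 ≡ length rest
      i₁₃     : vars s 13 ≡ length old
      nbs     : Stored (λ k → k * n + vtx q) proj₂ (arrays s 7) rest
      few     : length rest ≤ 2 * (n * n)
      adj     : AdjMem n arcs (arrays s 6) (arrays s 7)
      ext     : ∃[ pre ] Q ≡ pre ++ Q₀

  ext-push : ∀ {Q Q′ Q₀ : List Item} {p} → Pushed Q p Q′ → ∃[ pre ] Q ≡ pre ++ Q₀ → ∃[ pre ] Q′ ≡ pre ++ Q₀
  ext-push (kept _)             e            = e
  ext-push {p = p} (pushed _ _) (pre , refl) = p ∷ pre , refl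

  inner-step : ∀ {Q₀ q old e rest s} → Inner Q₀ q old (e ∷ rest) s →
    Run w ( 17 ≔ bin sub (var 17) (lit 1)
          ⨟ 8 ≔ get 7 (bin add (bin mul (var 17) (var 0)) (var 14))
          ⨟ push ) s 28 (Inner Q₀ q old rest)
  inner-step {Q₀} {q} {old} {y , z} {rest} {s} I =
    asg⨟ (ev-pred (ev-var i₁₇))
    (asg⨟ (ev-get (ev-idx {a = length rest} 2 (ev-var refl) (ev-var (Regs.r-n (proj₂ rep))) (ev-var i₁₄) vtx<
             (≤-trans (*-monoˡ-≤ n few) (≤-reflexive (trans (*-assoc 2 (n * n) n) (cong (2 *_) (*-assoc n n n))))) (m≤m+n 3 61)) (proj₁ nbs))
    (framed (push-run rep (Visit.isGood visit) (visit-valid visit) (visit-dst visit) refl i₉ i₁₀)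
      λ s′ V A (Q′ , p , rep′) → record
        { visit = proj₂ (visit-step visit p)
        ; rep = rep′
        ; i₁₄ = trans (V 14 refl) i₁₄
        ; i₉ = trans (V 9 refl) i₉
        ; i₁₀ = trans (V 10 refl) i₁₀
        ; i₁₇ = V 17 refl
        ; i₁₃ = trans (V 13 refl) i₁₃
        ; nbs = subst (λ f → Stored _ proj₂ f rest) (sym (A 7 refl)) (proj₂ nbs)
        ; few = ≤-trans (n≤1+n _) few
        ; adj = subst₂ (AdjMem n arcs) (sym (A 6 refl)) (sym (A 7 refl)) adj
        ; ext = ext-push p ext }))
    where
    open Inner I
    vtx< : vtx q < n
    vtx< = vtx<n (All.lookup (all-valid (Visit.isGood visit)) (∈-split (Visit.split visit)))

  record Outer (Q₀ : List Item) (b : ℕ) (s : State) : Set where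
    field
      {Q new old} : List Item
      loop    : Loop Q new old
      rep     : Rep s Q
      o₁₃     : vars s 13 ≡ length old
      -- A visit costs 12 steps and 29 more per arc, of which 28 are the body of the inner loop and
      -- one is its test. `cost-≤` turns this into the factor 41 = 12 + 29.
      spent   : b ≡ ∑ (λ q → 12 + 29 * deg arcs (vtx q)) old
      adj     : AdjMem n arcs (arrays s 6) (arrays s 7)
      ext     : ∃[ pre ] Q ≡ pre ++ Q₀

  Flooded : List Item → State → Set
  Flooded Q₀ s = ∃[ Q ] (Rep s Q × Loop Q [] Q × (∃[ pre ] Q ≡ pre ++ Q₀))

  flood-run : ∀ {s Q₀} → Rep s Q₀ → Loop Q₀ Q₀ [] → vars s 13 ≡ 0 → AdjMem n arcs (arrays s 6) (arrays s 7) →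
    Run w flood s (suc (41 * (length arcs * cap))) (Flooded Q₀)
  flood-run {s₀} {Q₀} rep₀ loop₀ h₁₃ adj₀ = while-elapsed (Outer Q₀) _ bound stp
    (record { loop = loop₀ ; rep = rep₀ ; o₁₃ = h₁₃ ; spent = refl ; adj = adj₀ ; ext = [] , refl })
    where
    bound : ∀ b s → Outer Q₀ b s → b ≤ 41 * (length arcs * cap)
    bound b s O = begin
      b                                                          ≡⟨ spent ⟩
      ∑ (λ q → 12 + 29 * deg arcs (vtx q)) old                    ≤⟨ m≤n+m _ _ ⟩
      ∑ (λ q → 12 + 29 * deg arcs (vtx q)) new + ∑ (λ q → 12 + 29 * deg arcs (vtx q)) old ≡⟨ ∑-++ _ new old ⟨
      ∑ (λ q → 12 + 29 * deg arcs (vtx q)) (new ++ old)           ≡⟨ cong (∑ _) (Loop.split loop) ⟨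
      ∑ (λ q → 12 + 29 * deg arcs (vtx q)) Q                      ≤⟨ cost-≤ 12 29 (Loop.isGood loop) ⟩
      41 * (length arcs * cap)                                   ∎
      where
      open Outer O
      open ≤-Reasoning
    stp : ∀ b s → Outer Q₀ b s → (Ev w s (bin lt (var 13) (var 7)) 0 × Flooded Q₀ s)
      ⊎ (∃[ v ] ∃[ T ] (Ev w s (bin lt (var 13) (var 7)) (suc v) × Run w _ s T (λ s′ → Outer Q₀ (b + suc T) s′)))
    stp b s O with Outer.new O in new≡
    stp b s O | ns with initLast ns
    stp b s O | .[] | [] = inj₁ (ev-≡ (bit-≮ᵇ (λ l< → <⇒≢ l< (cong length (sym split′))))
        (ev-lt 2≤2^w (ev-var o₁₃) (ev-var (Regs.r-tail (proj₂ rep))))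
      , Q , rep , subst₂ (Loop Q) new≡ (sym split′) loop , ext)
      where
      open Outer O
      split′ : Q ≡ old
      split′ = trans (Loop.split loop) (cong (_++ old) new≡)
    stp b s O | .(new′ ∷ʳ q) | new′ ∷ʳ′ q = inj₂ (0 , 11 + 29 * deg arcs (vtx q)
      , ev-≡ (bit-<ᵇ old<) (ev-lt 2≤2^w (ev-var o₁₃) (ev-var (Regs.r-tail (proj₂ rep))))
      , weaken (≤-reflexive time) body)
      where
      open Outer O
      v₀ : Visit Q new′ q old (sel proj₁ (vtx q) arcs)
      v₀ = visit-start (subst (λ ns → Loop Q ns old) new≡ loop)
      open Mem (proj₁ rep)
      valid-q : Valid q
      valid-q = All.lookup (all-valid (Loop.isGood loop)) (∈-split (Visit.split v₀))
      here-at : ∀ {g arr} → Stored (λ k → k) g arr Q → arr (length old) ≡ g q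
      here-at {g} {arr} st = proj₁ (stored-drop {at = λ k → k} {g} {arr} new′ (subst (Stored _ g arr) (Visit.split v₀) st))
      old< : length old < length Q
      old< = subst (λ Q → length old < length Q) (sym (Visit.split v₀))
        (≤-trans (m≤n+m (suc (length old)) (length new′)) (≤-reflexive (sym (length-++ new′))))
      old≤ : length old ≤ n³
      old≤ = ≤-trans (<⇒≤ old<) (length-≤n³ (Loop.isGood loop))
      dst≤ : dst q ≤ n³
      dst≤ = ≤-trans (≤-trans (n≤1+n _) (visit-dst v₀)) (length-≤n³ (Loop.isGood loop))
      body : Run w
        ( 14 ≔ get 3 (var 13) ⨟ 9 ≔ get 4 (var 13) ⨟ 10 ≔ bin add (get 5 (var 13)) (lit 1) ⨟ 17 ≔ get 6 (var 14)
        ⨟ while (var 17)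
            ( 17 ≔ bin sub (var 17) (lit 1) ⨟ 8 ≔ get 7 (bin add (bin mul (var 17) (var 0)) (var 14)) ⨟ push )
        ⨟ 13 ≔ bin add (var 13) (lit 1) ) s
        (8 + suc (suc (∑ (λ _ → 29) (sel proj₁ (vtx q) arcs)) + 1))
        (λ s′ → Outer Q₀ (b + suc (11 + 29 * deg arcs (vtx q))) s′)
      body =
        asg⨟ (ev-get (ev-var o₁₃) (here-at queue-vtx))
        (asg⨟ (ev-get (ev-var o₁₃) (here-at queue-key))
        (asg⨟ (ev-suc 1 (ev-get (ev-var o₁₃) (here-at queue-dst)) (1*-≤ dst≤) (m≤m+n 3 61))
        (asg⨟ (ev-get (ev-var refl) (proj₁ (adj (vtx q) (vtx<n valid-q))))
        (call⨟ (while-list (Inner Q₀ q old) (λ _ → 28)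
                 (λ s I → ev-var (Inner.i₁₇ I) , I)
                 (λ e rest s I → length rest , ev-var (Inner.i₁₇ I) , inner-step I)
                 (sel proj₁ (vtx q) arcs)
                 (record { visit = v₀ ; rep = rep ; i₁₄ = refl ; i₉ = refl ; i₁₀ = refl ; i₁₇ = refl ; i₁₃ = o₁₃
                         ; nbs = proj₂ (adj (vtx q) (vtx<n valid-q)) ; few = ≤-trans (length-sel-≤ proj₁ (vtx q) arcs) arcs-few
                         ; adj = adj ; ext = ext }))
          λ s′ V A I → asg (ev-suc 1 (ev-var (Inner.i₁₃ I)) (1*-≤ old≤) (m≤m+n 3 61))
            (record { loop = visit-end (Inner.visit I) ; rep = Inner.rep I ; o₁₃ = refl
                    ; spent = trans (+-comm b _) (cong (suc (11 + 29 * deg arcs (vtx q)) +_) spent)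
                    ; adj = Inner.adj I ; ext = Inner.ext I })))))
      time : 8 + suc (suc (∑ (λ _ → 29) (sel proj₁ (vtx q) arcs)) + 1) ≡ 11 + 29 * deg arcs (vtx q)
      time = trans (cong (10 +_) (+-comm (∑ (λ _ → 29) (sel proj₁ (vtx q) arcs)) 1))
        (cong (11 +_) (trans (∑-const 29 (sel proj₁ (vtx q) arcs)) (*-comm (deg arcs (vtx q)) 29)))

-- Reading the edges: adjacency lists and sources

arcsOf : List (ℕ × ℕ) → List (ℕ × ℕ)
arcsOf []             = []
arcsOf ((a , b) ∷ es) = (b , a) ∷ (a , b) ∷ arcsOf es

arcsOf-sym : ∀ es {y z} → (y , z) ∈ arcsOf es → (z , y) ∈ arcsOf es
arcsOf-sym ((a , b) ∷ es) (here refl)         = there (here refl)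
arcsOf-sym ((a , b) ∷ es) (there (here refl)) = here refl
arcsOf-sym ((a , b) ∷ es) (there (there e∈))  = there (there (arcsOf-sym es e∈))

arcsOf-< : ∀ {n} es → All (λ e → proj₁ e < n × proj₂ e < n) es → ∀ {y z} → (y , z) ∈ arcsOf es → y < n
arcsOf-< ((a , b) ∷ es) ((a< , b<) ∷ bs) (here refl)         = b<
arcsOf-< ((a , b) ∷ es) ((a< , b<) ∷ bs) (there (here refl)) = a<
arcsOf-< ((a , b) ∷ es) (_ ∷ bs)         (there (there e∈))  = arcsOf-< es bs e∈

length-arcsOf : ∀ es → length (arcsOf es) ≡ 2 * length es
length-arcsOf []       = refl
length-arcsOf (_ ∷ es) = trans (cong (λ k → suc (suc k)) (length-arcsOf es)) (sym (*-suc 2 (length es)))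

arcsOf-++ : ∀ es {fs e} → e ∈ arcsOf fs → e ∈ arcsOf (es ++ fs)
arcsOf-++ []       e∈ = e∈
arcsOf-++ (_ ∷ es) e∈ = there (there (arcsOf-++ es e∈))

cells-at : ∀ {A : Set} (f : A → ℕ) xs {e ys} → cells (map f (xs ++ e ∷ ys)) (length xs) ≡ f e
cells-at f []       = refl
cells-at f (x ∷ xs) = cells-at f xs

adj-link : ∀ {n A DG NB y} z → AdjMem n A DG NB → y < n →
  AdjMem n ((y , z) ∷ A) (update DG y (suc (deg A y))) (update NB (deg A y * n + y) z)
adj-link {n} {A} {DG} {NB} {y} z adj y<n x x<n with y ≟ x
... | yes refl = trans (update-same DG y _) (sym (cong length (sel-yes proj₁ {q = y , z} A refl)))
      , subst (Stored _ proj₂ _) (sym (sel-yes proj₁ {q = y , z} A refl))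
          ( update-same NB _ z
          , stored-update (sel proj₁ y A) (λ k k< → idx-≢ˡ {deg A y} {k} y<n y<n (<⇒≢ k< ∘ sym)) (proj₂ (adj y y<n)))
... | no y≢x = trans (update-other DG _ y≢x) (trans (proj₁ (adj x x<n)) (sym (cong length (sel-no proj₁ {q = y , z} A y≢x))))
      , subst (Stored _ proj₂ _) (sym (sel-no proj₁ {q = y , z} A y≢x))
          (stored-update (sel proj₁ x A) (λ k k< → idx-≢ʳ {deg A y} {k} y<n x<n y≢x) (proj₂ (adj x x<n)))

link : ℕ → ℕ → Cmd
link a b =
    put 7 (bin add (bin mul (get 6 (var a)) (var 0)) (var a)) (var b)
  ⨟ put 6 (var a) (bin add (get 6 (var a)) (lit 1))

read-edges : Cmd
read-edges =
  while (var 20)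
    ( 20 ≔ bin sub (var 20) (lit 1)
    ⨟ 8 ≔ get 0 (var 20)
    ⨟ 12 ≔ get 1 (var 20)
    ⨟ link 8 12
    ⨟ link 12 8
    ⨟ 9 ≔ var 8
    ⨟ push
    ⨟ 8 ≔ var 12
    ⨟ 9 ≔ var 12
    ⨟ push )

module _ {n : ℕ} {arcs : List (ℕ × ℕ)} {arcs-sym : ∀ {y w} → (y , w) ∈ arcs → (w , y) ∈ arcs}
  {arcs-< : ∀ {y w} → (y , w) ∈ arcs → y < n} {X cap : ℕ} {root : ℕ → ℕ} {IsKey : ℕ → Set} where

  open Flood n arcs arcs-sym arcs-< X cap root IsKey

  -- While only distances 0 are queued, a duplicate has distance 0 too and is the very item wanted;
  -- `fits` excludes the other reason for a refusal.
  source-pushed : ∀ {Q y x Q′} → All (λ q → dst q ≡ 0) Q → (mult Q y x ≡ 0 → cnt Q y < cap) →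
    Pushed Q (item y x 0) Q′ → item y x 0 ∈ Q′
  source-pushed zeros fits (pushed _ _) = here refl
  source-pushed {Q} {y} {x} zeros fits (kept why) with mult Q y x ≟ 0
  source-pushed zeros fits (kept (inj₁ m≥1)) | yes m≡0 = contradiction (subst (1 ≤_) m≡0 m≥1) λ ()
  source-pushed zeros fits (kept (inj₂ full)) | yes m≡0 = contradiction full (<⇒≱ (fits m≡0))
  source-pushed {Q} {y} {x} zeros fits (kept why) | no m≢0 with mult⁻ Q y x (n≢0⇒n>0 m≢0)
  ... | k , q∈Q with All.lookup zeros q∈Q
  ...   | refl = q∈Q

  pushed-⊆ : ∀ {Q q Q′ p} → Pushed Q q Q′ → p ∈ Q → p ∈ Q′
  pushed-⊆ (pushed _ _) = there
  pushed-⊆ (kept _)     = λ p∈ → p∈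

  pushed-All : ∀ {P : Item → Set} {Q q Q′} → Pushed Q q Q′ → P q → All P Q → All P Q′
  pushed-All (pushed _ _) pq ps = pq ∷ ps
  pushed-All (kept _)     pq ps = ps

Diagonal : Item → Set
Diagonal q = key q ≡ vtx q × dst q ≡ 0

-- Before the flood a vertex can hold no key but itself. So a list without that key is empty, and
-- `1 ≤ κ` already leaves room for it.
diagonal-cnt : ∀ {Q} y → All Diagonal Q → mult Q y y ≡ cnt Q y
diagonal-cnt {Q} y diag = trans (∑-cong Q λ {q} q∈Q → lemma q (proj₁ (All.lookup diag q∈Q))) (sym (length-sel vtx y Q))
  where
  lemma : ∀ q → key q ≡ vtx q → [ vtx q ≣ y ] * [ key q ≣ y ] ≡ [ vtx q ≣ y ]
  lemma (item v .v d) refl with v ≡ᵇ y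
  ... | true  = refl
  ... | false = refl

module EdgesRun (w n : ℕ) (n≥1 : 1 ≤ n) (room : 64 * (n * (n * n)) ≤ 2 ^ w)
  (es : List (ℕ × ℕ)) (es-< : All (λ e → proj₁ e < n × proj₂ e < n) es) (es-few : length es ≤ n * n)
  (κ : ℕ) (κ≥1 : 1 ≤ κ) (κ≤n : κ ≤ n) where

  arcs : List (ℕ × ℕ)
  arcs = arcsOf es

  arcs-few : length arcs ≤ 2 * (n * n)
  arcs-few = ≤-trans (≤-reflexive (length-arcsOf es)) (*-monoʳ-≤ 2 es-few)

  open Words w n n≥1 room
  open Flood n arcs (arcsOf-sym es) (arcsOf-< es es-<) n κ (λ x → x) (λ _ → ⊤)
  open FloodMem n n κ n 1 0 0 (λ _ → 0)
  open FloodRun w n n≥1 room arcs (arcsOf-sym es) (arcsOf-< es es-<) arcs-few n κ (λ x → x) (λ _ → ⊤) n 1 0 0 (λ _ → 0)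
    ≤-refl κ≤n ≤-refl (s≤s (s≤s z≤n)) z≤n z≤n using (push-run; 1*-≤; col-fit)

  record Sources (done : List (ℕ × ℕ)) (Q : List Item) : Set where
    field
      isGood : Good Q
      diag   : All Diagonal Q
      srcs   : ∀ {y z} → (y , z) ∈ arcsOf done → item y y 0 ∈ Q

  record Reading (r : ℕ) (s : State) : Set where
    field
      {pre done} : List (ℕ × ℕ)
      {Q}   : List Item
      split : es ≡ pre ++ done
      left  : length pre ≡ r
      r₂₀   : vars s 20 ≡ r
      r₁₀   : vars s 10 ≡ 0
      a₀    : arrays s 0 ≡ cells (map proj₁ es)
      a₁    : arrays s 1 ≡ cells (map proj₂ es)
      adj   : AdjMem n (arcsOf done) (arrays s 6) (arrays s 7)
      rep   : Rep s Q
      srcs  : Sources done Q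

  Read : State → Set
  Read s = AdjMem n arcs (arrays s 6) (arrays s 7) × ∃[ Q ] (Rep s Q × Sources es Q)

  link-run : ∀ a b {s A y z} → vars s 0 ≡ n → vars s a ≡ y → vars s b ≡ z → y < n → length A ≤ n * n + n * n →
    AdjMem n A (arrays s 6) (arrays s 7) →
    Run w (link a b) s 3 (λ s′ → AdjMem n ((y , z) ∷ A) (arrays s′ 6) (arrays s′ 7))
  link-run a b {s} {A} {y} {z} h₀ ha hb y<n few adj =
    put⨟ (ev-idx {a = deg A y} 3 (ev-get (ev-var ha) (proj₁ (adj y y<n))) (ev-var h₀) (ev-var ha) y<n fits (m≤m+n 4 60)) (ev-var hb)
    (put-run (ev-var ha) (ev-suc 2 (ev-get (ev-var ha) (proj₁ (adj y y<n))) deg≤ (m≤m+n 4 60))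
      (adj-link {A = A} {arrays s 6} {arrays s 7} z adj y<n))
    where
    n²+n²≤ : n * n + n * n ≤ 2 * n³
    n²+n²≤ = +-mono-≤ n²≤n³ (≤-trans n²≤n³ (m≤m+n n³ 0))
    deg≤ : deg A y ≤ 2 * n³
    deg≤ = ≤-trans (length-sel-≤ proj₁ y A) (≤-trans few n²+n²≤)
    fits : suc (deg A y) * n ≤ 3 * n³
    fits = +-mono-≤ n≤n³ (≤-trans (*-monoˡ-≤ n (≤-trans (length-sel-≤ proj₁ y A) few))
      (≤-reflexive (trans (*-distribʳ-+ n (n * n) (n * n)) (trans (cong₂ _+_ (*-assoc n n n) (*-assoc n n n)) (cong (n³ +_) (sym (+-identityʳ n³)))))))

  source-run : ∀ {s Q y z} → Rep s Q → Good Q → All Diagonal Q → (y , z) ∈ arcs →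
    vars s 8 ≡ y → vars s 9 ≡ y → vars s 10 ≡ 0 →
    Run w push s 24 (λ s′ → ∃[ Q′ ] (Rep s′ Q′ × Good Q′ × All Diagonal Q′ × item y y 0 ∈ Q′ × (∀ p → p ∈ Q → p ∈ Q′)))
  source-run {s} {Q} {y} rep g diag e∈ h₈ h₉ h₁₀ =
    framed (push-run rep g v z≤n h₈ h₉ h₁₀) λ s′ V A (Q′ , p , rep′) →
      Q′ , rep′ , good-push g v z≤n p , pushed-All p (refl , refl) diag
      , source-pushed (All.map proj₂ diag) (λ m≡0 → subst (_< κ) (trans (sym m≡0) (diagonal-cnt y diag)) κ≥1) p
      , λ _ → pushed-⊆ p
    where
    v : Valid (item y y 0)
    v = valid (arcsOf-< es es-< e∈) (arcsOf-< es es-< e∈) (deg-positive e∈) tt nil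

  read-step : ∀ {r s} → Reading (suc r) s → Run w
    ( 20 ≔ bin sub (var 20) (lit 1) ⨟ 8 ≔ get 0 (var 20) ⨟ 12 ≔ get 1 (var 20)
    ⨟ link 8 12 ⨟ link 12 8 ⨟ 9 ≔ var 8 ⨟ push ⨟ 8 ≔ var 12 ⨟ 9 ≔ var 12 ⨟ push ) s 69 (Reading r)
  read-step {r} {s} I with Reading.pre I in pre≡
  ... | ns with initLast ns
  ... | [] = contradiction (trans (sym (Reading.left I)) (cong length pre≡)) λ ()
  ... | pre′ ∷ʳ′ (a , b) =
    asg⨟ (ev-pred (ev-var r₂₀))
    (asg⨟ (ev-get (ev-var refl) (trans (cong-app a₀ r) (subst (λ k → cells (map proj₁ es) k ≡ a) left′
             (trans (cong (λ l → cells (map proj₁ l) (length pre′)) es≡) (cells-at proj₁ pre′)))))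
    (asg⨟ (ev-get (ev-var refl) (trans (cong-app a₁ r) (subst (λ k → cells (map proj₂ es) k ≡ b) left′
             (trans (cong (λ l → cells (map proj₂ l) (length pre′)) es≡) (cells-at proj₂ pre′)))))
    (call⨟ (link-run 8 12 {A = arcsOf done} (Regs.r-n (proj₂ rep)) refl refl a<n (≤-trans (n≤1+n _) (≤-trans (n≤1+n _) few)) adj) λ s₁ V₁ A₁ adj₁ →
    call⨟ (link-run 12 8 {A = (a , b) ∷ arcsOf done} (trans (V₁ 0 refl) (Regs.r-n (proj₂ rep))) (V₁ 12 refl) (V₁ 8 refl) b<n (≤-trans (n≤1+n _) few) adj₁) λ s₂ V₂ A₂ adj₂ →
    asg⨟ (ev-var (trans (V₂ 8 refl) (V₁ 8 refl)))
    (call⨟ (source-run {Q = Q} (rep₂ {s₁} {s₂} V₁ A₁ V₂ A₂) (Sources.isGood srcs) (Sources.diag srcs) (e∈ {a , b} (there (here refl)))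
              (trans (V₂ 8 refl) (V₁ 8 refl)) refl (trans (V₂ 10 refl) (trans (V₁ 10 refl) r₁₀)))
      λ s₃ V₃ A₃ (Q₃ , rep₃ , g₃ , diag₃ , a∈ , sub₃) →
    asg⨟ (ev-var (trans (V₃ 12 refl) (trans (V₂ 12 refl) (V₁ 12 refl))))
    (asg⨟ (ev-var (trans (V₃ 12 refl) (trans (V₂ 12 refl) (V₁ 12 refl))))
    (framed (source-run {Q = Q₃} rep₃ g₃ diag₃ (e∈ {b , a} (here refl)) refl refl (trans (V₃ 10 refl) (trans (V₂ 10 refl) (trans (V₁ 10 refl) r₁₀))))
      λ s₄ V₄ A₄ (Q₄ , rep₄ , g₄ , diag₄ , b∈ , sub₄) → record
        { pre = pre′
        ; done = (a , b) ∷ done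
        ; split = es≡
        ; left = left′
        ; r₂₀ = trans (V₄ 20 refl) (trans (V₃ 20 refl) (trans (V₂ 20 refl) (V₁ 20 refl)))
        ; r₁₀ = trans (V₄ 10 refl) (trans (V₃ 10 refl) (trans (V₂ 10 refl) (trans (V₁ 10 refl) r₁₀)))
        ; a₀ = trans (A₄ 0 refl) (trans (A₃ 0 refl) (trans (A₂ 0 refl) (trans (A₁ 0 refl) a₀)))
        ; a₁ = trans (A₄ 1 refl) (trans (A₃ 1 refl) (trans (A₂ 1 refl) (trans (A₁ 1 refl) a₁)))
        ; adj = subst₂ (AdjMem n (arcsOf ((a , b) ∷ done))) (sym (trans (A₄ 6 refl) (A₃ 6 refl))) (sym (trans (A₄ 7 refl) (A₃ 7 refl))) adj₂
        ; rep = rep₄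
        ; srcs = record { isGood = g₄ ; diag = diag₄ ; srcs = srcs′ b∈ (sub₄ _ a∈) (λ p p∈ → sub₄ p (sub₃ p p∈)) } }))))))
    where
    open Reading I hiding (pre)
    es≡ : es ≡ pre′ ++ (a , b) ∷ done
    es≡ = trans split (trans (cong (_++ done) pre≡) (++-assoc pre′ ((a , b) ∷ []) done))
    left′ : length pre′ ≡ r
    left′ = suc-injective (trans (sym (trans (length-++ pre′) (+-comm (length pre′) 1))) (trans (sym (cong length pre≡)) left))
    e∈ : ∀ {e} → e ∈ arcsOf ((a , b) ∷ done) → e ∈ arcs
    e∈ e∈′ = subst (λ l → _ ∈ arcsOf l) (sym es≡) (arcsOf-++ pre′ e∈′)
    a<n : a < n
    a<n = arcsOf-< es es-< (e∈ {a , b} (there (here refl)))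
    b<n : b < n
    b<n = arcsOf-< es es-< (e∈ (here refl))
    few : suc (suc (length (arcsOf done))) ≤ n * n + n * n
    few = begin
      suc (suc (length (arcsOf done))) ≡⟨ length-arcsOf ((a , b) ∷ done) ⟩
      2 * suc (length done)            ≤⟨ *-monoʳ-≤ 2 (≤-trans (m≤n+m _ (length pre′)) (≤-reflexive (trans (sym (length-++ pre′)) (sym (cong length es≡))))) ⟩
      2 * length es                    ≤⟨ *-monoʳ-≤ 2 es-few ⟩
      2 * (n * n)                      ≡⟨ cong (n * n +_) (+-identityʳ (n * n)) ⟩
      n * n + n * n ∎
      where open ≤-Reasoning
    rep₂ : ∀ {s₁ s₂} → FrameV (link 8 12) (setVar 12 b (setVar 8 a (setVar 20 r s))) s₁ →
      FrameA (link 8 12) (setVar 12 b (setVar 8 a (setVar 20 r s))) s₁ →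
      FrameV (link 12 8) s₁ s₂ → FrameA (link 12 8) s₁ s₂ → Rep (setVar 9 a s₂) Q
    rep₂ V₁ A₁ V₂ A₂ =
      mem-cong (trans (A₂ 2 refl) (A₁ 2 refl)) (trans (A₂ 3 refl) (A₁ 3 refl)) (trans (A₂ 4 refl) (A₁ 4 refl))
        (trans (A₂ 5 refl) (A₁ 5 refl)) (trans (A₂ 8 refl) (A₁ 8 refl)) (trans (A₂ 9 refl) (A₁ 9 refl)) (proj₁ rep)
      , regs-cong (trans (V₂ 0 refl) (V₁ 0 refl)) (trans (V₂ 3 refl) (V₁ 3 refl)) (trans (V₂ 4 refl) (V₁ 4 refl))
        (trans (V₂ 5 refl) (V₁ 5 refl)) (trans (V₂ 6 refl) (V₁ 6 refl)) (trans (V₂ 7 refl) (V₁ 7 refl)) (trans (V₂ 18 refl) (V₁ 18 refl)) (proj₂ rep)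
    srcs′ : ∀ {Q₄} → item b b 0 ∈ Q₄ → item a a 0 ∈ Q₄ → (∀ p → p ∈ Q → p ∈ Q₄) →
      ∀ {y z} → (y , z) ∈ arcsOf ((a , b) ∷ done) → item y y 0 ∈ Q₄
    srcs′ b∈ a∈ up (here refl)         = b∈
    srcs′ b∈ a∈ up (there (here refl)) = a∈
    srcs′ b∈ a∈ up (there (there e∈))  = up _ (Sources.srcs srcs e∈)

  read-run : ∀ {s} → Reading (length es) s → Run w read-edges s (suc (length es * 70)) Read
  read-run I = while-count Reading 69 stp (length es) I
    where
    stp : ∀ r s → Reading r s → (Ev w s (var 20) 0 × Read s)
      ⊎ (∃[ r′ ] ∃[ v ] (r ≡ suc r′ × Ev w s (var 20) (suc v) × Run w _ s 69 (Reading r′)))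
    stp (suc r) s I = inj₂ (r , r , refl , ev-var (Reading.r₂₀ I) , read-step I)
    stp zero s I = inj₁ (ev-var (Reading.r₂₀ I) , subst (λ d → AdjMem n (arcsOf d) (arrays s 6) (arrays s 7)) done≡ (Reading.adj I)
      , Reading.Q I , Reading.rep I , subst (λ d → Sources d (Reading.Q I)) done≡ (Reading.srcs I))
      where
      done≡ : Reading.done I ≡ es
      done≡ with Reading.pre I | Reading.left I | Reading.split I
      ... | [] | _ | split = sym split

-- Greedy choice of pivots

-- Indexing from the back, as in `Stored`: prepending a new pivot leaves the numbers of the earlier
-- ones unchanged.
atB : List ℕ → ℕ → ℕ
atB []       r = 0
atB (p ∷ ps) r = if r ≡ᵇ length ps then p else atB ps r

atB-last : ∀ p ps → atB (p ∷ ps) (length ps) ≡ p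
atB-last p ps rewrite ≡ᵇ-refl (length ps) = refl

atB-∷ : ∀ p ps {r} → r < length ps → atB (p ∷ ps) r ≡ atB ps r
atB-∷ p ps r< rewrite ≢⇒≡ᵇ-false (<⇒≢ r<) = refl

module Greedy (n κ : ℕ) (Q src : List Item)
  (vtx-< : ∀ {q} → q ∈ Q → vtx q < n) (key-< : ∀ {q} → q ∈ Q → key q < n)
  (once : ∀ y x → mult Q y x ≤ 1)
  (key-src : ∀ {q} → q ∈ Q → ∃[ p ] (p ∈ src × key p ≡ key q))
  (src-once : ∀ x → ∑ (λ p → [ key p ≣ x ]) src ≤ 1) where

  -- N y = 0 means that no pivot has been chosen for y yet; only full lists need one.
  unhit : (ℕ → ℕ) → ℕ → ℕ
  unhit N y = [ N y ≣ 0 ] * [ cnt Q y ≣ κ ]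

  -- What choosing `x` would gain: the number of full lists that contain `x` and still lack a pivot.
  load : (ℕ → ℕ) → ℕ → ℕ
  load N x = ∑ (λ q → unhit N (vtx q)) (sel key x Q)

  total : (ℕ → ℕ) → ℕ
  total N = ∑ (unhit N) (downFrom n)

  unhit-≤1 : ∀ N y → unhit N y ≤ 1
  unhit-≤1 N y = *-mono-≤ ([≣]-≤1 (N y) 0) ([≣]-≤1 (cnt Q y) κ)

  total-≤ : ∀ N → total N ≤ n
  total-≤ N = ≤-trans (∑-≤-const (downFrom n) (λ {y} _ → unhit-≤1 N y))
    (≤-reflexive (trans (*-identityʳ _) (length-downFrom n)))

  load-mult : ∀ N x → load N x ≡ ∑ (λ y → mult Q y x * unhit N y) (downFrom n)
  load-mult N x = begin
    load N x                                                        ≡⟨ ∑-sel key x _ Q ⟩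
    ∑ (λ q → [ key q ≣ x ] * unhit N (vtx q)) Q                       ≡⟨ ∑-fiber vtx _ Q vtx-< ⟩
    ∑ (λ y → ∑ (λ q → [ vtx q ≣ y ] * ([ key q ≣ x ] * unhit N (vtx q))) Q) (downFrom n)
      ≡⟨ ∑-cong (downFrom n) (λ {y} _ → trans (∑-cong Q (λ {q} _ → point y q)) (factor y Q)) ⟩
    ∑ (λ y → mult Q y x * unhit N y) (downFrom n) ∎
    where
    open ≡-Reasoning
    point : ∀ y q → [ vtx q ≣ y ] * ([ key q ≣ x ] * unhit N (vtx q)) ≡ [ vtx q ≣ y ] * [ key q ≣ x ] * unhit N y
    point y q with vtx q ≟ y
    ... | yes refl = sym (*-assoc [ vtx q ≣ vtx q ] _ _)
    ... | no ne rewrite [≣]-≢ ne = refl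
    factor : ∀ y P → ∑ (λ q → [ vtx q ≣ y ] * [ key q ≣ x ] * unhit N y) P ≡ mult P y x * unhit N y
    factor y []      = refl
    factor y (q ∷ P) = trans (cong (_ +_) (factor y P)) (sym (*-distribʳ-+ (unhit N y) ([ vtx q ≣ y ] * [ key q ≣ x ]) _))

  load-≤n : ∀ N x → load N x ≤ n
  load-≤n N x = ≤-trans (≤-trans (≤-reflexive (load-mult N x)) (∑-mono (downFrom n) λ {y} _ →
      ≤-trans (*-monoˡ-≤ (unhit N y) (once y x)) (≤-reflexive (*-identityˡ _)))) (total-≤ N)

  load-mono : ∀ {N N′} x → (∀ {y} → y < n → unhit N′ y ≤ unhit N y) → load N′ x ≤ load N x
  load-mono x le = ∑-mono (sel key x Q) λ q∈ → le (vtx-< (proj₁ (∈-sel⁻ key Q q∈)))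

  -- Double counting: every list that counts in `total` is full, so it contributes to exactly `κ`
  -- loads, one for each of its items.
  ∑-load : ∀ N → ∑ (load N) (downFrom n) ≡ κ * total N
  ∑-load N = begin
    ∑ (load N) (downFrom n)                                     ≡⟨ ∑-cong (downFrom n) (λ {x} _ → ∑-sel key x _ Q) ⟩
    ∑ (λ x → ∑ (λ q → [ key q ≣ x ] * unhit N (vtx q)) Q) (downFrom n) ≡⟨ ∑-fiber key _ Q key-< ⟨
    ∑ (λ q → unhit N (vtx q)) Q                                   ≡⟨ ∑-fiber vtx _ Q vtx-< ⟩
    ∑ (λ y → ∑ (λ q → [ vtx q ≣ y ] * unhit N (vtx q)) Q) (downFrom n)
      ≡⟨ ∑-cong (downFrom n) (λ {y} _ → trans (∑-cong Q (λ {q} _ → point y q)) (trans (factor y Q) (full y))) ⟩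
    ∑ (λ y → κ * unhit N y) (downFrom n)                          ≡⟨ ∑-* κ _ (downFrom n) ⟩
    κ * total N ∎
    where
    open ≡-Reasoning
    point : ∀ y q → [ vtx q ≣ y ] * unhit N (vtx q) ≡ [ vtx q ≣ y ] * unhit N y
    point y q with vtx q ≟ y
    ... | yes refl = refl
    ... | no ne rewrite [≣]-≢ ne = refl
    factor : ∀ y P → ∑ (λ q → [ vtx q ≣ y ] * unhit N y) P ≡ ∑ (λ q → [ vtx q ≣ y ]) P * unhit N y
    factor y []      = refl
    factor y (q ∷ P) = trans (cong (_ +_) (factor y P)) (sym (*-distribʳ-+ (unhit N y) [ vtx q ≣ y ] _))
    full : ∀ y → ∑ (λ q → [ vtx q ≣ y ]) Q * unhit N y ≡ κ * unhit N y
    full y rewrite sym (length-sel vtx y Q) with cnt Q y ≟ κ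
    ... | yes e≡ = cong (_* unhit N y) e≡
    ... | no ne = trans (cong (cnt Q y *_) zero′) (trans (*-zeroʳ (cnt Q y)) (sym (trans (cong (κ *_) zero′) (*-zeroʳ κ))))
      where
      zero′ : unhit N y ≡ 0
      zero′ = trans (cong ([ N y ≣ 0 ] *_) ([≣]-≢ ne)) (*-zeroʳ [ N y ≣ 0 ])

  record Marked (N : ℕ → ℕ) (x mk : ℕ) (N′ : ℕ → ℕ) : Set where
    field
      change : ∀ {y} → y < n → N′ y ≡ N y ⊎ (1 ≤ unhit N y × N′ y ≡ mk × ∃[ k ] item y x k ∈ Q)
      hit    : ∀ {q} → q ∈ sel key x Q → unhit N′ (vtx q) ≡ 0

  unhit-change : ∀ N N′ {mk} y {A : Set} → 1 ≤ mk → N′ y ≡ N y ⊎ (1 ≤ unhit N y × N′ y ≡ mk × A) → unhit N′ y ≤ unhit N y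
  unhit-change N N′ y mk≥1 (inj₁ e≡) = ≤-reflexive (cong (λ v → [ v ≣ 0 ] * [ cnt Q y ≣ κ ]) e≡)
  unhit-change N N′ {suc mk} y mk≥1 (inj₂ (_ , e≡ , _)) =
    subst (_≤ unhit N y) (sym (cong (λ v → [ v ≣ 0 ] * [ cnt Q y ≣ κ ]) e≡)) z≤n

  -- All vertices whose list contains `x` become hit, and each of them counted at most once in the
  -- load because keys do not repeat in a list.
  total-marked : ∀ {N x mk N′} → 1 ≤ mk → Marked N x mk N′ → total N′ + load N x ≤ total N
  total-marked {N} {x} {mk} {N′} mk≥1 M = begin
    total N′ + load N x                                                      ≡⟨ cong (total N′ +_) (load-mult N x) ⟩
    total N′ + ∑ (λ y → mult Q y x * unhit N y) (downFrom n)                   ≡⟨ ∑-+ (unhit N′) _ (downFrom n) ⟨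
    ∑ (λ y → unhit N′ y + mult Q y x * unhit N y) (downFrom n)                 ≤⟨ ∑-mono (downFrom n) (λ y∈ → point (∈-downFrom⁻ y∈)) ⟩
    total N ∎
    where
    open ≤-Reasoning
    point : ∀ {y} → y < n → unhit N′ y + mult Q y x * unhit N y ≤ unhit N y
    point {y} y<n with mult Q y x in m≡
    ... | zero = ≤-trans (≤-reflexive (+-identityʳ _)) (unhit-change N N′ y mk≥1 (Marked.change M y<n))
    ... | suc k with mult⁻ Q y x (subst (1 ≤_) (sym m≡) (s≤s z≤n))
    ...   | d , q∈Q rewrite Marked.hit M (∈-sel⁺ key q∈Q refl) =
      ≤-trans (*-monoˡ-≤ (unhit N y) (subst (_≤ 1) m≡ (once y x))) (≤-reflexive (*-identityˡ _))

  Hits : (ℕ → ℕ) → List ℕ → Set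
  Hits N pv = ∀ {y r} → y < n → N y ≡ suc r → r < length pv × ∃[ k ] item y (atB pv r) k ∈ Q

  hits-marked : ∀ {N x N′ pv} → Hits N pv → Marked N x (suc (length pv)) N′ → Hits N′ (x ∷ pv)
  hits-marked {N} {x} {N′} {pv} h M {y} {r} y<n e≡ with Marked.change M y<n
  ... | inj₁ same with h y<n (trans (sym same) e≡)
  ...   | r< , k , q∈Q = m≤n⇒m≤1+n r< , k , subst (λ p → item y p k ∈ Q) (sym (atB-∷ x pv r<)) q∈Q
  hits-marked {N} {x} {N′} {pv} h M {y} {r} y<n e≡ | inj₂ (_ , new , k , q∈Q) with suc-injective (trans (sym e≡) new)
  ... | refl = ≤-refl , k , subst (λ p → item y p k ∈ Q) (sym (atB-last x pv)) q∈Q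

  -- A pass examines only the keys of sources. Any other `x` occurs in no list, since every key
  -- comes from a source, and so has load 0.
  load-all : ∀ {N θ} → 1 ≤ θ → (∀ {p} → p ∈ src → load N (key p) < θ) → ∀ x → load N x < θ
  load-all {N} {θ} θ≥1 small x with sel key x Q in e≡
  ... | [] = θ≥1
  ... | q ∷ P with ∈-sel⁻ key {x} {q} Q (subst (q ∈_) (sym e≡) (here refl))
  ...   | q∈Q , refl with key-src q∈Q
  ...     | p , p∈src , k≡ = subst (λ R → ∑ (λ q → unhit N (vtx q)) R < θ) e≡ (subst (λ x → load N x < θ) k≡ (small p∈src))

  -- `R` and `R′` are the numbers of pivots before and after a pass. Each new one takes at least `θ`
  -- off `total`, so there are at most `total N` / θ of them. By `∑-load`, κ times `total` is the
  -- sum of `n` loads of at most `2 * θ`. Hence a pass adds at most 2n/κ pivots, whatever `θ` is.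
  phase-bound : ∀ {N θ R R′ U′} → 1 ≤ θ → (∀ x → load N x ≤ 2 * θ) → θ * R′ + U′ ≤ θ * R + total N →
    R′ * κ ≤ R * κ + 2 * n
  phase-bound {N} {θ} {R} {R′} {U′} θ≥1 small spent = *-cancelˡ-≤ θ {{>-nonZero θ≥1}} (begin
    θ * (R′ * κ)                  ≡⟨ *-assoc θ R′ κ ⟨
    θ * R′ * κ                    ≤⟨ *-monoˡ-≤ κ (≤-trans (m≤m+n _ U′) spent) ⟩
    (θ * R + total N) * κ         ≡⟨ *-distribʳ-+ κ (θ * R) (total N) ⟩
    θ * R * κ + total N * κ       ≡⟨ cong₂ _+_ (*-assoc θ R κ) (*-comm (total N) κ) ⟩
    θ * (R * κ) + κ * total N     ≡⟨ cong (θ * (R * κ) +_) (∑-load N) ⟨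
    θ * (R * κ) + ∑ (load N) (downFrom n) ≤⟨ +-monoʳ-≤ (θ * (R * κ)) (∑-≤-const (downFrom n) (λ {x} _ → small x)) ⟩
    θ * (R * κ) + length (downFrom n) * (2 * θ) ≡⟨ cong (λ k → θ * (R * κ) + k) (trans (cong (_* (2 * θ)) (length-downFrom n))
                                                     (trans (*-comm n (2 * θ)) (trans (cong (_* n) (*-comm 2 θ)) (*-assoc θ 2 n)))) ⟩
    θ * (R * κ) + θ * (2 * n)     ≡⟨ *-distribˡ-+ θ (R * κ) (2 * n) ⟨
    θ * (R * κ + 2 * n)           ∎)
    where open ≤-Reasoning

  -- Distinct sources have distinct keys, so the index by key presents each item at most once per
  -- pass.
  scan-cost : ∑ (λ p → length (sel key (key p) Q)) src ≤ length Q
  scan-cost = begin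
    ∑ (λ p → length (sel key (key p) Q)) src          ≡⟨ ∑-cong src (λ {p} _ → length-sel key (key p) Q) ⟩
    ∑ (λ p → ∑ (λ q → [ key q ≣ key p ]) Q) src        ≡⟨ ∑-swap (λ p q → [ key q ≣ key p ]) src Q ⟩
    ∑ (λ q → ∑ (λ p → [ key q ≣ key p ]) src) Q        ≤⟨ ∑-mono Q (λ {q} _ → ≤-trans (≤-reflexive (∑-cong src λ {p} _ → [≣]-sym (key q) (key p))) (src-once (key q))) ⟩
    ∑ (λ _ → 1) Q                                     ≡⟨ trans (∑-const 1 Q) (*-identityʳ _) ⟩
    length Q ∎
    where open ≤-Reasoning

-- Variables: 20 index, 21 number of sources, 22 threshold, 23 source, 24 index,
-- 25 load, 26 mark, 27 number of pivots, 28 vertex.  Array 10 holds the pivots.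
unhitE : Expr
unhitE = bin mul (bin eq (get 2 (addrE 0 0 (lit 3) (var 28))) (lit 0))
                 (bin eq (get 2 (addrE 0 0 (lit 1) (var 28))) (var 2))

fetch compute-load mark-vertices consider phase choose-pivots : Cmd
fetch =
    24 ≔ bin sub (var 24) (lit 1)
  ⨟ 28 ≔ get 9 (bin add (bin mul (var 24) (var 0)) (var 23))
compute-load =
    25 ≔ lit 0
  ⨟ 24 ≔ get 8 (var 23)
  ⨟ while (var 24) (fetch ⨟ 25 ≔ bin add (var 25) unhitE)
mark-vertices =
    24 ≔ get 8 (var 23)
  ⨟ while (var 24) (fetch ⨟ put 2 (addrE 0 0 (lit 3) (var 28))
      (bin add (get 2 (addrE 0 0 (lit 3) (var 28))) (bin mul (var 26) unhitE)))
consider =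
    20 ≔ bin sub (var 20) (lit 1)
  ⨟ 23 ≔ get 4 (var 20)
  ⨟ compute-load
  ⨟ ifnz (bin lt (var 25) (var 22))
      skip
      (put 10 (var 27) (var 23) ⨟ 27 ≔ bin add (var 27) (lit 1) ⨟ 26 ≔ var 27 ⨟ mark-vertices)
phase =
    20 ≔ var 21
  ⨟ while (var 20) consider
  ⨟ 22 ≔ bin quo (var 22) (lit 2)
choose-pivots =
    22 ≔ var 0
  ⨟ while (var 22) phase

module GreedyRun (w n : ℕ) (n≥1 : 1 ≤ n) (room : 64 * (n * (n * n)) ≤ 2 ^ w)
  (κ : ℕ) (Q src : List Item)
  (vtx-< : ∀ {q} → q ∈ Q → vtx q < n) (key-< : ∀ {q} → q ∈ Q → key q < n)
  (once : ∀ y x → mult Q y x ≤ 1)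
  (key-src : ∀ {q} → q ∈ Q → ∃[ p ] (p ∈ src × key p ≡ key q))
  (src-once : ∀ x → ∑ (λ p → [ key p ≣ x ]) src ≤ 1)
  (src-⊆ : ∀ {p} → p ∈ src → p ∈ Q) (Q-few : length Q ≤ n * n) (src-few : length src ≤ n * n)
  (D₁ QK IC IV : ℕ → ℕ)
  (cnt-row : ∀ {y} → y < n → D₁ (addr n 0 1 y) ≡ cnt Q y)
  (near-zero : ∀ {y} → y < n → D₁ (addr n 0 3 y) ≡ 0)
  (ic : ∀ {x} → x < n → IC x ≡ length (sel key x Q))
  (iv : ∀ {x} → x < n → Stored (λ k → k * n + x) vtx IV (sel key x Q))
  (qk : Stored (λ k → k) key QK src) where

  open Words w n n≥1 room
  open Greedy n κ Q src vtx-< key-< once key-src src-once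

  nearOf : (ℕ → ℕ) → ℕ → ℕ
  nearOf D y = D (addr n 0 3 y)

  record GR (s : State) : Set where
    field
      g₀    : vars s 0 ≡ n
      g₂    : vars s 2 ≡ κ
      g₂₁   : vars s 21 ≡ length src
      b₄    : arrays s 4 ≡ QK
      b₈    : arrays s 8 ≡ IC
      b₉    : arrays s 9 ≡ IV
      other : ∀ {i} → (∀ {y} → y < n → addr n 0 3 y ≢ i) → arrays s 2 i ≡ D₁ i

  gr-cong : ∀ {s s′} → GR s → vars s′ 0 ≡ vars s 0 → vars s′ 2 ≡ vars s 2 → vars s′ 21 ≡ vars s 21 →
    arrays s′ 2 ≡ arrays s 2 → arrays s′ 4 ≡ arrays s 4 → arrays s′ 8 ≡ arrays s 8 → arrays s′ 9 ≡ arrays s 9 → GR s′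
  gr-cong G e₀ e₂ e₂₁ a₂ a₄ a₈ a₉ = record
    { g₀ = trans e₀ (GR.g₀ G) ; g₂ = trans e₂ (GR.g₂ G) ; g₂₁ = trans e₂₁ (GR.g₂₁ G)
    ; b₄ = trans a₄ (GR.b₄ G) ; b₈ = trans a₈ (GR.b₈ G) ; b₉ = trans a₉ (GR.b₉ G)
    ; other = λ {i} ne → trans (cong-app a₂ i) (GR.other G ne) }

  3<4n : 3 < 4 * n
  3<4n = m≤m*n 4 n {{>-nonZero n≥1}}

  1<4n : 1 < 4 * n
  1<4n = ≤-trans (s≤s (s≤s z≤n)) 3<4n

  n≤1*n³ : n ≤ 1 * n³
  n≤1*n³ = ≤-trans n≤n³ (≤-reflexive (sym (*-identityˡ n³)))

  cnt-at : ∀ {s y} → GR s → y < n → arrays s 2 (addr n 0 1 y) ≡ cnt Q y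
  cnt-at G y<n = trans (GR.other G (λ z<n → addr-≢ʳ n z<n y<n λ ())) (cnt-row y<n)

  ev-near : ∀ {s y} → GR s → vars s 28 ≡ y → y < n → Ev w s (addrE 0 0 (lit 3) (var 28)) (addr n 0 3 y)
  ev-near G h y<n = ev-addr {c = 0} (s≤s z≤n) (ev-const 3 (m≤m+n 4 60)) (ev-var (GR.g₀ G)) (ev-var h) 3<4n y<n

  ev-unhit : ∀ {s y} → GR s → vars s 28 ≡ y → y < n → Ev w s unhitE (unhit (nearOf (arrays s 2)) y)
  ev-unhit {s} {y} G h y<n = ev-mul
    (ev-eq 2≤2^w (ev-get (ev-near G h y<n) refl) ev-zero)
    (ev-eq 2≤2^w (ev-get (ev-addr {c = 0} (s≤s z≤n) ev-one (ev-var (GR.g₀ G)) (ev-var h) 1<4n y<n) (cnt-at G y<n)) (ev-var (GR.g₂ G)))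
    (fit-lit (≤-<-trans (unhit-≤1 (nearOf (arrays s 2)) y) (m≤m+n 2 62)))

  unhit-cong : ∀ {N N′ : ℕ → ℕ} {y} → N y ≡ N′ y → unhit N y ≡ unhit N′ y
  unhit-cong {y = y} e≡ = cong (λ v → [ v ≣ 0 ] * [ cnt Q y ≣ κ ]) e≡

  record Scan (x : ℕ) (rest : List Item) (s : State) : Set where
    field
      gr  : GR s
      s₂₃ : vars s 23 ≡ x
      s₂₄ : vars s 24 ≡ length rest
      st  : Stored (λ k → k * n + x) vtx IV rest
      few : length rest ≤ n * n
      low : ∀ {q} → q ∈ rest → q ∈ Q

  scan-start : ∀ {x s} → x < n → GR s → vars s 23 ≡ x → vars s 24 ≡ length (sel key x Q) → Scan x (sel key x Q) s
  scan-start {x} x<n G h₂₃ h₂₄ = record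
    { gr = G ; s₂₃ = h₂₃ ; s₂₄ = h₂₄ ; st = iv x<n ; few = ≤-trans (length-sel-≤ key x Q) Q-few
    ; low = λ q∈ → proj₁ (∈-sel⁻ key Q q∈) }

  fetch-run : ∀ {x q rest s} → x < n → Scan x (q ∷ rest) s →
    Run w fetch s 3 (λ s′ → Scan x rest s′ × vars s′ 28 ≡ vtx q)
  fetch-run {x} {q} {rest} {s} x<n S =
    asg⨟ (ev-pred (ev-var s₂₄))
    (asg (ev-get (ev-idx {a = length rest} 1 (ev-var refl) (ev-var (GR.g₀ gr)) (ev-var s₂₃) x<n
            (≤-trans (*-monoˡ-≤ n few) (≤-reflexive (trans (*-assoc n n n) (sym (*-identityˡ n³))))) (m≤m+n 2 62))
            (trans (cong-app (GR.b₉ gr) (length rest * n + x)) (proj₁ st)))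
      (record { gr = gr-cong {s} gr refl refl refl refl refl refl refl ; s₂₃ = s₂₃ ; s₂₄ = refl ; st = proj₂ st
              ; few = ≤-trans (n≤1+n _) few ; low = λ q∈ → low (there q∈) } , refl))
    where open Scan S

  load-run : ∀ {x s} → x < n → GR s → vars s 23 ≡ x →
    Run w compute-load s (5 + ∑ (λ _ → 6) (sel key x Q)) (λ s′ → vars s′ 25 ≡ load (nearOf (arrays s 2)) x)
  load-run {x} {s} x<n G h₂₃ =
    asg⨟ ev-zero
    (asg⨟ (ev-get (ev-var h₂₃) (trans (cong-app (GR.b₈ G) x) (ic x<n)))
    (while-list Inv (λ _ → 5) (λ s′ (S , A , e≡) → ev-var (Scan.s₂₄ S) , trans (sym (+-identityʳ _)) e≡) stp (sel key x Q)
      (scan-start x<n (gr-cong {s} G refl refl refl refl refl refl refl) h₂₃ refl , refl , refl)))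
    where
    N : ℕ → ℕ
    N = nearOf (arrays s 2)
    Inv : List Item → State → Set
    Inv rest s′ = Scan x rest s′ × arrays s′ 2 ≡ arrays s 2 × vars s′ 25 + ∑ (λ q → unhit N (vtx q)) rest ≡ load N x
    stp : ∀ q rest s′ → Inv (q ∷ rest) s′ →
      ∃[ v ] (Ev w s′ (var 24) (suc v) × Run w (fetch ⨟ 25 ≔ bin add (var 25) unhitE) s′ 5 (Inv rest))
    stp q rest s′ (S , A , e≡) = length rest , ev-var (Scan.s₂₄ S) ,
      call⨟ (fetch-run x<n S) λ s″ V₁ A₁ (S₁ , h₂₈) →
        let u≡ : unhit (nearOf (arrays s″ 2)) (vtx q) ≡ unhit N (vtx q)
            u≡ = unhit-cong {nearOf (arrays s″ 2)} {N} (cong-app (trans (A₁ 2 refl) A) (addr n 0 3 (vtx q)))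
            c≤ : vars s′ 25 + unhit N (vtx q) + ∑ (λ q → unhit N (vtx q)) rest ≡ load N x
            c≤ = trans (+-assoc (vars s′ 25) _ _) e≡
        in asg (ev-add (ev-var (V₁ 25 refl)) (ev-≡ u≡ (ev-unhit (Scan.gr S₁) h₂₈ (vtx-< (Scan.low S (here refl)))))
                 (fit 1 (≤-trans (≤-trans (m≤m+n _ _) (≤-reflexive c≤)) (≤-trans (load-≤n N x) n≤1*n³)) (m≤m+n 2 62)))
             (record { gr = gr-cong {s″} (Scan.gr S₁) refl refl refl refl refl refl refl ; s₂₃ = Scan.s₂₃ S₁ ; s₂₄ = Scan.s₂₄ S₁
                     ; st = Scan.st S₁ ; few = Scan.few S₁ ; low = Scan.low S₁ }
             , trans (A₁ 2 refl) A , c≤)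

  record Marking (N : ℕ → ℕ) (x mk : ℕ) (rest : List Item) (s : State) : Set where
    field
      scan   : Scan x rest s
      m₂₆    : vars s 26 ≡ mk
      change : ∀ {y} → y < n → nearOf (arrays s 2) y ≡ N y ⊎ (1 ≤ unhit N y × nearOf (arrays s 2) y ≡ mk × ∃[ k ] item y x k ∈ Q)
      hit    : ∀ {q} → q ∈ sel key x Q → q ∈ rest ⊎ unhit (nearOf (arrays s 2)) (vtx q) ≡ 0
      todo   : ∀ {q} → q ∈ rest → key q ≡ x

  -- This is the branch-free write of `mark-vertices`. A vertex without a pivot has value 0, so
  -- adding `mk` times `unhit` makes it `mk`; otherwise `unhit` is 0 and the value stays. Either way
  -- the vertex is not unhit afterwards.
  mark-value : ∀ N N₁ {x mk y} → 1 ≤ mk → ∃[ k ] item y x k ∈ Q →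
    N₁ y ≡ N y ⊎ (1 ≤ unhit N y × N₁ y ≡ mk × ∃[ k ] item y x k ∈ Q) →
    (N₁ y + mk * unhit N₁ y ≡ N y ⊎ (1 ≤ unhit N y × N₁ y + mk * unhit N₁ y ≡ mk × ∃[ k ] item y x k ∈ Q))
    × [ N₁ y + mk * unhit N₁ y ≣ 0 ] * [ cnt Q y ≣ κ ] ≡ 0
  mark-value N N₁ {x} {mk} {y} mk≥1 q∈Q ch = go (unhit N₁ y) refl
    where
    value : ∀ {u} → unhit N₁ y ≡ u → ∀ {v} → N₁ y + mk * u ≡ v → N₁ y + mk * unhit N₁ y ≡ v
    value u≡ = trans (cong (λ u → N₁ y + mk * u) u≡)
    go : ∀ u → unhit N₁ y ≡ u →
      (N₁ y + mk * unhit N₁ y ≡ N y ⊎ (1 ≤ unhit N y × N₁ y + mk * unhit N₁ y ≡ mk × ∃[ k ] item y x k ∈ Q))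
      × [ N₁ y + mk * unhit N₁ y ≣ 0 ] * [ cnt Q y ≣ κ ] ≡ 0
    go zero u≡ = subst (λ v → v ≡ N y ⊎ (1 ≤ unhit N y × v ≡ mk × ∃[ k ] item y x k ∈ Q)) (sym same) ch
      , trans (cong (λ v → [ v ≣ 0 ] * [ cnt Q y ≣ κ ]) same) u≡
      where
      same : N₁ y + mk * unhit N₁ y ≡ N₁ y
      same = value u≡ (trans (cong (N₁ y +_) (*-zeroʳ mk)) (+-identityʳ (N₁ y)))
    go (suc j) u≡ = choose ch , trans (cong (λ v → [ v ≣ 0 ] * [ cnt Q y ≣ κ ]) new)
        (cong (_* [ cnt Q y ≣ κ ]) ([≣]-≢ (λ mk≡0 → contradiction (subst (1 ≤_) mk≡0 mk≥1) λ ())))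
      where
      positive : 1 ≤ unhit N₁ y
      positive = subst (1 ≤_) (sym u≡) (s≤s z≤n)
      N₁≡0 : N₁ y ≡ 0
      N₁≡0 = [≣]-positive (N₁ y) 0 (proj₁ (*-positive [ N₁ y ≣ 0 ] [ cnt Q y ≣ κ ] positive))
      new : N₁ y + mk * unhit N₁ y ≡ mk
      new = value (≤-antisym (unhit-≤1 N₁ y) positive) (cong₂ _+_ N₁≡0 (*-identityʳ mk))
      choose : N₁ y ≡ N y ⊎ (1 ≤ unhit N y × N₁ y ≡ mk × ∃[ k ] item y x k ∈ Q) →
        N₁ y + mk * unhit N₁ y ≡ N y ⊎ (1 ≤ unhit N y × N₁ y + mk * unhit N₁ y ≡ mk × ∃[ k ] item y x k ∈ Q)
      choose (inj₁ same) = inj₂ (subst (1 ≤_) (unhit-cong {N₁} {N} {y} same) positive , new , q∈Q)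
      choose (inj₂ (_ , e≡ , _)) = contradiction (subst (1 ≤_) (trans (sym e≡) N₁≡0) mk≥1) λ ()

  mark-step : ∀ {N x mk q rest s} → x < n → 1 ≤ mk → mk ≤ n → (∀ {y} → y < n → N y ≤ n) → Marking N x mk (q ∷ rest) s →
    Run w (fetch ⨟ put 2 (addrE 0 0 (lit 3) (var 28))
      (bin add (get 2 (addrE 0 0 (lit 3) (var 28))) (bin mul (var 26) unhitE))) s 5 (Marking N x mk rest)
  mark-step {N} {x} {mk} {q} {rest} {s} x<n mk≥1 mk≤n N≤n M =
    call⨟ (fetch-run x<n (Marking.scan M)) λ s₁ V A (S₁ , h₂₈) → finish s₁ V A S₁ h₂₈
    where
    y : ℕ
    y = vtx q
    q∈Q : q ∈ Q
    q∈Q = Scan.low (Marking.scan M) (here refl)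
    y<n : y < n
    y<n = vtx-< q∈Q
    finish : ∀ s₁ → FrameV fetch s s₁ → FrameA fetch s s₁ → Scan x rest s₁ → vars s₁ 28 ≡ y →
      Run w (put 2 (addrE 0 0 (lit 3) (var 28)) (bin add (get 2 (addrE 0 0 (lit 3) (var 28))) (bin mul (var 26) unhitE)))
        s₁ 1 (Marking N x mk rest)
    finish s₁ V A S₁ h₂₈ =
      put-run (ev-near (Scan.gr S₁) h₂₈ y<n)
        (ev-add (ev-get (ev-near (Scan.gr S₁) h₂₈ y<n) refl)
          (ev-mul (ev-var (trans (V 26 refl) (Marking.m₂₆ M))) (ev-unhit (Scan.gr S₁) h₂₈ y<n) (fit 1 (≤-trans mul≤ n≤1*n³) (m≤m+n 2 62)))
          (fit 2 (+-mono-≤ (≤-trans near≤ n≤n³) (≤-trans mul≤ (≤-trans n≤n³ (m≤m+n n³ 0)))) (m≤m+n 3 61)))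
        (record
          { scan = record
            { gr = record { g₀ = GR.g₀ G ; g₂ = GR.g₂ G ; g₂₁ = GR.g₂₁ G ; b₄ = GR.b₄ G ; b₈ = GR.b₈ G ; b₉ = GR.b₉ G
                          ; other = λ ne → trans (update-other D v (ne y<n)) (GR.other G ne) }
            ; s₂₃ = Scan.s₂₃ S₁ ; s₂₄ = Scan.s₂₄ S₁ ; st = Scan.st S₁ ; few = Scan.few S₁ ; low = Scan.low S₁ }
          ; m₂₆ = trans (V 26 refl) (Marking.m₂₆ M)
          ; change = change′
          ; hit = hit′
          ; todo = λ q∈ → Marking.todo M (there q∈) })
      where
      G : GR s₁
      G = Scan.gr S₁
      D N₁ : ℕ → ℕ
      D = arrays s₁ 2
      N₁ = nearOf D
      v : ℕ
      v = N₁ y + mk * unhit N₁ y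
      ch : ∀ {z} → z < n → N₁ z ≡ N z ⊎ (1 ≤ unhit N z × N₁ z ≡ mk × ∃[ k ] item z x k ∈ Q)
      ch {z} z<n = subst (λ D → nearOf D z ≡ N z ⊎ (1 ≤ unhit N z × nearOf D z ≡ mk × ∃[ k ] item z x k ∈ Q)) (sym (A 2 refl)) (Marking.change M z<n)
      near≤ : N₁ y ≤ n
      near≤ with ch y<n
      ... | inj₁ e≡           = subst (_≤ n) (sym e≡) (N≤n y<n)
      ... | inj₂ (_ , e≡ , _) = subst (_≤ n) (sym e≡) mk≤n
      mul≤ : mk * unhit N₁ y ≤ n
      mul≤ = ≤-trans (*-monoʳ-≤ mk (unhit-≤1 N₁ y)) (≤-trans (≤-reflexive (*-identityʳ mk)) mk≤n)
      marked : (v ≡ N y ⊎ (1 ≤ unhit N y × v ≡ mk × ∃[ k ] item y x k ∈ Q)) × [ v ≣ 0 ] * [ cnt Q y ≣ κ ] ≡ 0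
      marked = mark-value N N₁ mk≥1 (dst q , subst (λ k → item y k (dst q) ∈ Q) (Marking.todo M (here refl)) q∈Q) (ch y<n)
      D′ : ℕ → ℕ
      D′ = update D (addr n 0 3 y) v
      same : nearOf D′ y ≡ v
      same = update-same D (addr n 0 3 y) v
      apart : ∀ {z} → z < n → y ≢ z → nearOf D′ z ≡ N₁ z
      apart z<n ne = update-other D v (addr-≢ʸ n y<n z<n ne)
      change′ : ∀ {z} → z < n → nearOf D′ z ≡ N z ⊎ (1 ≤ unhit N z × nearOf D′ z ≡ mk × ∃[ k ] item z x k ∈ Q)
      change′ {z} z<n with y ≟ z
      ... | yes refl = subst (λ v → v ≡ N y ⊎ (1 ≤ unhit N y × v ≡ mk × ∃[ k ] item y x k ∈ Q)) (sym same) (proj₁ marked)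
      ... | no ne    = subst (λ v → v ≡ N z ⊎ (1 ≤ unhit N z × v ≡ mk × ∃[ k ] item z x k ∈ Q)) (sym (apart z<n ne)) (ch z<n)
      hit′ : ∀ {p} → p ∈ sel key x Q → p ∈ rest ⊎ unhit (nearOf D′) (vtx p) ≡ 0
      hit′ {p} p∈ with y ≟ vtx p
      ... | yes refl = inj₂ (trans (cong (λ v → [ v ≣ 0 ] * [ cnt Q y ≣ κ ]) same) (proj₂ marked))
      ... | no ne with Marking.hit M p∈
      ...   | inj₁ (here refl)  = contradiction refl ne
      ...   | inj₁ (there p∈′)  = inj₁ p∈′
      ...   | inj₂ z = inj₂ (trans (unhit-cong {nearOf D′} {nearOf (arrays s 2)}
                (trans (apart (vtx-< (proj₁ (∈-sel⁻ key Q p∈))) ne) (cong-app (A 2 refl) _))) z)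

  mark-run : ∀ {x mk s} → x < n → 1 ≤ mk → mk ≤ n → (∀ {y} → y < n → nearOf (arrays s 2) y ≤ n) →
    GR s → vars s 23 ≡ x → vars s 26 ≡ mk →
    Run w mark-vertices s (3 + ∑ (λ _ → 6) (sel key x Q))
      (λ s′ → GR s′ × Marked (nearOf (arrays s 2)) x mk (nearOf (arrays s′ 2)))
  mark-run {x} {mk} {s} x<n mk≥1 mk≤n N≤n G h₂₃ h₂₆ =
    asg⨟ (ev-get (ev-var h₂₃) (trans (cong-app (GR.b₈ G) x) (ic x<n)))
    (while-list (Marking (nearOf (arrays s 2)) x mk) (λ _ → 5)
      (λ s′ M → ev-var (Scan.s₂₄ (Marking.scan M)) , Scan.gr (Marking.scan M)
        , record { change = Marking.change M ; hit = λ q∈ → done (Marking.hit M q∈) })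
      (λ q rest s′ M → length rest , ev-var (Scan.s₂₄ (Marking.scan M)) , mark-step x<n mk≥1 mk≤n N≤n M)
      (sel key x Q)
      (record { scan = scan-start x<n (gr-cong {s} G refl refl refl refl refl refl refl) h₂₃ refl ; m₂₆ = h₂₆
              ; change = λ _ → inj₁ refl ; hit = inj₁ ; todo = λ q∈ → proj₂ (∈-sel⁻ key Q q∈) }))
    where
    done : ∀ {q : Item} {A : Set} → q ∈ [] ⊎ A → A
    done (inj₂ a) = a

  -- `spent` is a potential: a new pivot adds `θ` to its first summand and takes at least `θ` off
  -- `total`. `few` is the same with 1 for `θ`; it keeps the number of pivots at most `n` through
  -- all passes.
  record Core (θ c₀ : ℕ) (D : ℕ → ℕ) (pv : List ℕ) : Set where
    field
      hits  : Hits (nearOf D) pv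
      spent : θ * length pv + total (nearOf D) ≤ c₀
      few   : length pv + total (nearOf D) ≤ n
      inner : All (λ p → ∃[ q ] (q ∈ src × key q ≡ p)) pv

  record Mid (θ c₀ : ℕ) (rest : List Item) (s : State) : Set where
    field
      {pv}  : List ℕ
      gr    : GR s
      m₂₀   : vars s 20 ≡ length rest
      m₂₂   : vars s 22 ≡ θ
      m₂₇   : vars s 27 ≡ length pv
      pvs   : Stored (λ k → k) (λ p → p) (arrays s 10) pv
      core  : Core θ c₀ (arrays s 2) pv
      small : ∀ {p} → p ∈ src → p ∈ rest ⊎ load (nearOf (arrays s 2)) (key p) < θ
      below : ∀ {p} → p ∈ rest → p ∈ src
      rest≤ : length rest ≤ n * n
      qks   : Stored (λ k → k) key QK rest

  core-≤n : ∀ {θ c₀ D pv} → Core θ c₀ D pv → ∀ {y} → y < n → nearOf D y ≤ n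
  core-≤n {D = D} {pv} C {y} y<n with nearOf D y in e≡
  ... | zero  = z≤n
  ... | suc r = ≤-trans (proj₁ (Core.hits C y<n e≡)) (≤-trans (m≤m+n _ _) (Core.few C))

  load-marked : ∀ {N x mk N′} → Marked N x mk N′ → load N′ x ≡ 0
  load-marked {x = x} M = trans (∑-cong (sel key x Q) (λ q∈ → Marked.hit M q∈)) (∑-zero (sel key x Q))

  core-marked : ∀ {θ c₀ D D′ pv x} → (∃[ q ] (q ∈ src × key q ≡ x)) → 1 ≤ θ → θ ≤ load (nearOf D) x → Core θ c₀ D pv →
    Marked (nearOf D) x (suc (length pv)) (nearOf D′) → Core θ c₀ D′ (x ∷ pv)
  core-marked {θ} {c₀} {D} {D′} {pv} {x} x∈ θ≥1 heavy C M = record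
    { hits  = hits-marked {nearOf D} {pv = pv} (Core.hits C) M
    ; spent = ≤-trans (≤-trans (≤-reflexive (trans (cong (_+ total (nearOf D′)) (*-suc θ (length pv))) (trans (cong (_+ total (nearOf D′)) (+-comm θ _)) (+-assoc (θ * length pv) θ _))))
                (+-monoʳ-≤ (θ * length pv) (≤-trans (+-monoˡ-≤ _ heavy) drop≤))) (Core.spent C)
    ; few   = ≤-trans (≤-reflexive (sym (+-suc (length pv) _))) (≤-trans (+-monoʳ-≤ (length pv) (≤-trans (+-monoˡ-≤ _ (≤-trans θ≥1 heavy)) drop≤)) (Core.few C))
    ; inner = x∈ ∷ Core.inner C }
    where
    drop≤ : load (nearOf D) x + total (nearOf D′) ≤ total (nearOf D)
    drop≤ = ≤-trans (≤-reflexive (+-comm (load (nearOf D) x) _)) (total-marked {nearOf D} {x} (s≤s z≤n) M)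

  -- Six steps per item for computing the load and six for marking.
  consider-cost : Item → ℕ
  consider-cost p = 20 + 12 * length (sel key (key p) Q)

  consider-step : ∀ {θ c₀ p rest s} → 1 ≤ θ → Mid θ c₀ (p ∷ rest) s → Run w consider s (consider-cost p) (Mid θ c₀ rest)
  consider-step {θ} {c₀} {p} {rest} {s} θ≥1 I = weaken (≤-reflexive time)
    (asg⨟ (ev-pred (ev-var m₂₀))
    (asg⨟ (ev-get (ev-var refl) (trans (cong-app (GR.b₄ gr) (length rest)) (proj₁ qks)))
    (call⨟ (load-run {x} x<n (gr-cong {s} gr refl refl refl refl refl refl refl) refl) λ s₁ V₁ A₁ h₂₅ → branch s₁ V₁ A₁ h₂₅)))
    where
    open Mid I
    x S : ℕ
    x = key p
    S = ∑ (λ _ → 6) (sel key x Q)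
    x<n : x < n
    x<n = key-< (src-⊆ (below (here refl)))
    N : ℕ → ℕ
    N = nearOf (arrays s 2)
    time : 4 + suc (5 + S + (suc (9 + S))) ≡ consider-cost p
    time = trans (cong (10 +_) (+-comm S (10 + S))) (cong (20 +_) (trans (cong₂ _+_ S≡ S≡)
      (sym (*-distribʳ-+ (length (sel key x Q)) 6 6))))
      where
      S≡ : S ≡ 6 * length (sel key x Q)
      S≡ = trans (∑-const 6 (sel key x Q)) (*-comm (length (sel key x Q)) 6)
    s₀ : State
    s₀ = setVar 23 x (setVar 20 (length rest) s)
    branch : ∀ s₁ → FrameV compute-load s₀ s₁ → FrameA compute-load s₀ s₁ → vars s₁ 25 ≡ load N x →
      Run w (ifnz (bin lt (var 25) (var 22)) skip
        (put 10 (var 27) (var 23) ⨟ 27 ≔ bin add (var 27) (lit 1) ⨟ 26 ≔ var 27 ⨟ mark-vertices)) s₁ (suc (9 + S)) (Mid θ c₀ rest)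
    branch s₁ V A h₂₅ with suc (load N x) ≤? θ
    ... | yes light = weaken (s≤s (≤-trans (m≤m+n 1 8) (m≤m+n 9 S))) (if₁
        (ev-≡ (bit-<ᵇ light) (ev-lt 2≤2^w (ev-var h₂₅) (ev-var (trans (V 22 refl) m₂₂))))
        (skip-run (record
          { gr = G₁ ; m₂₀ = V 20 refl ; m₂₂ = trans (V 22 refl) m₂₂ ; m₂₇ = trans (V 27 refl) m₂₇
          ; pvs = subst (λ f → Stored _ (λ p → p) f pv) (sym (A 10 refl)) pvs
          ; core = subst (λ D → Core θ c₀ D pv) (sym (A 2 refl)) core
          ; small = λ p∈ → subst (λ D → _ ⊎ load (nearOf D) _ < θ) (sym (A 2 refl)) (small′ p∈)
          ; below = λ p∈ → below (there p∈) ; rest≤ = ≤-trans (n≤1+n _) rest≤ ; qks = proj₂ qks })))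
      where
      G₁ : GR s₁
      G₁ = gr-cong {s} gr (V 0 refl) (V 2 refl) (V 21 refl) (A 2 refl) (A 4 refl) (A 8 refl) (A 9 refl)
      small′ : ∀ {q} → q ∈ src → q ∈ rest ⊎ load N (key q) < θ
      small′ q∈ with small q∈
      ... | inj₁ (here refl) = inj₂ light
      ... | inj₁ (there q∈′) = inj₁ q∈′
      ... | inj₂ l<          = inj₂ l<
    ... | no ¬light = if₀
        (ev-≡ (bit-≮ᵇ ¬light) (ev-lt 2≤2^w (ev-var h₂₅) (ev-var (trans (V 22 refl) m₂₂))))
        (put⨟ (ev-var (trans (V 27 refl) m₂₇)) (ev-var (V 23 refl))
        (asg⨟ (ev-suc 1 (ev-var (trans (V 27 refl) m₂₇)) (≤-trans R≤ n≤1*n³) (m≤m+n 3 61))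
        (asg⨟ (ev-var refl)
        (framed (mark-run {x} {suc (length pv)} x<n (s≤s z≤n) mk≤n near≤ (gr-cong {s₁} G₁ refl refl refl refl refl refl refl) (V 23 refl) refl)
          λ s₂ V₂ A₂ (G₂ , M₂) →
            let M = subst (λ D → Marked (nearOf D) x (suc (length pv)) (nearOf (arrays s₂ 2))) (A 2 refl) M₂
            in record
            { pv = x ∷ pv ; gr = G₂ ; m₂₀ = trans (V₂ 20 refl) (V 20 refl) ; m₂₂ = trans (V₂ 22 refl) (trans (V 22 refl) m₂₂)
            ; m₂₇ = V₂ 27 refl
            ; pvs = subst (λ f → Stored _ (λ p → p) f (x ∷ pv)) (sym (trans (A₂ 10 refl) (cong (λ f → update f (length pv) x) (A 10 refl))))
                ( update-same (arrays s 10) (length pv) x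
                , stored-update {at = λ k → k} {λ p → p} {arrays s 10} pv (λ k k< → <⇒≢ k< ∘ sym) pvs)
            ; core = core-marked {θ} {c₀} {arrays s 2} {arrays s₂ 2} (p , below (here refl) , refl) θ≥1 (≮⇒≥ ¬light) core M
            ; small = small′ M
            ; below = λ p∈ → below (there p∈) ; rest≤ = ≤-trans (n≤1+n _) rest≤ ; qks = proj₂ qks }))))
      where
      G₁ : GR s₁
      G₁ = gr-cong {s} gr (V 0 refl) (V 2 refl) (V 21 refl) (A 2 refl) (A 4 refl) (A 8 refl) (A 9 refl)
      R≤ : length pv ≤ n
      R≤ = ≤-trans (m≤m+n _ _) (Core.few core)
      -- A key heavy enough to be chosen has a vertex to hit, so `few` leaves room for one more
      -- pivot number.
      total≥1 : 1 ≤ total N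
      total≥1 with total N in e≡
      ... | suc _ = s≤s z≤n
      ... | zero  = contradiction (≤-trans (≤-trans θ≥1 (≮⇒≥ ¬light)) (≤-trans (≤-reflexive (load-mult N x)) none)) λ ()
        where
        none : ∑ (λ y → mult Q y x * unhit N y) (downFrom n) ≤ 0
        none = ≤-trans (∑-mono (downFrom n) (λ {y} _ → ≤-trans (*-monoˡ-≤ (unhit N y) (once y x)) (≤-reflexive (*-identityˡ _)))) (≤-reflexive e≡)
      mk≤n : suc (length pv) ≤ n
      mk≤n = ≤-trans (≤-trans (≤-reflexive (+-comm 1 (length pv))) (+-monoʳ-≤ (length pv) total≥1)) (Core.few core)
      near≤ : ∀ {y} → y < n → nearOf (arrays s₁ 2) y ≤ n
      near≤ {y} y<n = subst (λ D → nearOf D y ≤ n) (sym (A 2 refl)) (core-≤n core y<n)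
      small′ : ∀ {N′} → Marked N x (suc (length pv)) N′ → ∀ {q} → q ∈ src → q ∈ rest ⊎ load N′ (key q) < θ
      small′ {N′} M {q} q∈ with small q∈
      ... | inj₁ (here refl) = inj₂ (subst (_< θ) (sym (load-marked {N} M)) θ≥1)
      ... | inj₁ (there q∈′) = inj₁ q∈′
      ... | inj₂ l<          = inj₂ (≤-<-trans (load-mono {N} {N′} (key q) (λ {y} y<n → unhit-change N N′ y (s≤s z≤n) (Marked.change M y<n))) l<)

  phase-cost : ℕ
  phase-cost = 5 + ∑ (λ p → suc (consider-cost p)) src

  -- `r` bounds the passes still to come, as `θ` is halved after each. `sparse` reserves 2n/κ pivots
  -- for every one of them, hence at most `2 * n * r₀` / κ in all. `small` is what the previous pass
  -- achieved with twice the threshold.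
  record Phase (r₀ r : ℕ) (s : State) : Set where
    field
      {θ}   : ℕ
      {pv}  : List ℕ
      gr    : GR s
      p₂₂   : vars s 22 ≡ θ
      p₂₇   : vars s 27 ≡ length pv
      pvs   : Stored (λ k → k) (λ p → p) (arrays s 10) pv
      hits  : Hits (nearOf (arrays s 2)) pv
      few   : length pv + total (nearOf (arrays s 2)) ≤ n
      inner : All (λ p → ∃[ q ] (q ∈ src × key q ≡ p)) pv
      small : ∀ x → load (nearOf (arrays s 2)) x ≤ 2 * θ
      θ<    : θ < 2 ^ r
      θ≤    : θ ≤ n
      sparse : length pv * κ + 2 * n * r ≤ 2 * n * r₀

  phase-step : ∀ {r₀ r s} → (P : Phase r₀ (suc r) s) → 1 ≤ Phase.θ P → Run w phase s phase-cost (Phase r₀ r)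
  phase-step {r₀} {r} {s} P θ≥1 = weaken (≤-reflexive time)
    (asg⨟ (ev-var (GR.g₂₁ gr))
    (call⨟ (while-list (Mid θ c₀) consider-cost (λ s′ M → ev-var (Mid.m₂₀ M) , M)
             (λ p rest s′ M → length rest , ev-var (Mid.m₂₀ M) , consider-step θ≥1 M) src
             (record { gr = gr-cong {s} gr refl refl refl refl refl refl refl ; m₂₀ = refl ; m₂₂ = p₂₂ ; m₂₇ = p₂₇ ; pvs = pvs
                     ; core = record { hits = hits ; spent = ≤-refl ; few = few ; inner = inner }
                     ; small = inj₁ ; below = λ p∈ → p∈ ; rest≤ = src-few ; qks = qk }))
      λ s₁ V A M → asg (ev-half (ev-var (Mid.m₂₂ M)) (ev-const 2 (m≤m+n 3 61))) (record
        { gr = gr-cong {s₁} (Mid.gr M) refl refl refl refl refl refl refl ; p₂₂ = refl ; p₂₇ = Mid.m₂₇ M ; pvs = Mid.pvs M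
        ; hits = Core.hits (Mid.core M) ; few = Core.few (Mid.core M) ; inner = Core.inner (Mid.core M)
        ; small = λ x → half (load-all {nearOf (arrays s₁ 2)} θ≥1 (λ p∈ → finished (Mid.small M p∈)) x)
        ; θ< = m<n*o⇒m/o<n {θ} {2 ^ r} {2} (subst (θ <_) (*-comm 2 (2 ^ r)) θ<)
        ; θ≤ = ≤-trans (m/n≤m θ 2) θ≤
        ; sparse = thin {length (Mid.pv M)} (phase-bound {nearOf (arrays s 2)} {θ} {length pv} {length (Mid.pv M)} {total (nearOf (arrays s₁ 2))} θ≥1 small (Core.spent (Mid.core M))) })))
    where
    open Phase P
    c₀ : ℕ
    c₀ = θ * length pv + total (nearOf (arrays s 2))
    time : 2 + suc (suc (∑ (λ p → suc (consider-cost p)) src) + 1) ≡ phase-cost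
    time = cong (4 +_) (+-comm (∑ (λ p → suc (consider-cost p)) src) 1)
    finished : ∀ {p : Item} {A : Set} → p ∈ [] ⊎ A → A
    finished (inj₂ a) = a
    -- The strict inequality absorbs what rounding loses when `θ` is odd.
    half : ∀ {a} → a < θ → a ≤ 2 * (θ / 2)
    half {a} a<θ = s≤s⁻¹ (≤-trans a<θ (≤-trans (≤-reflexive (m≡m%n+[m/n]*n θ 2))
      (+-mono-≤ (s≤s⁻¹ (m%n<n θ 2)) (≤-reflexive (*-comm (θ / 2) 2)))))
    thin : ∀ {R′} → R′ * κ ≤ length pv * κ + 2 * n → R′ * κ + 2 * n * r ≤ 2 * n * r₀
    thin {R′} le = ≤-trans (+-monoˡ-≤ (2 * n * r) le) (≤-trans (≤-reflexive (trans (+-assoc (length pv * κ) (2 * n) _)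
      (cong (length pv * κ +_) (sym (*-suc (2 * n) r))))) sparse)

  record Chosen (r₀ : ℕ) (s : State) : Set where
    field
      {pv}  : List ℕ
      gr    : GR s
      c₂₇   : vars s 27 ≡ length pv
      pvs   : Stored (λ k → k) (λ p → p) (arrays s 10) pv
      hits  : Hits (nearOf (arrays s 2)) pv
      few   : length pv ≤ n
      inner : All (λ p → ∃[ q ] (q ∈ src × key q ≡ p)) pv
      sparse : length pv * κ ≤ 2 * n * r₀
      covered : ∀ {q} → q ∈ Q → cnt Q (vtx q) ≡ κ → ∃[ r ] nearOf (arrays s 2) (vtx q) ≡ suc r

  choose-run : ∀ {s} r₀ → n < 2 ^ r₀ → GR s → vars s 27 ≡ 0 → (∀ i → arrays s 2 i ≡ D₁ i) →
    Run w choose-pivots s (2 + suc (r₀ * suc phase-cost)) (Chosen r₀)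
  choose-run {s} r₀ n< G h₂₇ D≡ =
    asg⨟ (ev-var (GR.g₀ G))
    (while-count (Phase r₀) phase-cost stp r₀ (record
      { pv = [] ; gr = gr-cong {s} G refl refl refl refl refl refl refl ; p₂₂ = refl ; p₂₇ = h₂₇ ; pvs = tt
      ; hits = λ {y} y<n e≡ → contradiction (trans (sym e≡) (trans (D≡ _) (near-zero y<n))) λ ()
      ; few = total-≤ (nearOf (arrays s 2)) ; inner = []
      ; small = λ x → ≤-trans (load-≤n (nearOf (arrays s 2)) x) (m≤m+n n _)
      ; θ< = n< ; θ≤ = ≤-refl ; sparse = ≤-refl }))
    where
    stp : ∀ r s → Phase r₀ r s → (Ev w s (var 22) 0 × Chosen r₀ s)
      ⊎ (∃[ r′ ] ∃[ v ] (r ≡ suc r′ × Ev w s (var 22) (suc v) × Run w phase s phase-cost (Phase r₀ r′)))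
    stp r s P with Phase.θ P in θ≡
    stp r s P | zero = inj₁ (ev-var (trans p₂₂ θ≡) , record
      { gr = gr ; c₂₇ = p₂₇ ; pvs = pvs ; hits = hits ; few = ≤-trans (m≤m+n _ _) few ; inner = inner
      ; sparse = ≤-trans (m≤m+n _ _) sparse ; covered = covered })
      where
      open Phase P
      covered : ∀ {q} → q ∈ Q → cnt Q (vtx q) ≡ κ → ∃[ r ] nearOf (arrays s 2) (vtx q) ≡ suc r
      -- At threshold 0 every load is 0, whereas a full list without a pivot would contribute 1 to
      -- the load of each of its keys.
      covered {q} q∈Q full with nearOf (arrays s 2) (vtx q) in near≡
      ... | suc r = r , refl
      ... | zero  = contradiction (≤-trans one (≤-trans (∑-∈ (λ p → unhit (nearOf (arrays s 2)) (vtx p)) (∈-sel⁺ key q∈Q refl))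
                      (subst (λ θ → load (nearOf (arrays s 2)) (key q) ≤ 2 * θ) θ≡ (small (key q))))) λ ()
        where
        one : 1 ≤ unhit (nearOf (arrays s 2)) (vtx q)
        one = ≤-reflexive (sym (cong₂ _*_ (cong (λ v → [ v ≣ 0 ]) near≡) (trans (cong (λ v → [ v ≣ κ ]) full) ([≣]-refl κ))))
    stp zero s P | suc θ = contradiction (≤-trans (≤-trans (s≤s (s≤s z≤n)) (≤-reflexive (cong suc (sym θ≡)))) (Phase.θ< P)) λ { (s≤s ()) }
    stp (suc r) s P | suc θ = inj₂ (r , θ , refl , ev-var (trans (Phase.p₂₂ P) θ≡)
      , phase-step P (subst (1 ≤_) (sym θ≡) (s≤s z≤n)))

-- The construction

Path-++ : ∀ {arcs k l u v z} → Path arcs k u v → Path arcs l v z → Path arcs (k + l) u z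
Path-++ nil        q = q
Path-++ (cons e p) q = cons e (Path-++ p q)

Path-reverse : ∀ {arcs} → (∀ {y z} → (y , z) ∈ arcs → (z , y) ∈ arcs) → ∀ {l u v} → Path arcs l u v → Path arcs l v u
Path-reverse sy nil = nil
Path-reverse {arcs} sy {suc l} {u} {v} (cons e p) = subst (λ k → Path arcs k v u) (+-comm l 1) (Path-++ (Path-reverse sy p) (cons (sy e) nil))

-- All that a query may rely on. In `complete`, the alternative to finding `x` in the list of `y` is
-- a pivot within `suc l` of `y`, expressed by what it is good for: its stored distance to any `z`
-- is at most that of the detour through `y`. Length 0 is left out because an isolated vertex has an
-- empty list.
record Table (n κ R : ℕ) (arcs : List (ℕ × ℕ)) (D : ℕ → ℕ) : Set where
  field
    balls    : List Item
    root     : ℕ → ℕ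
    sound    : ∀ {q} → q ∈ balls → key q < n × Path arcs (dst q) (vtx q) (key q) × dst q ≤ n * n
    cnt-≤    : ∀ y → cnt balls y ≤ κ
    counts   : ∀ {y} → y < n → D (addr n 0 1 y) ≡ cnt balls y
    keys     : ∀ {y} → y < n → Stored (λ k → addr n 2 k y) key D (sel vtx y balls)
    dists    : ∀ {y} → y < n → Stored (λ k → addr n 3 k y) dst D (sel vtx y balls)
    near     : ∀ {y} → y < n → D (addr n 0 3 y) ≤ R
    -- With `≤` and not `<`: at a vertex without a pivot the query reads row 0, even if there are no
    -- pivots at all. Whatever is found there has to be the length of a path.
    matrix   : ∀ {r y e} → r < n → r ≤ R → y < n → D (addr n 1 r y) ≡ suc e → Path arcs e y (root r) × e ≤ n * n
    complete : ∀ {y l x} → y < n → Path arcs (suc l) y x →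
      (∃[ k ] (k ≤ suc l × item y x k ∈ balls))
      ⊎ (∃[ r ] (D (addr n 0 3 y) ≡ suc r × r < R
          × (∀ {z j} → z < n → Path arcs j y z → ∃[ e ] (e ≤ suc l + j × D (addr n 1 r z) ≡ suc e))))

-- Only the rows below `4 + κ + R` have to agree, and row 0 of class 0 is exempt because its first
-- cell takes the header `n`. This covers both writing the header and passing from memory to the
-- output list.
table-cong : ∀ {n κ R arcs D D′} → (∀ {c ρ y} → c < 4 → y < n → ρ < 4 + κ + R → c ≢ 0 ⊎ ρ ≢ 0 → D′ (addr n c ρ y) ≡ D (addr n c ρ y)) →
  Table n κ R arcs D → Table n κ R arcs D′
table-cong {n} {κ} {R} {arcs} {D} {D′} same t = record
  { balls = balls ; root = root ; sound = sound ; cnt-≤ = cnt-≤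
  ; counts = λ y<n → trans (same (s≤s z≤n) y<n (≤-trans (m≤m+n 2 2) row₀) (inj₂ λ ())) (counts y<n)
  ; keys = λ {y} y<n → stored-cong (sel vtx y balls) (λ k k< → same (m≤m+n 3 1) y<n (row k k<) (inj₁ λ ())) (keys y<n)
  ; dists = λ {y} y<n → stored-cong (sel vtx y balls) (λ k k< → same ≤-refl y<n (row k k<) (inj₁ λ ())) (dists y<n)
  ; near = λ y<n → subst (_≤ R) (sym (near≡ y<n)) (near y<n)
  ; matrix = λ r<n r≤R y<n e≡ → matrix r<n r≤R y<n (trans (sym (matrix≡ r≤R y<n)) e≡)
  ; complete = λ y<n p → complete′ y<n (complete y<n p) }
  where
  open Table t
  row₀ : 4 ≤ 4 + κ + R
  row₀ = ≤-trans (m≤m+n 4 κ) (m≤m+n (4 + κ) R)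
  row : ∀ k {y} → k < length (sel vtx y balls) → k < 4 + κ + R
  row k {y} k< = ≤-trans (<-≤-trans k< (cnt-≤ y)) (≤-trans (m≤n+m κ 4) (m≤m+n (4 + κ) R))
  near≡ : ∀ {y} → y < n → D′ (addr n 0 3 y) ≡ D (addr n 0 3 y)
  near≡ y<n = same (s≤s z≤n) y<n row₀ (inj₂ λ ())
  matrix≡ : ∀ {r y} → r ≤ R → y < n → D′ (addr n 1 r y) ≡ D (addr n 1 r y)
  matrix≡ r≤R y<n = same (m≤m+n 2 2) y<n (≤-trans (s≤s r≤R) (s≤s (m≤n+m R (3 + κ)))) (inj₁ λ ())
  complete′ : ∀ {y l x} → y < n →
    (∃[ k ] (k ≤ suc l × item y x k ∈ balls))
      ⊎ (∃[ r ] (D (addr n 0 3 y) ≡ suc r × r < R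
          × (∀ {z j} → z < n → Path arcs j y z → ∃[ e ] (e ≤ suc l + j × D (addr n 1 r z) ≡ suc e)))) →
    (∃[ k ] (k ≤ suc l × item y x k ∈ balls))
      ⊎ (∃[ r ] (D′ (addr n 0 3 y) ≡ suc r × r < R
          × (∀ {z j} → z < n → Path arcs j y z → ∃[ e ] (e ≤ suc l + j × D′ (addr n 1 r z) ≡ suc e))))
  complete′ y<n (inj₁ b) = inj₁ b
  complete′ y<n (inj₂ (r , e≡ , r<R , f)) = inj₂ (r , trans (near≡ y<n) e≡ , r<R , λ z<n p →
    let e , e≤ , d≡ = f z<n p in e , e≤ , trans (matrix≡ (<⇒≤ r<R) z<n) d≡)

start-up start-pivots₁ start-pivots₂ start-pivots push-pivots finish stage₁ stage₂ stage₃ preprocessing : Cmd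
start-up =
    3 ≔ var 2
  ⨟ 4 ≔ var 0
  ⨟ 5 ≔ lit 1
  ⨟ 20 ≔ var 1
start-pivots₁ =
    3 ≔ var 27
  ⨟ 4 ≔ lit 0
  ⨟ 5 ≔ lit 2
  ⨟ 6 ≔ var 2
start-pivots₂ =
    7 ≔ lit 0
  ⨟ 10 ≔ lit 0
  ⨟ 13 ≔ lit 0
  ⨟ 18 ≔ var 0
  ⨟ 20 ≔ var 27
start-pivots = start-pivots₁ ⨟ start-pivots₂
push-pivots =
  while (var 20)
    ( 20 ≔ bin sub (var 20) (lit 1)
    ⨟ 8 ≔ get 10 (var 20)
    ⨟ 9 ≔ var 20
    ⨟ push )
finish =
    put 2 (lit 0) (var 0)
  ⨟ 0 ≔ bin mul (bin mul (bin add (bin add (lit 4) (var 2)) (var 27)) (lit 4)) (var 0)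
stage₁ = start-up ⨟ read-edges ⨟ 21 ≔ var 7 ⨟ flood
stage₂ = choose-pivots ⨟ start-pivots
stage₃ = push-pivots ⨟ flood ⨟ finish
preprocessing = stage₁ ⨟ stage₂ ⨟ stage₃

module Preprocess (w n : ℕ) (n≥1 : 1 ≤ n) (room : 64 * (n * (n * n)) ≤ 2 ^ w)
  (es : List (ℕ × ℕ)) (es-< : All (λ e → proj₁ e < n × proj₂ e < n) es) (es-few : length es ≤ n * n)
  (κ : ℕ) (κ≥1 : 1 ≤ κ) (κ≤n : κ ≤ n) (r₀ : ℕ) (n<2^r₀ : n < 2 ^ r₀) where

  open Words w n n≥1 room
  open EdgesRun w n n≥1 room es es-< es-few κ κ≥1 κ≤n using (arcs; arcs-few; Reading; Read; read-run; Sources)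

  sy : ∀ {y z} → (y , z) ∈ arcs → (z , y) ∈ arcs
  sy = arcsOf-sym es

  lo : ∀ {y z} → (y , z) ∈ arcs → y < n
  lo = arcsOf-< es es-<

  id′ : ℕ → ℕ
  id′ x = x

  module F₀ = Flood n arcs sy lo n κ id′ (λ _ → ⊤)
  module F₁ (src : List Item) = Flood n arcs sy lo n κ id′ (λ x → item x x 0 ∈ src)
  module M₁ = FloodMem n n κ n 1 0 0 (λ _ → 0)
  module R₁ (src : List Item) = FloodRun w n n≥1 room arcs sy lo arcs-few n κ id′ (λ x → item x x 0 ∈ src)
    n 1 0 0 (λ _ → 0) ≤-refl κ≤n ≤-refl (s≤s (s≤s z≤n)) z≤n z≤n

  record After₁ (s : State) : Set where
    field
      {src Q pre} : List Item
      rep    : M₁.Rep s Q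
      loop   : F₁.Loop src Q [] Q
      ext    : Q ≡ pre ++ src
      diag   : All Diagonal src
      src-ok : F₀.Good src
      srcs   : ∀ {y z} → (y , z) ∈ arcs → item y y 0 ∈ src
      a₂     : vars s 2 ≡ κ
      a₂₁    : vars s 21 ≡ length src
      a₂₇    : vars s 27 ≡ 0
      adj    : AdjMem n arcs (arrays s 6) (arrays s 7)

  record Start (s : State) : Set where
    field
      s₀ : vars s 0 ≡ n
      s₁ : vars s 1 ≡ length es
      s₂ : vars s 2 ≡ κ
      zero-vars : ∀ x → 3 ≤ x → vars s x ≡ 0
      e₀ : arrays s 0 ≡ cells (map proj₁ es)
      e₁ : arrays s 1 ≡ cells (map proj₂ es)
      zero-cells : ∀ a i → 2 ≤ a → arrays s a i ≡ 0

  3≤ : ∀ k → 3 ≤ 3 + k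
  3≤ k = m≤m+n 3 k

  2≤ : ∀ k → 2 ≤ 2 + k
  2≤ k = m≤m+n 2 k

  reading₀ : ∀ {s} → Start s → ∀ {s′} → vars s′ 0 ≡ n → vars s′ 3 ≡ κ → vars s′ 4 ≡ n → vars s′ 5 ≡ 1 → vars s′ 20 ≡ length es →
    (∀ x → x ≡ 6 ⊎ x ≡ 7 ⊎ x ≡ 10 ⊎ x ≡ 18 → vars s′ x ≡ vars s x) → (∀ a → arrays s′ a ≡ arrays s a) → Reading (length es) s′
  reading₀ {s} S {s′} h₀ h₃ h₄ h₅ h₂₀ V A = record
    { pre = es ; done = [] ; Q = [] ; split = sym (++-identityʳ es) ; left = refl ; r₂₀ = h₂₀
    ; r₁₀ = trans (V 10 (inj₂ (inj₂ (inj₁ refl)))) (zero-vars 10 (3≤ 7))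
    ; a₀ = trans (A 0) e₀ ; a₁ = trans (A 1) e₁
    ; adj = λ y y<n → z 6 y (2≤ 4) , tt
    ; rep = record
        { queue-vtx = tt ; queue-key = tt ; queue-dst = tt
        ; counts = λ y<n → z 2 _ (2≤ 0) ; keys = λ _ → tt ; dists = λ _ → tt ; matrix = λ _ _ → z 2 _ (2≤ 0)
        ; frame₀ = λ _ _ → z 2 _ (2≤ 0) ; frame₁ = λ _ _ → z 2 _ (2≤ 0) ; frame₂ = λ _ _ → z 2 _ (2≤ 0) ; frame₃ = λ _ _ → z 2 _ (2≤ 0)
        ; key-count = λ _ → z 8 _ (2≤ 6) ; key-vtxs = λ _ → tt ; ic-fresh = λ _ → z 8 _ (2≤ 6) }
      , record { r-n = h₀ ; r-cap = h₃ ; r-xb = h₄ ; r-crow = h₅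
               ; r-lrow = trans (V 6 (inj₁ refl)) (zero-vars 6 (3≤ 3))
               ; r-tail = trans (V 7 (inj₂ (inj₁ refl))) (zero-vars 7 (3≤ 4))
               ; r-icb = trans (V 18 (inj₂ (inj₂ (inj₂ refl)))) (zero-vars 18 (3≤ 15)) }
    ; srcs = record { isGood = F₀.good-[] ; diag = [] ; srcs = λ () } }
    where
    open Start S
    z : ∀ a i → 2 ≤ a → arrays s′ a i ≡ 0
    z a i le = trans (cong-app (A a) i) (zero-cells a i le)

  -- The set of sources is known only after all edges are read. From then on every key can be
  -- required to be one of them, which the greedy choice needs in order to find all keys by scanning
  -- the sources.
  rekey : ∀ {src} → All Diagonal src → F₀.Good src → F₁.Good src src
  rekey {src} diag g = F₁.good (All.tabulate valid′) (F₀.mult≤1 g) (F₀.cnt≤cap g) (shallow′ src (F₀.shallow g))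
    where
    valid′ : ∀ {q} → q ∈ src → F₁.Valid src q
    valid′ {q} q∈ with All.lookup (F₀.all-valid g) q∈ | All.lookup diag q∈
    ... | F₀.valid a b c d e | refl , refl = F₁.valid a b c q∈ e
    shallow′ : ∀ Q → F₀.Shallow Q → F₁.Shallow src Q
    shallow′ []      _       = tt
    shallow′ (q ∷ Q) (d , s) = d , shallow′ Q s

  startup-run : ∀ {s} → Start s → Run w start-up s 7 (Reading (length es))
  startup-run S =
    asg⨟ (ev-var (Start.s₂ S)) (asg⨟ (ev-var (Start.s₀ S)) (asg⨟ ev-one (asg (ev-var (Start.s₁ S))
      (reading₀ S (Start.s₀ S) refl refl refl refl
        (λ { _ (inj₁ refl) → refl ; _ (inj₂ (inj₁ refl)) → refl ; _ (inj₂ (inj₂ (inj₁ refl))) → refl ; _ (inj₂ (inj₂ (inj₂ refl))) → refl })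
        (λ _ → refl)))))

  T₁ : ℕ
  T₁ = suc (7 + suc (suc (length es * 70) + (2 + suc (41 * (length arcs * κ)))))

  stage₁-run : ∀ {s} → Start s → Run w stage₁ s T₁ After₁
  stage₁-run {s} S =
    call⨟ (startup-run S) λ s₁ V₁ A₁ I →
    call⨟ (read-run I) λ s₂ V₂ A₂ (adj , src , rep , sources) →
    asg⨟ (ev-var (FloodMem.Regs.r-tail (proj₂ rep)))
    (framed (R₁.flood-run src {Q₀ = src} rep
        (F₁.loop-start src (rekey (Sources.diag sources) (Sources.isGood sources)) (All.map proj₂ (Sources.diag sources)))
        (trans (V₂ 13 refl) (trans (V₁ 13 refl) (Start.zero-vars S 13 (3≤ 10)))) adj)
      λ s₃ V₃ A₃ (Q , rep₃ , loop , pre , ext) → record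
        { rep = rep₃ ; loop = loop ; ext = ext
        ; diag = Sources.diag sources ; src-ok = Sources.isGood sources ; srcs = Sources.srcs sources
        ; a₂ = trans (V₃ 2 refl) (trans (V₂ 2 refl) (trans (V₁ 2 refl) (Start.s₂ S)))
        ; a₂₁ = V₃ 21 refl
        ; a₂₇ = trans (V₃ 27 refl) (trans (V₂ 27 refl) (trans (V₁ 27 refl) (Start.zero-vars S 27 (3≤ 24))))
        ; adj = subst₂ (AdjMem n arcs) (sym (A₃ 6 refl)) (sym (A₃ 7 refl)) adj })

  -- The second flood puts its distances into rows from 0 on, left free because the first one used
  -- rows from `n` on as scratch. Its own lists go to rows from `κ` on, above the lists to be kept.
  module M₂ (R : ℕ) (base : ℕ → ℕ) = FloodMem n R R 0 2 κ n base

  record After₂ (s : State) : Set where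
    field
      {src Q} : List Item
      {pv}   : List ℕ
      loop   : F₁.Loop src Q [] Q
      srcs   : ∀ {y z} → (y , z) ∈ arcs → item y y 0 ∈ Q
      counts : ∀ {y} → y < n → arrays s 2 (addr n 0 1 y) ≡ cnt Q y
      keys   : ∀ {y} → y < n → Stored (λ k → addr n 2 k y) key (arrays s 2) (sel vtx y Q)
      dists  : ∀ {y} → y < n → Stored (λ k → addr n 3 k y) dst (arrays s 2) (sel vtx y Q)
      hits   : ∀ {y r} → y < n → arrays s 2 (addr n 0 3 y) ≡ suc r → r < length pv × ∃[ k ] item y (atB pv r) k ∈ Q
      covered : ∀ {q} → q ∈ Q → cnt Q (vtx q) ≡ κ → ∃[ r ] arrays s 2 (addr n 0 3 (vtx q)) ≡ suc r
      pv-ok  : All (λ p → p < n × 1 ≤ deg arcs p) pv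
      few    : length pv ≤ n
      sparse : length pv * κ ≤ 2 * n * r₀
      pvs    : Stored (λ k → k) (λ p → p) (arrays s 10) pv
      rep    : M₂.Rep (length pv) (arrays s 2) s []
      b₂     : vars s 2 ≡ κ
      b₁₀    : vars s 10 ≡ 0
      b₁₃    : vars s 13 ≡ 0
      b₂₀    : vars s 20 ≡ length pv
      b₂₇    : vars s 27 ≡ length pv
      adj    : AdjMem n arcs (arrays s 6) (arrays s 7)

  T₂ : ℕ
  T₂ = suc (2 + suc (r₀ * suc (5 + 33 * (length arcs * κ))) + 17)

  module _ {s : State} (P : After₁ s) where
    open After₁ P

    good₁ : F₁.Good src Q
    good₁ = F₁.Loop.isGood loop

    valid₁ : ∀ {q} → q ∈ Q → F₁.Valid src q
    valid₁ q∈ = All.lookup (F₁.all-valid good₁) q∈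

    src-⊆ : ∀ {p} → p ∈ src → p ∈ Q
    src-⊆ p∈ = subst (_ ∈_) (sym ext) (∈-++⁺ʳ pre p∈)

    length-src : length src ≤ length Q
    length-src = ≤-trans (m≤n+m _ (length pre)) (≤-reflexive (trans (sym (length-++ pre)) (cong length (sym ext))))

    Q-few : length Q ≤ n * n
    Q-few = ≤-trans (F₁.length-≤ src good₁) (*-monoʳ-≤ n κ≤n)

    src-once : ∀ x → ∑ (λ p → [ key p ≣ x ]) src ≤ 1
    src-once x = ≤-trans (≤-reflexive (∑-cong src λ {p} p∈ → lemma p (proj₁ (All.lookup diag p∈)))) (F₀.mult≤1 src-ok x x)
      where
      lemma : ∀ p → key p ≡ vtx p → [ key p ≣ x ] ≡ [ vtx p ≣ x ] * [ key p ≣ x ]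
      lemma (item v .v d) refl with v ≡ᵇ x
      ... | true  = refl
      ... | false = refl

    module G = GreedyRun w n n≥1 room κ Q src
      (λ q∈ → F₁.Valid.vtx<n (valid₁ q∈)) (λ q∈ → F₁.Valid.key<X (valid₁ q∈)) (F₁.mult≤1 good₁)
      (λ {q} q∈ → item (key q) (key q) 0 , F₁.Valid.isKey (valid₁ q∈) , refl)
      src-once src-⊆ Q-few (≤-trans length-src Q-few)
      (arrays s 2) (arrays s 4) (arrays s 8) (arrays s 9)
      (M₁.Mem.counts (proj₁ rep)) (λ y<n → M₁.Mem.frame₀ (proj₁ rep) {3} y<n λ ())
      (M₁.Mem.key-count (proj₁ rep)) (M₁.Mem.key-vtxs (proj₁ rep))
      (stored-drop {at = λ k → k} {key} {arrays s 4} pre (subst (Stored (λ k → k) key (arrays s 4)) ext (M₁.Mem.queue-key (proj₁ rep))))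

    gr₁ : G.GR s
    gr₁ = record { g₀ = M₁.Regs.r-n (proj₂ rep) ; g₂ = a₂ ; g₂₁ = a₂₁ ; b₄ = refl ; b₈ = refl ; b₉ = refl ; other = λ _ → refl }

    length-Q : length Q ≤ length arcs * κ
    length-Q = ≤-trans (≤-reflexive (sym (trans (∑-const 1 Q) (*-identityʳ _)))) (≤-trans (F₁.cost-≤ src 1 0 good₁) (≤-reflexive (*-identityˡ _)))

    -- 33 = 21 + 12: each source costs 21 steps and each item 12, and both sources and items number
    -- at most `length arcs * κ`.
    phase-cost-≤ : G.phase-cost ≤ 5 + 33 * (length arcs * κ)
    phase-cost-≤ = +-monoʳ-≤ 5 (begin
      ∑ (λ p → 21 + 12 * length (sel key (key p) Q)) src
        ≡⟨ trans (∑-+ (λ _ → 21) (λ p → 12 * length (sel key (key p) Q)) src) (cong₂ _+_ (∑-const 21 src) (∑-* 12 (λ p → length (sel key (key p) Q)) src)) ⟩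
      length src * 21 + 12 * ∑ (λ p → length (sel key (key p) Q)) src
        ≤⟨ +-mono-≤ (≤-trans (*-monoˡ-≤ 21 (≤-trans length-src length-Q)) (≤-reflexive (*-comm (length arcs * κ) 21))) (*-monoʳ-≤ 12 (≤-trans scan length-Q)) ⟩
      21 * (length arcs * κ) + 12 * (length arcs * κ)
        ≡⟨ *-distribʳ-+ (length arcs * κ) 21 12 ⟨
      33 * (length arcs * κ) ∎)
      where
      open ≤-Reasoning
      scan : ∑ (λ p → length (sel key (key p) Q)) src ≤ length Q
      scan = Greedy.scan-cost n κ Q src (λ q∈ → F₁.Valid.vtx<n (valid₁ q∈)) (λ q∈ → F₁.Valid.key<X (valid₁ q∈)) (F₁.mult≤1 good₁)
        (λ {q} q∈ → item (key q) (key q) 0 , F₁.Valid.isKey (valid₁ q∈) , refl) src-once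

    stage₂-run : Run w stage₂ s T₂ After₂
    stage₂-run =
      call⨟ (weaken (s≤s (s≤s (s≤s (*-monoʳ-≤ r₀ (s≤s phase-cost-≤))))) (G.choose-run r₀ n<2^r₀ gr₁ (After₁.a₂₇ P) (λ _ → refl)))
      λ s₁ V₁ A₁ C →
      let open G.Chosen C in
      call⨟ {P = λ s₂ → vars s₂ 3 ≡ length pv × vars s₂ 4 ≡ 0 × vars s₂ 5 ≡ 2 × vars s₂ 6 ≡ κ}
        (asg⨟ (ev-var c₂₇) (asg⨟ ev-zero (asg⨟ (ev-const 2 (m≤m+n 3 61)) (asg (ev-var (G.GR.g₂ gr)) (refl , refl , refl , refl)))))
      λ s₂ V₂ A₂ (h₃ , h₄ , h₅ , h₆) →
      framed {P = λ s₃ → vars s₃ 7 ≡ 0 × vars s₃ 10 ≡ 0 × vars s₃ 13 ≡ 0 × vars s₃ 18 ≡ n × vars s₃ 20 ≡ length pv}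
        (asg⨟ ev-zero (asg⨟ ev-zero (asg⨟ ev-zero (asg⨟ (ev-var (trans (V₂ 0 refl) (G.GR.g₀ gr)))
          (asg (ev-var (trans (V₂ 27 refl) c₂₇)) (refl , refl , refl , refl , refl))))))
      λ s₃ V₃ A₃ (h₇ , h₁₀ , h₁₃ , h₁₈ , h₂₀) → build s₁ V₁ A₁ C s₃ (λ a → trans (A₃ a refl) (A₂ a refl))
        (trans (V₃ 0 refl) (trans (V₂ 0 refl) (G.GR.g₀ gr))) (trans (V₃ 2 refl) (trans (V₂ 2 refl) (G.GR.g₂ gr)))
        (trans (V₃ 3 refl) h₃) (trans (V₃ 4 refl) h₄) (trans (V₃ 5 refl) h₅) (trans (V₃ 6 refl) h₆) h₇ h₁₀ h₁₃ h₁₈ h₂₀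
        (trans (V₃ 27 refl) (trans (V₂ 27 refl) c₂₇))
      where
      mem : M₁.Mem (arrays s 2) (arrays s 3) (arrays s 4) (arrays s 5) (arrays s 8) (arrays s 9) Q
      mem = proj₁ (After₁.rep P)
      build : ∀ s₁ → FrameV choose-pivots s s₁ → FrameA choose-pivots s s₁ → (C : G.Chosen r₀ s₁) →
        ∀ s₃ → (∀ a → arrays s₃ a ≡ arrays s₁ a) → vars s₃ 0 ≡ n → vars s₃ 2 ≡ κ →
        vars s₃ 3 ≡ length (G.Chosen.pv C) → vars s₃ 4 ≡ 0 → vars s₃ 5 ≡ 2 → vars s₃ 6 ≡ κ → vars s₃ 7 ≡ 0 → vars s₃ 10 ≡ 0 →
        vars s₃ 13 ≡ 0 → vars s₃ 18 ≡ n → vars s₃ 20 ≡ length (G.Chosen.pv C) → vars s₃ 27 ≡ length (G.Chosen.pv C) → After₂ s₃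
      build s₁ V₁ A₁ C s₃ A h₀ h₂ h₃ h₄ h₅ h₆ h₇ h₁₀ h₁₃ h₁₈ h₂₀ h₂₇ = record
        { loop = After₁.loop P ; srcs = λ e∈ → src-⊆ (After₁.srcs P e∈)
        ; counts = λ y<n → trans (same (λ z<n → addr-≢ʳ n z<n y<n λ ())) (M₁.Mem.counts mem y<n)
        ; keys = λ y<n → stored-cong (sel vtx _ Q) (λ k k< → same (λ z<n → addr-≢ᶜ n (s≤s z≤n) (s≤s (s≤s (s≤s z≤n))) z<n y<n λ ())) (M₁.Mem.keys mem y<n)
        ; dists = λ y<n → stored-cong (sel vtx _ Q) (λ k k< → same (λ z<n → addr-≢ᶜ n (s≤s z≤n) ≤-refl z<n y<n λ ())) (M₁.Mem.dists mem y<n)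
        ; hits = λ y<n e≡ → G.Chosen.hits C y<n (trans (sym (cong-app (A 2) _)) e≡)
        ; covered = λ q∈ full → let r , e≡ = G.Chosen.covered C q∈ full in r , trans (cong-app (A 2) _) e≡
        ; pv-ok = All.map pivot-ok (G.Chosen.inner C)
        ; few = G.Chosen.few C ; sparse = G.Chosen.sparse C
        ; pvs = subst (λ f → Stored _ (λ p → p) f (G.Chosen.pv C)) (sym (A 10)) (G.Chosen.pvs C)
        ; rep = record
            { queue-vtx = tt ; queue-key = tt ; queue-dst = tt
            ; counts = λ y<n → trans (same (λ z<n → addr-≢ʳ n z<n y<n λ ())) (M₁.Mem.frame₀ mem {2} y<n λ ())
            ; keys = λ _ → tt ; dists = λ _ → tt
            ; matrix = λ x<n y<n → trans (same (λ z<n → addr-≢ᶜ n (s≤s z≤n) (s≤s (s≤s z≤n)) z<n y<n λ ())) (M₁.Mem.frame₁ mem y<n x<n)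
            ; frame₀ = λ _ _ → refl ; frame₁ = λ _ _ → refl ; frame₂ = λ _ _ → refl ; frame₃ = λ _ _ → refl
            ; key-count = λ {x} x<n → fresh (m≤m+n n x) ; key-vtxs = λ _ → tt
            ; ic-fresh = λ le → fresh (≤-trans (m≤m+n n n) le) }
          , record { r-n = h₀ ; r-cap = h₃ ; r-xb = h₄ ; r-crow = h₅ ; r-lrow = h₆ ; r-tail = h₇ ; r-icb = h₁₈ }
        ; b₂ = h₂ ; b₁₀ = h₁₀ ; b₁₃ = h₁₃ ; b₂₀ = h₂₀ ; b₂₇ = h₂₇
        ; adj = subst₂ (AdjMem n arcs) (sym (trans (A 6) (A₁ 6 refl))) (sym (trans (A 7) (A₁ 7 refl))) (After₁.adj P) }
        where
        same : ∀ {i} → (∀ {y} → y < n → addr n 0 3 y ≢ i) → arrays s₃ 2 i ≡ arrays s 2 i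
        same {i} ne = trans (cong-app (A 2) i) (G.GR.other (G.Chosen.gr C) ne)
        fresh : ∀ {i} → n ≤ i → arrays s₃ 8 i ≡ 0
        fresh {i} le = trans (cong-app (A 8) i) (trans (cong-app (A₁ 8 refl) i) (M₁.Mem.ic-fresh mem le))
        pivot-ok : ∀ {p} → ∃[ q ] (q ∈ src × key q ≡ p) → p < n × 1 ≤ deg arcs p
        pivot-ok (q , q∈ , refl) with All.lookup (F₀.all-valid src-ok) q∈ | All.lookup diag q∈
        ... | F₀.valid a b c d e | refl , refl = b , c

  -- The number of pivots is read off a state, but the time bound must be fixed in advance; this is
  -- the largest number that `sparse` allows.
  Rmax : ℕ
  Rmax = _/_ (2 * n * r₀) κ {{>-nonZero κ≥1}}

  record Built (s : State) : Set where
    field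
      {R}    : ℕ
      R≤n    : R ≤ n
      sparse : R * κ ≤ 2 * n * r₀
      size₀  : vars s 0 ≡ (4 + κ + R) * 4 * n
      header : arrays s 2 0 ≡ n
      table  : Table n κ R arcs (arrays s 2)

  module _ {s : State} (P : After₂ s) where
    open After₂ P

    R : ℕ
    R = length pv

    module F₂ = Flood n arcs sy lo R R (atB pv) (λ _ → ⊤)
    module R₂ = FloodRun w n n≥1 room arcs sy lo arcs-few R R (atB pv) (λ _ → ⊤) 0 2 κ n (arrays s 2)
      few few z≤n (s≤s (s≤s (s≤s z≤n))) κ≤n ≤-refl

    record Seeding (rest : List ℕ) (s′ : State) : Set where
      field
        {done} : List ℕ
        {Q₂}   : List Item
        rep₂   : M₂.Rep R (arrays s 2) s′ Q₂
        good₂  : F₂.Good Q₂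
        zeros  : All (λ q → dst q ≡ 0) Q₂
        seeded : ∀ {r} → r < R → length rest ≤ r → item (atB pv r) r 0 ∈ Q₂
        d₂₀    : vars s′ 20 ≡ length rest
        d₁₀    : vars s′ 10 ≡ 0
        rests  : Stored (λ k → k) (λ p → p) (arrays s′ 10) rest
        split  : pv ≡ done ++ rest

    atB-split : ∀ done {p rest} → atB (done ++ p ∷ rest) (length rest) ≡ p
    atB-split []         {p} {rest} = atB-last p rest
    atB-split (d ∷ done) {p} {rest} = trans (atB-∷ d (done ++ p ∷ rest)
      (≤-trans (m≤n+m (suc (length rest)) (length done)) (≤-reflexive (sym (length-++ done))))) (atB-split done)

    seed-step : ∀ {p rest s′} → Seeding (p ∷ rest) s′ →
      Run w ( 20 ≔ bin sub (var 20) (lit 1) ⨟ 8 ≔ get 10 (var 20) ⨟ 9 ≔ var 20 ⨟ push ) s′ 30 (Seeding rest)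
    seed-step {p} {rest} {s′} I =
      asg⨟ (ev-pred (ev-var d₂₀)) (asg⨟ (ev-get (ev-var refl) (proj₁ rests)) (asg⨟ (ev-var refl)
      (framed (R₂.push-run {Q = Q₂} rep₂ good₂ v z≤n refl refl d₁₀) λ s″ V A (Q₂′ , pu , rep₂′) → record
        { done = done ∷ʳ p ; rep₂ = rep₂′ ; good₂ = F₂.good-push good₂ v z≤n pu
        ; zeros = pushed-All pu refl zeros
        ; seeded = λ {r} r<R le → seeded′ pu r<R (m≤n⇒m<n∨m≡n le)
        ; d₂₀ = V 20 refl ; d₁₀ = trans (V 10 refl) d₁₀
        ; rests = subst (λ f → Stored _ (λ p → p) f rest) (sym (A 10 refl)) (proj₂ rests)
        ; split = trans split (sym (++-assoc done (p ∷ []) rest)) })))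
      where
      open Seeding I
      root≡ : atB pv (length rest) ≡ p
      root≡ = trans (cong (λ l → atB l (length rest)) split) (atB-split done)
      rest<R : length rest < R
      rest<R = ≤-trans (m≤n+m (suc (length rest)) (length done)) (≤-reflexive (sym (trans (cong length split) (length-++ done))))
      p-ok : p < n × 1 ≤ deg arcs p
      p-ok = All.lookup pv-ok (subst (p ∈_) (sym split) (∈-++⁺ʳ done (here refl)))
      v : F₂.Valid (item p (length rest) 0)
      v = F₂.valid (proj₁ p-ok) rest<R (proj₂ p-ok) tt (subst (Path arcs 0 p) (sym root≡) nil)
      seeded′ : ∀ {Q₂′} → F₂.Pushed Q₂ (item p (length rest) 0) Q₂′ → ∀ {r} → r < R → length rest < r ⊎ length rest ≡ r →
        item (atB pv r) r 0 ∈ Q₂′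
      seeded′ pu r<R (inj₁ rest<r) = pushed-⊆ pu (seeded r<R rest<r)
      seeded′ {Q₂′} pu r<R (inj₂ refl) = subst (λ z → item z (length rest) 0 ∈ Q₂′) (sym root≡)
        (source-pushed zeros (F₂.room-for-fresh good₂ ≤-refl rest<R) pu)

    good₁′ : F₁.Good src Q
    good₁′ = F₁.Loop.isGood loop

    build-table : ∀ {D QV QK QD IC IV Q₂} → M₂.Mem R (arrays s 2) D QV QK QD IC IV Q₂ → F₂.Loop Q₂ [] Q₂ →
      (∀ {r} → r < R → item (atB pv r) r 0 ∈ Q₂) → Table n κ R arcs D
    build-table {D} {Q₂ = Q₂} mem loop₂ seeds = record
      { balls = Q ; root = atB pv
      ; sound = λ q∈ → let v = All.lookup (F₁.all-valid good₁′) q∈ in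
          F₁.Valid.key<X v , F₁.Valid.walk v , ≤-trans (F₁.shallow-∈ src (F₁.shallow good₁′) q∈) (≤-trans (F₁.length-≤ src good₁′) (*-monoʳ-≤ n κ≤n))
      ; cnt-≤ = F₁.cnt≤cap good₁′
      ; counts = λ y<n → trans (M₂.Mem.frame₀ mem {1} y<n λ ()) (counts y<n)
      ; keys = λ {y} y<n → stored-cong (sel vtx y Q) (λ k k< → M₂.Mem.frame₂ mem y<n (<-≤-trans k< (F₁.cnt≤cap good₁′ y))) (keys y<n)
      ; dists = λ {y} y<n → stored-cong (sel vtx y Q) (λ k k< → M₂.Mem.frame₃ mem y<n (<-≤-trans k< (F₁.cnt≤cap good₁′ y))) (dists y<n)
      ; near = near′
      ; matrix = λ {r} {y} {e} r<n _ y<n e≡ →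
          let q∈ = mval-suc Q₂ y r (trans (sym (M₂.Mem.matrix mem r<n y<n)) e≡)
              v = All.lookup (F₂.all-valid g₂) q∈
          in F₂.Valid.walk v , ≤-trans (F₂.shallow-∈ (F₂.shallow g₂) q∈) (≤-trans (F₂.length-≤ g₂) (*-monoʳ-≤ n few))
      ; complete = complete′ }
      where
      g₂ : F₂.Good Q₂
      g₂ = F₂.Loop.isGood loop₂
      near≡ : ∀ {y} → y < n → D (addr n 0 3 y) ≡ arrays s 2 (addr n 0 3 y)
      near≡ y<n = M₂.Mem.frame₀ mem {3} y<n λ ()
      near′ : ∀ {y} → y < n → D (addr n 0 3 y) ≤ R
      near′ {y} y<n with arrays s 2 (addr n 0 3 y) in e≡
      ... | zero  = subst (_≤ R) (sym (trans (near≡ y<n) e≡)) z≤n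
      ... | suc r = subst (_≤ R) (sym (trans (near≡ y<n) e≡)) (proj₁ (hits y<n e≡))
      row : ∀ {r z l} → r < R → z < n → Path arcs l z (atB pv r) → ∃[ e ] (e ≤ l × D (addr n 1 r z) ≡ suc e)
      row {r} {z} {l} r<R z<n p = found (F₂.complete loop₂ (seeds r<R) p)
        where
        found : F₂.Reached Q₂ z r l → ∃[ e ] (e ≤ l × D (addr n 1 r z) ≡ suc e)
        found (inj₁ (e , e≤ , q∈)) = e , e≤ , trans (M₂.Mem.matrix mem (<-≤-trans r<R few) z<n) (mval-∈ Q₂ z r (F₂.mult≤1 g₂ z r) q∈)
        found (inj₂ full) = found (inj₁ (F₂.full-all g₂ ≤-refl full r<R))
      nonempty : ∀ {y} → 1 ≤ cnt Q y → ∃[ q ] (q ∈ Q × vtx q ≡ y)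
      nonempty {y} pos with sel vtx y Q in e≡
      ... | q ∷ _ = q , ∈-sel⁻ vtx Q (subst (q ∈_) (sym e≡) (here refl))
      first : ∀ {l u v} → Path arcs (suc l) u v → ∃[ z ] (u , z) ∈ arcs
      first (cons e _) = _ , e
      Goal : ℕ → ℕ → ℕ → Set
      Goal y l x = (∃[ k ] (k ≤ suc l × item y x k ∈ Q))
        ⊎ (∃[ r ] (D (addr n 0 3 y) ≡ suc r × r < R
            × (∀ {z j} → z < n → Path arcs j y z → ∃[ e ] (e ≤ suc l + j × D (addr n 1 r z) ≡ suc e))))
      -- The list of `y` has `κ` items, so the greedy choice gave `y` a pivot from this very list,
      -- and by `full-dst` it lies within `suc l`. A path from `y` to `z`, reversed and continued to
      -- the pivot, bounds what the second flood stores for `z`.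
      pivot : ∀ {y l x} → y < n → F₁.Full src Q y (suc l) → ∃[ q ] (q ∈ Q × vtx q ≡ y) → Goal y l x
      pivot {y} {l} y<n full (q , q∈ , refl) with covered q∈ (≤-antisym (F₁.cnt≤cap good₁′ y) (≤-trans full (cntLe-≤cnt Q y (suc l))))
      ... | r , e≡ with hits y<n e≡
      ...   | r<R , k , p∈ = inj₂ (r , trans (near≡ y<n) e≡ , r<R , λ {z} {j} z<n path →
        let e , e≤ , d≡ = row r<R z<n (Path-++ (Path-reverse sy path) (F₁.Valid.walk (All.lookup (F₁.all-valid good₁′) p∈)))
        in e , ≤-trans e≤ (≤-trans (+-monoʳ-≤ j (F₁.full-dst src good₁′ full p∈ refl)) (≤-reflexive (+-comm j (suc l)))) , d≡)
      complete′ : ∀ {y l x} → y < n → Path arcs (suc l) y x → Goal y l x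
      -- The last arc of the nonempty path shows that `x` is not isolated, so it was a source of the
      -- first flood.
      complete′ {y} {l} {x} y<n path with F₁.complete src loop (srcs (proj₂ (first (Path-reverse sy path)))) path
      ... | inj₁ r = inj₁ r
      ... | inj₂ full = pivot y<n full (nonempty (≤-trans κ≥1 (≤-trans full (cntLe-≤cnt Q y (suc l)))))

    R≤Rmax : R ≤ Rmax
    R≤Rmax = subst (_≤ Rmax) (m*n/n≡m R κ {{>-nonZero κ≥1}}) (/-monoˡ-≤ κ {{>-nonZero κ≥1}} sparse)

    seeds-run : Run w push-pivots s (suc (Rmax * 31)) (Seeding [])
    seeds-run = weaken (s≤s (≤-trans (≤-reflexive (∑-const 31 pv)) (*-monoˡ-≤ 31 R≤Rmax)))
      (while-list Seeding (λ _ → 30) (λ s′ I → ev-var (Seeding.d₂₀ I) , I)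
        (λ p rest s′ I → length rest , ev-var (Seeding.d₂₀ I) , seed-step I) pv
        (record { done = [] ; rep₂ = rep ; good₂ = F₂.good-[] ; zeros = [] ; seeded = λ r<R le → contradiction le (<⇒≱ r<R)
                ; d₂₀ = b₂₀ ; d₁₀ = b₁₀ ; rests = pvs ; split = refl }))

    rows-≤ : 4 + κ + R ≤ 6 * n
    rows-≤ = ≤-trans (+-mono-≤ (+-mono-≤ (m≤m*n 4 n {{>-nonZero n≥1}}) κ≤n) few)
      (≤-reflexive (trans (+-assoc (4 * n) n n) (trans (cong (λ k → 4 * n + (n + k)) (sym (+-identityʳ n))) (sym (*-distribʳ-+ n 4 2)))))

    rows-fit : ∀ {a} → a ≤ 4 + κ + R → a ≤ 6 * n³
    rows-fit a≤ = ≤-trans a≤ (≤-trans rows-≤ (*-monoʳ-≤ 6 n≤n³))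

    rows*4-≤ : (4 + κ + R) * 4 ≤ 24 * n
    rows*4-≤ = ≤-trans (*-monoˡ-≤ 4 rows-≤) (≤-reflexive (trans (*-comm (6 * n) 4) (sym (*-assoc 4 6 n))))

    addr-≢0 : ∀ {c ρ y} → c < 4 → y < n → c ≢ 0 ⊎ ρ ≢ 0 → 0 ≢ addr n c ρ y
    addr-≢0 {c} {ρ} {y} c<4 y<n (inj₁ c≢0) e≡ = addr-≢ᶜ n {0} {c} {0} {ρ} {0} {y} (s≤s z≤n) c<4 n≥1 y<n (c≢0 ∘ sym) (trans (addr-header n) e≡)
    addr-≢0 {zero} {ρ} {y} c<4 y<n (inj₂ ρ≢0) e≡ = addr-≢ʳ n {0} {0} {ρ} {0} {y} n≥1 y<n (ρ≢0 ∘ sym) (trans (addr-header n) e≡)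
    addr-≢0 {suc c} {ρ} {y} c<4 y<n (inj₂ ρ≢0) e≡ = addr-≢ᶜ n {0} {suc c} {0} {ρ} {0} {y} (s≤s z≤n) c<4 n≥1 y<n (λ ()) (trans (addr-header n) e≡)

    T₃ : ℕ
    T₃ = suc (suc (Rmax * 31) + suc (suc (41 * (length arcs * Rmax)) + 3))

    stage₃-run : Run w stage₃ s T₃ Built
    stage₃-run =
      call⨟ seeds-run λ s₁ V₁ A₁ I →
      call⨟ (weaken (s≤s (*-monoʳ-≤ 41 (*-monoʳ-≤ (length arcs) R≤Rmax)))
          (R₂.flood-run {Q₀ = Seeding.Q₂ I} (Seeding.rep₂ I) (F₂.loop-start (Seeding.good₂ I) (Seeding.zeros I)) (trans (V₁ 13 refl) b₁₃)
          (subst₂ (AdjMem n arcs) (sym (A₁ 6 refl)) (sym (A₁ 7 refl)) adj)))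
      λ s₂ V₂ A₂ (Q₃ , rep₃ , loop₃ , pre₃ , ext₃) →
      put⨟ (ev-zero) (ev-var (FloodMem.Regs.r-n (proj₂ rep₃)))
      (asg (ev-mul (ev-mul (ev-add (ev-add (ev-const 4 (m≤m+n 5 59)) (ev-var (trans (V₂ 2 refl) (trans (V₁ 2 refl) b₂)))
               (fit 6 (rows-fit (m≤m+n (4 + κ) R)) (m≤m+n 7 57))) (ev-var (trans (V₂ 27 refl) (trans (V₁ 27 refl) b₂₇))) (fit 6 (rows-fit ≤-refl) (m≤m+n 7 57)))
             (ev-const 4 (m≤m+n 5 59)) (fit 24 (≤-trans rows*4-≤ (*-monoʳ-≤ 24 n≤n³)) (m≤m+n 25 39)))
           (ev-var (FloodMem.Regs.r-n (proj₂ rep₃)))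
           (fit 24 (≤-trans (*-monoˡ-≤ n rows*4-≤) (≤-trans (≤-reflexive (*-assoc 24 n n)) (*-monoʳ-≤ 24 n²≤n³))) (m≤m+n 25 39)))
        (record { R≤n = few ; sparse = sparse ; size₀ = refl ; header = update-same (arrays s₂ 2) 0 n
                ; table = table-cong (λ c<4 y<n _ ne → update-other (arrays s₂ 2) n (addr-≢0 c<4 y<n ne))
                    (build-table (proj₁ rep₃) loop₃ (λ r<R → subst (_ ∈_) (sym ext₃) (∈-++⁺ʳ pre₃ (Seeding.seeded I r<R z≤n)))) }))

  pre-time : ℕ
  pre-time = suc (T₁ + suc (T₂ + suc (suc (Rmax * 31) + suc (suc (41 * (length arcs * Rmax)) + 3))))

  preprocessing-run : ∀ {s} → Start s → Run w preprocessing s pre-time Built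
  preprocessing-run S =
    call⨟ (stage₁-run S) λ s₁ _ _ P₁ →
    call⨟ (stage₂-run P₁) λ s₂ _ _ P₂ →
    stage₃-run P₂

-- Queries

-- Variables: 0 and 1 the query, 2 n, 3 tail, 4 head, 5 best estimate plus one,
-- 6-9 the probe visited, 10-12 temporaries, 15 items left.  Arrays 1-4 hold the
-- probes, array 5 the shortest walks found from the two query vertices, plus one.
sideE : Expr → Expr
sideE e = bin add (bin mul e (var 2)) (var 7)

launch load-probe relax replace-best improve meet detour expand visit explore : Cmd
load-probe =
    6 ≔ get 1 (var 4)
  ⨟ 7 ≔ get 2 (var 4)
  ⨟ 8 ≔ get 3 (var 4)
  ⨟ 9 ≔ get 4 (var 4)
relax =
  ifnz (bin add (bin eq (get 5 (sideE (var 6))) (lit 0)) (bin lt (bin add (var 8) (lit 1)) (get 5 (sideE (var 6)))))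
    (put 5 (sideE (var 6)) (bin add (var 8) (lit 1)))
    skip
replace-best =
  ifnz (bin mul (bin mul (bin lt (lit 0) (var 11)) (bin lt (lit 0) (var 12)))
                (bin add (bin eq (var 5) (lit 0)) (bin lt (var 10) (var 5))))
    (5 ≔ var 10)
    skip
improve =
    10 ≔ bin sub (bin add (var 11) (var 12)) (lit 1)
  ⨟ replace-best
meet =
    11 ≔ get 5 (sideE (lit 0))
  ⨟ 12 ≔ get 5 (sideE (lit 1))
  ⨟ improve
detour =
    10 ≔ bin sub (get 0 (addrE 2 0 (lit 3) (var 7))) (lit 1)
  ⨟ 11 ≔ get 0 (addrE 2 1 (var 10) (var 0))
  ⨟ 12 ≔ get 0 (addrE 2 1 (var 10) (var 1))
  ⨟ improve
expand =
  while (var 15)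
    ( 15 ≔ bin sub (var 15) (lit 1)
    ⨟ put 1 (var 3) (var 6)
    ⨟ put 2 (var 3) (get 0 (addrE 2 2 (var 15) (var 7)))
    ⨟ put 3 (var 3) (bin add (var 8) (get 0 (addrE 2 3 (var 15) (var 7))))
    ⨟ put 4 (var 3) (bin sub (var 9) (lit 1))
    ⨟ 3 ≔ bin add (var 3) (lit 1) )
visit =
    load-probe
  ⨟ relax
  ⨟ meet
  ⨟ detour
  ⨟ 15 ≔ bin mul (get 0 (addrE 2 0 (lit 1) (var 7))) (bin lt (lit 0) (var 9))
  ⨟ expand
  ⨟ 4 ≔ bin add (var 4) (lit 1)
explore = while (bin lt (var 4) (var 3)) visit
launch =
    2 ≔ get 0 (lit 0)
  ⨟ put 1 (lit 1) (lit 1)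
  ⨟ put 2 (lit 0) (var 0)
  ⨟ put 2 (lit 1) (var 1)
  ⨟ 3 ≔ lit 2

launch-levels querying : ℕ → Cmd
launch-levels t = put 4 (lit 0) (lit t) ⨟ put 4 (lit 1) (lit t)
querying t = launch ⨟ launch-levels t ⨟ explore ⨟ 0 ≔ var 5

record Probe : Set where
  constructor probe
  field
    side at len lvl : ℕ

open Probe public

AtMost : ℕ → ℕ → Set
AtMost v k = ∃[ e ] (e ≤ k × v ≡ suc e)

-- The order on estimates encoded plus one, with 0 for infinity. Cells only move down in it, so
-- every bound once reached survives the rest of the search.
Improves : ℕ → ℕ → Set
Improves old new = ∀ k → old ≡ suc k → AtMost new k

improves-refl : ∀ {v} → Improves v v
improves-refl k e≡ = k , ≤-refl , e≡

atMost-improves : ∀ {v v′ k} → AtMost v k → Improves v v′ → AtMost v′ k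
atMost-improves (e , e≤ , v≡) imp with imp e v≡
... | e′ , e′≤ , v′≡ = e′ , ≤-trans e′≤ e≤ , v′≡

atMost-mono : ∀ {v k l} → k ≤ l → AtMost v k → AtMost v l
atMost-mono k≤l (e , e≤ , v≡) = e , ≤-trans e≤ k≤l , v≡

-- The test of relax and improve, on the encoding where 0 stands for infinity.
worse : ℕ → ℕ → ℕ
worse old e = [ old ≣ 0 ] + bit (suc e <ᵇ old)

worse-≤2 : ∀ old e → worse old e ≤ 2
worse-≤2 old e = +-mono-≤ ([≣]-≤1 old 0) (bit-≤1 (suc e <ᵇ old))

worse-keep : ∀ old e → worse old e ≡ 0 → AtMost old e
worse-keep (suc k) e w≡ = k , s≤s⁻¹ (≮⇒≥ λ l< → contradiction (trans (sym (bit-<ᵇ l<)) w≡) λ ()) , refl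

worse-replace : ∀ old e {j} → worse old e ≡ suc j → Improves old (suc e)
worse-replace (suc k) e w≡ .k refl = e , bound , refl
  where
  bound : e ≤ k
  bound with suc e <ᵇ suc k in b≡
  ... | true = ≤-trans (n≤1+n e) (s≤s⁻¹ (<ᵇ⇒< (suc e) (suc k) (subst T (sym b≡) tt)))

module Query (w n : ℕ) (n≥1 : 1 ≤ n) (room : 64 * (n * (n * n)) ≤ 2 ^ w)
  (κ : ℕ) (κ≥1 : 1 ≤ κ) (κ≤n : κ ≤ n) (R : ℕ) (R≤n : R ≤ n)
  (arcs : List (ℕ × ℕ)) (sy : ∀ {y z} → (y , z) ∈ arcs → (z , y) ∈ arcs)
  (D : ℕ → ℕ) (table : Table n κ R arcs D)
  (u v : ℕ) (u<n : u < n) (v<n : v < n) (t : ℕ)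
  (room-len : 8 * (suc t * (n * n)) ≤ 2 ^ w) (room-count : 2 * (3 * κ) ^ t < 2 ^ w) where

  open Words w n n≥1 room
  open Table table

  end : ℕ → ℕ
  end zero    = u
  end (suc _) = v

  nearest : ℕ → ℕ
  nearest x = D (addr n 0 3 x) ∸ 1

  nearest-≤R : ∀ {x} → x < n → nearest x ≤ R
  nearest-≤R x<n = ≤-trans (m∸n≤m _ 1) (near x<n)

  nearest-<n : ∀ {x} → x < n → nearest x < n
  nearest-<n {x} x<n with D (addr n 0 3 x) | near x<n
  ... | zero  | _  = n≥1
  ... | suc r | r≤ = ≤-trans r≤ R≤n

  longest : ℕ
  longest = t * (n * n)

  n²≥1 : 1 ≤ n * n
  n²≥1 = ≤-trans n≥1 n≤n²

  fit-len : ∀ {a} → a ≤ 7 * (suc t * (n * n)) → a < 2 ^ w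
  fit-len a≤ = <-≤-trans (≤-<-trans a≤ (*-monoˡ-< (suc t * (n * n)) {{>-nonZero (≤-trans n²≥1 (m≤m+n (n * n) longest))}} {7} {8} ≤-refl)) room-len

  suc-longest : suc longest ≤ suc t * (n * n)
  suc-longest = +-monoˡ-≤ longest n²≥1

  -- `short` reserves `n * n`, the largest stored distance, for each level still to come, so lengths
  -- stay within a word.
  record Okay (q : Probe) : Set where
    field
      side≤1 : side q ≤ 1
      at<n   : at q < n
      walk   : Path arcs (len q) (end (side q)) (at q)
      short  : len q + lvl q * (n * n) ≤ longest

  open Okay public

  WalksOf : (ℕ → ℕ) → Set
  WalksOf T = ∀ {sd x e} → sd ≤ 1 → x < n → T (sd * n + x) ≡ suc e → Path arcs e (end sd) x × e ≤ longest

  WalkOf : ℕ → Set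
  WalkOf best = ∀ {e} → best ≡ suc e → Path arcs e u v

  Meets : (ℕ → ℕ) → ℕ → Set
  Meets T best = ∀ x a b → x < n → T (0 * n + x) ≡ suc a → T (1 * n + x) ≡ suc b → AtMost best (a + b)

  Detours : ℕ → ℕ → Set
  Detours x best = ∀ a b → D (addr n 1 (nearest x) u) ≡ suc a → D (addr n 1 (nearest x) v) ≡ suc b → AtMost best (a + b)

  -- What a visit establishes for good: a short entry at its vertex, the detour through the pivot of
  -- that vertex, and one child for each list item.
  record Visited (G : List Probe) (T : ℕ → ℕ) (best : ℕ) (q : Probe) : Set where
    field
      reached  : AtMost (T (side q * n + at q)) (len q)
      detoured : Detours (at q) best
      children : ∀ {l p} → lvl q ≡ suc l → p ∈ sel vtx (at q) balls → probe (side q) (key p) (len q + dst p) l ∈ G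

  record Base (s : State) : Set where
    field
      q₀ : vars s 0 ≡ u
      q₁ : vars s 1 ≡ v
      q₂ : vars s 2 ≡ n
      qD : arrays s 0 ≡ D

  record Probes (s : State) (G : List Probe) : Set where
    field
      sides : Stored (λ k → k) side (arrays s 1) G
      ats   : Stored (λ k → k) at (arrays s 2) G
      lens  : Stored (λ k → k) len (arrays s 3) G
      lvls  : Stored (λ k → k) lvl (arrays s 4) G
      tail  : vars s 3 ≡ length G

  base-cong : ∀ {s s′} → vars s′ 0 ≡ vars s 0 → vars s′ 1 ≡ vars s 1 → vars s′ 2 ≡ vars s 2 → arrays s′ 0 ≡ arrays s 0 →
    Base s → Base s′
  base-cong e₀ e₁ e₂ a₀ B = record { q₀ = trans e₀ (Base.q₀ B) ; q₁ = trans e₁ (Base.q₁ B) ; q₂ = trans e₂ (Base.q₂ B) ; qD = trans a₀ (Base.qD B) }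

  probes-cong : ∀ {s s′ G} → arrays s′ 1 ≡ arrays s 1 → arrays s′ 2 ≡ arrays s 2 → arrays s′ 3 ≡ arrays s 3 → arrays s′ 4 ≡ arrays s 4 →
    vars s′ 3 ≡ vars s 3 → Probes s G → Probes s′ G
  probes-cong {G = G} a₁ a₂ a₃ a₄ e₃ P = record
    { sides = subst (λ f → Stored _ side f G) (sym a₁) (Probes.sides P)
    ; ats = subst (λ f → Stored _ at f G) (sym a₂) (Probes.ats P)
    ; lens = subst (λ f → Stored _ len f G) (sym a₃) (Probes.lens P)
    ; lvls = subst (λ f → Stored _ lvl f G) (sym a₄) (Probes.lvls P)
    ; tail = trans e₃ (Probes.tail P) }

  side-fit : ∀ {sd} → sd ≤ 1 → suc sd * n ≤ 2 * n³
  side-fit sd≤ = *-mono-≤ (s≤s sd≤) n≤n³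

  ev-side : ∀ {s e sd x} → Ev w s e sd → vars s 2 ≡ n → vars s 7 ≡ x → sd ≤ 1 → x < n → Ev w s (sideE e) (sd * n + x)
  ev-side {sd = sd} ee h₂ h₇ sd≤ x<n = ev-idx {a = sd} 2 ee (ev-var h₂) (ev-var h₇) x<n (side-fit sd≤) (m≤m+n 3 61)

  Relaxed : ℕ → ℕ → (ℕ → ℕ) → (ℕ → ℕ) → Set
  Relaxed i δ T T′ = (T′ i ≡ T i ⊎ T′ i ≡ suc δ) × AtMost (T′ i) δ × Improves (T i) (T′ i) × (∀ j → i ≢ j → T′ j ≡ T j)

  relax-run : ∀ {s sd x δ} → Base s → vars s 6 ≡ sd → vars s 7 ≡ x → vars s 8 ≡ δ → sd ≤ 1 → x < n → δ ≤ longest →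
    Run w relax s 2 (λ s′ → Relaxed (sd * n + x) δ (arrays s 5) (arrays s′ 5))
  relax-run {s} {sd} {x} {δ} B h₆ h₇ h₈ sd≤ x<n δ≤ = go (worse old δ) refl
    where
    i old : ℕ
    i = sd * n + x
    old = arrays s 5 i
    idx : Ev w s (sideE (var 6)) i
    idx = ev-side (ev-var h₆) (Base.q₂ B) h₇ sd≤ x<n
    next-δ : Ev w s (bin add (var 8) (lit 1)) (suc δ)
    next-δ = ev-≡ (+-comm δ 1) (ev-add (ev-var h₈) ev-one
      (fit-len (≤-trans (≤-reflexive (+-comm δ 1)) (≤-trans (s≤s δ≤) (≤-trans suc-longest (m≤m+n _ _))))))
    condition : ∀ {c} → worse old δ ≡ c → Ev w s (bin add (bin eq (get 5 (sideE (var 6))) (lit 0)) (bin lt (bin add (var 8) (lit 1)) (get 5 (sideE (var 6))))) c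
    condition e≡ = ev-≡ e≡ (ev-add (ev-eq 2≤2^w (ev-get idx refl) ev-zero) (ev-lt 2≤2^w next-δ (ev-get idx refl))
      (fit-lit (≤-<-trans (worse-≤2 old δ) (m≤m+n 3 61))))
    go : ∀ c → worse old δ ≡ c → Run w relax s 2 (λ s′ → Relaxed i δ (arrays s 5) (arrays s′ 5))
    go zero w≡ = if₀ (condition w≡) (skip-run (inj₁ refl , worse-keep old δ w≡ , improves-refl , λ _ _ → refl))
    go (suc c) w≡ = if₁ (condition w≡) (put-run idx next-δ
      (inj₂ same , (δ , ≤-refl , same) , (λ k o≡ → subst (λ v → AtMost v k) (sym same) (worse-replace old δ w≡ k o≡)) , λ j ne → update-other (arrays s 5) (suc δ) ne))
      where
      same : update (arrays s 5) i (suc δ) i ≡ suc δ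
      same = update-same (arrays s 5) i (suc δ)

  Improved : ℕ → ℕ → ℕ → ℕ → Set
  Improved a b best best′ = (best′ ≡ best ⊎ (∃[ a′ ] ∃[ b′ ] (a ≡ suc a′ × b ≡ suc b′ × best′ ≡ suc (a′ + b′))))
    × Improves best best′
    × (∀ a′ b′ → a ≡ suc a′ → b ≡ suc b′ → AtMost best′ (a′ + b′))

  improve-run : ∀ {s a b} → vars s 11 ≡ a → vars s 12 ≡ b → a + b ≤ 7 * (suc t * (n * n)) →
    Run w improve s 4 (λ s′ → Improved a b (vars s 5) (vars s′ 5))
  improve-run {s} {a} {b} h₁₁ h₁₂ fits = asg⨟ (ev-sub (ev-add (ev-var h₁₁) (ev-var h₁₂) (fit-len fits)) ev-one) (go a b refl refl)
    where
    s₁ : State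
    s₁ = setVar 10 (a + b ∸ 1) s
    best : ℕ
    best = vars s 5
    value : ℕ
    value = bit (0 <ᵇ a) * bit (0 <ᵇ b) * ([ best ≣ 0 ] + bit (a + b ∸ 1 <ᵇ best))
    value-≤ : value ≤ 1 * 1 * 2
    value-≤ = *-mono-≤ (*-mono-≤ (bit-≤1 (0 <ᵇ a)) (bit-≤1 (0 <ᵇ b))) (+-mono-≤ ([≣]-≤1 best 0) (bit-≤1 (a + b ∸ 1 <ᵇ best)))
    small : ∀ {k} → k ≤ 2 → k < 2 ^ w
    small k≤ = fit-lit (≤-<-trans k≤ (m≤m+n 3 61))
    condition : ∀ {c} → value ≡ c → Ev w s₁ (bin mul (bin mul (bin lt (lit 0) (var 11)) (bin lt (lit 0) (var 12)))
                  (bin add (bin eq (var 5) (lit 0)) (bin lt (var 10) (var 5)))) c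
    condition e≡ = ev-≡ e≡ (ev-mul (ev-mul (ev-lt 2≤2^w ev-zero (ev-var h₁₁)) (ev-lt 2≤2^w ev-zero (ev-var h₁₂))
        (small (≤-trans (*-mono-≤ (bit-≤1 (0 <ᵇ a)) (bit-≤1 (0 <ᵇ b))) (n≤1+n 1))))
      (ev-add (ev-eq 2≤2^w (ev-var refl) ev-zero) (ev-lt 2≤2^w (ev-var refl) (ev-var refl))
        (small (+-mono-≤ ([≣]-≤1 best 0) (bit-≤1 (a + b ∸ 1 <ᵇ best)))))
      (small value-≤))
    Post : State → Set
    Post s′ = Improved a b (vars s 5) (vars s′ 5)
    go : ∀ a₀ b₀ → a ≡ a₀ → b ≡ b₀ → Run w replace-best s₁ 2 Post
    go zero b₀ a≡ b≡ = if₀ (condition (cong (λ a → bit (0 <ᵇ a) * bit (0 <ᵇ b) * ([ best ≣ 0 ] + bit (a + b ∸ 1 <ᵇ best))) a≡))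
      (skip-run (inj₁ refl , improves-refl , λ _ _ a≡′ → contradiction (trans (sym a≡′) a≡) λ ()))
    go (suc a₀) zero a≡ b≡ = if₀ (condition (cong₂ (λ a b → bit (0 <ᵇ a) * bit (0 <ᵇ b) * ([ best ≣ 0 ] + bit (a + b ∸ 1 <ᵇ best))) a≡ b≡))
      (skip-run (inj₁ refl , improves-refl , λ _ _ _ b≡′ → contradiction (trans (sym b≡′) b≡) λ ()))
    go (suc a₀) (suc b₀) a≡ b≡ = choose (worse best (a₀ + b₀)) refl
      where
      sum≡ : a + b ∸ 1 ≡ suc (a₀ + b₀)
      sum≡ = trans (cong₂ (λ a b → a + b ∸ 1) a≡ b≡) (+-suc a₀ b₀)
      value≡ : value ≡ worse best (a₀ + b₀)
      value≡ = trans (cong₂ (λ x y → bit (0 <ᵇ x) * bit (0 <ᵇ y) * ([ best ≣ 0 ] + bit (a + b ∸ 1 <ᵇ best))) a≡ b≡)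
        (trans (+-identityʳ _) (cong (λ k → [ best ≣ 0 ] + bit (k <ᵇ best)) sum≡))
      given : ∀ {a′ b′} → a ≡ suc a′ → b ≡ suc b′ → a₀ + b₀ ≡ a′ + b′
      given a≡′ b≡′ = cong₂ _+_ (suc-injective (trans (sym a≡) a≡′)) (suc-injective (trans (sym b≡) b≡′))
      choose : ∀ c → worse best (a₀ + b₀) ≡ c → Run w replace-best s₁ 2 Post
      choose zero w≡ = if₀ (condition (trans value≡ w≡)) (skip-run (inj₁ refl , improves-refl
        , λ _ _ a≡′ b≡′ → subst (AtMost best) (given a≡′ b≡′) (worse-keep best _ w≡)))
      choose (suc c) w≡ = if₁ (condition (trans value≡ w≡)) (asg (ev-var sum≡)
        ( inj₂ (a₀ , b₀ , a≡ , b≡ , refl) , worse-replace best (a₀ + b₀) w≡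
        , λ _ _ a≡′ b≡′ → subst (AtMost (suc (a₀ + b₀))) (given a≡′ b≡′) (a₀ + b₀ , ≤-refl , refl)))

  -- The weight of a probe with `l` levels to go. The factor 3 allows `κ * wt l` for each of the
  -- three payments in `wt-suc`.
  wt : ℕ → ℕ
  wt l = (3 * κ) ^ l

  wt≥1 : ∀ l → 1 ≤ wt l
  wt≥1 zero    = ≤-refl
  wt≥1 (suc l) = *-mono-≤ (≤-trans κ≥1 (m≤m+n κ _)) (wt≥1 l)

  -- A probe pays for itself, for queueing its children and for the children.
  wt-suc : ∀ {k} l → k ≤ κ → 1 + k + k * wt l ≤ wt (suc l)
  wt-suc {k} l k≤κ = begin
    1 + k + k * wt l                ≤⟨ +-mono-≤ (+-mono-≤ (*-mono-≤ κ≥1 (wt≥1 l)) (≤-trans (≤-reflexive (sym (*-identityʳ k))) (*-mono-≤ k≤κ (wt≥1 l)))) (*-monoˡ-≤ (wt l) k≤κ) ⟩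
    κ * wt l + κ * wt l + κ * wt l  ≡⟨ trans (+-assoc (κ * wt l) _ _) (cong (λ z → κ * wt l + (κ * wt l + z)) (sym (+-identityʳ _))) ⟩
    3 * (κ * wt l)                  ≡⟨ *-assoc 3 κ (wt l) ⟨
    wt (suc l)                      ∎
    where open ≤-Reasoning

  weight : List Probe → ℕ
  weight = ∑ (λ q → wt (lvl q))

  length-≤-weight : ∀ G → length G ≤ weight G
  length-≤-weight []      = z≤n
  length-≤-weight (q ∷ G) = +-mono-≤ (wt≥1 (lvl q)) (length-≤-weight G)

  -- Two probes start the search, one from each query vertex, and their joint weight bounds the
  -- length of the queue.
  room-tail : ℕ
  room-tail = 2 * wt t

  record Spread (q : Probe) (l : ℕ) (below : List Probe) (rest : List Item) (s : State) : Set where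
    field
      {cs}   : List Probe
      base   : Base s
      probes : Probes s (cs ++ below)
      cs-ok  : All Okay cs
      cs-lvl : All (λ c → lvl c ≡ l) cs
      x₆     : vars s 6 ≡ side q
      x₇     : vars s 7 ≡ at q
      x₈     : vars s 8 ≡ len q
      x₉     : vars s 9 ≡ suc l
      x₁₅    : vars s 15 ≡ length rest
      fits   : length (cs ++ below) + length rest ≤ room-tail
      tot    : length cs + length rest ≡ length (sel vtx (at q) balls)
      rest-⊆ : ∀ {p} → p ∈ rest → p ∈ balls × vtx p ≡ at q
      rest-κ : length rest ≤ κ
      rest₂  : Stored (λ k → addr n 2 k (at q)) key D rest
      rest₃  : Stored (λ k → addr n 3 k (at q)) dst D rest
      made   : ∀ {p} → p ∈ sel vtx (at q) balls → p ∈ rest ⊎ probe (side q) (key p) (len q + dst p) l ∈ cs ++ below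

  κ≤4n : ∀ {k} → k < κ → k < 4 * n
  κ≤4n k< = <-≤-trans k< (≤-trans κ≤n (m≤m+n n _))

  spread-step : ∀ {q l below p rest s} → Okay q → lvl q ≡ suc l → Spread q l below (p ∷ rest) s →
    Run w ( 15 ≔ bin sub (var 15) (lit 1)
    ⨟ put 1 (var 3) (var 6)
    ⨟ put 2 (var 3) (get 0 (addrE 2 2 (var 15) (var 7)))
    ⨟ put 3 (var 3) (bin add (var 8) (get 0 (addrE 2 3 (var 15) (var 7))))
    ⨟ put 4 (var 3) (bin sub (var 9) (lit 1))
    ⨟ 3 ≔ bin add (var 3) (lit 1) ) s 11 (Spread q l below rest)
  spread-step {q} {l} {below} {p} {rest} {s} ok lvl≡ S =
    asg⨟ (ev-pred (ev-var x₁₅))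
    (put⨟ (ev-var tail) (ev-var x₆)
    (put⨟ (ev-var tail) (ev-get (ev-addr (m≤m+n 3 1) (ev-var refl) (ev-var (Base.q₂ base)) (ev-var x₇) (κ≤4n rest-κ) (at<n ok)) (trans (cong-app (Base.qD base) _) (proj₁ rest₂)))
    (put⨟ (ev-var tail) (ev-add (ev-var x₈) (ev-get (ev-addr ≤-refl (ev-var refl) (ev-var (Base.q₂ base)) (ev-var x₇) (κ≤4n rest-κ) (at<n ok)) (trans (cong-app (Base.qD base) _) (proj₁ rest₃)))
        (fit-len (≤-trans short′ (≤-trans (n≤1+n _) (≤-trans suc-longest (m≤m+n _ _))))))
    (put⨟ (ev-var tail) (ev-pred (ev-var x₉))
    (asg (ev-≡ (+-comm _ 1) (ev-add (ev-var tail) ev-one (≤-<-trans tail≤ room-count)))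
      (record
        { cs = c ∷ cs
        ; base = base-cong {s} refl refl refl refl base
        ; probes = record
            { sides = update-same (arrays s 1) _ _ , bump side (arrays s 1) sides
            ; ats = update-same (arrays s 2) _ _ , bump at (arrays s 2) ats
            ; lens = update-same (arrays s 3) _ _ , bump len (arrays s 3) lens
            ; lvls = update-same (arrays s 4) _ _ , bump lvl (arrays s 4) lvls
            ; tail = refl }
        ; cs-ok = ok-c ∷ cs-ok ; cs-lvl = refl ∷ cs-lvl
        ; x₆ = x₆ ; x₇ = x₇ ; x₈ = x₈ ; x₉ = x₉ ; x₁₅ = refl
        ; tot = trans (sym (+-suc (length cs) (length rest))) tot
        ; fits = ≤-trans (≤-reflexive (sym (+-suc (length (cs ++ below)) (length rest)))) fits
        ; rest-⊆ = λ p∈ → rest-⊆ (there p∈) ; rest-κ = ≤-trans (n≤1+n _) rest-κ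
        ; rest₂ = proj₂ rest₂ ; rest₃ = proj₂ rest₃ ; made = made′ }))))))
    where
    open Spread S
    open Probes probes
    p∈ : p ∈ balls
    p∈ = proj₁ (rest-⊆ (here refl))
    c : Probe
    c = probe (side q) (key p) (len q + dst p) l
    tail≤ : length (cs ++ below) + 1 ≤ room-tail
    tail≤ = ≤-trans (+-monoʳ-≤ (length (cs ++ below)) (s≤s z≤n)) fits
    short-c : len q + dst p + l * (n * n) ≤ longest
    short-c = ≤-trans (≤-reflexive (+-assoc (len q) (dst p) _))
      (≤-trans (+-monoʳ-≤ (len q) (+-monoˡ-≤ (l * (n * n)) (proj₂ (proj₂ (sound p∈)))))
        (≤-trans (≤-reflexive (cong (λ k → len q + k * (n * n)) (sym lvl≡))) (short ok)))
    short′ : len q + dst p ≤ longest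
    short′ = ≤-trans (m≤m+n _ _) short-c
    ok-c : Okay c
    ok-c = record { side≤1 = side≤1 ok ; at<n = proj₁ (sound p∈)
                  ; walk = Path-++ (walk ok) (subst (λ y → Path arcs (dst p) y (key p)) (proj₂ (rest-⊆ (here refl))) (proj₁ (proj₂ (sound p∈))))
                  ; short = short-c }
    bump : ∀ (f : Probe → ℕ) (arr : ℕ → ℕ) {x} → Stored (λ k → k) f arr (cs ++ below) → Stored (λ k → k) f (update arr (length (cs ++ below)) x) (cs ++ below)
    bump f arr = stored-update {at = λ k → k} {f} {arr} (cs ++ below) (λ k k< → <⇒≢ k< ∘ sym)
    made′ : ∀ {r} → r ∈ sel vtx (at q) balls → r ∈ rest ⊎ probe (side q) (key r) (len q + dst r) l ∈ c ∷ cs ++ below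
    made′ r∈ with made r∈
    ... | inj₁ (here refl)  = inj₂ (here refl)
    ... | inj₁ (there r∈′)  = inj₁ r∈′
    ... | inj₂ c∈           = inj₂ (there c∈)

  kids : Probe → List Item
  kids (probe sd x δ zero)    = []
  kids (probe sd x δ (suc l)) = sel vtx x balls

  kids-weight : ∀ q → 1 + length (kids q) + length (kids q) * wt (lvl q ∸ 1) ≤ wt (lvl q)
  kids-weight (probe sd x δ zero)    = ≤-refl
  kids-weight (probe sd x δ (suc l)) = wt-suc l (cnt-≤ x)

  record Expanded (q : Probe) (below : List Probe) (s : State) : Set where
    field
      {cs}   : List Probe
      base   : Base s
      probes : Probes s (cs ++ below)
      cs-ok  : All Okay cs
      cs-wt  : weight cs ≡ length (kids q) * wt (lvl q ∸ 1)
      made   : ∀ {l p} → lvl q ≡ suc l → p ∈ sel vtx (at q) balls → probe (side q) (key p) (len q + dst p) l ∈ cs ++ below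

  weight-lvl : ∀ {l cs} → All (λ c → lvl c ≡ l) cs → weight cs ≡ length cs * wt l
  weight-lvl []         = refl
  weight-lvl (e≡ ∷ es≡) = cong₂ _+_ (cong wt e≡) (weight-lvl es≡)

  expand-run : ∀ {q below s} → Okay q → Base s → Probes s below → vars s 6 ≡ side q → vars s 7 ≡ at q → vars s 8 ≡ len q → vars s 9 ≡ lvl q →
    vars s 15 ≡ length (kids q) → length below + length (kids q) ≤ room-tail →
    Run w expand s (suc (∑ (λ _ → 12) (kids q))) (Expanded q below)
  expand-run {q@(probe sd x δ zero)} ok B P h₆ h₇ h₈ h₉ h₁₅ fits =
    _ , 1 , e-wh₀ h₁₅ , ≤-refl , record { cs = [] ; base = B ; probes = P ; cs-ok = [] ; cs-wt = refl ; made = λ () }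
  expand-run {q@(probe sd x δ (suc l))} {below} ok B P h₆ h₇ h₈ h₉ h₁₅ fits =
    while-list (Spread q l below) (λ _ → 11)
      (λ s S → ev-var (Spread.x₁₅ S) , record
        { base = Spread.base S ; probes = Spread.probes S ; cs-ok = Spread.cs-ok S
        ; cs-wt = trans (weight-lvl (Spread.cs-lvl S)) (cong (_* wt l) (trans (sym (+-identityʳ _)) (Spread.tot S)))
        ; made = λ { refl p∈ → all-made (Spread.made S p∈) } })
      (λ p rest s S → length rest , ev-var (Spread.x₁₅ S) , spread-step ok refl S)
      (sel vtx x balls)
      (record { cs = [] ; base = B ; probes = P ; cs-ok = [] ; cs-lvl = [] ; x₆ = h₆ ; x₇ = h₇ ; x₈ = h₈ ; x₉ = h₉ ; x₁₅ = h₁₅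
              ; fits = fits ; tot = refl ; rest-⊆ = ∈-sel⁻ vtx balls ; rest-κ = cnt-≤ x ; rest₂ = keys (at<n ok) ; rest₃ = dists (at<n ok) ; made = inj₁ })
    where
    all-made : ∀ {p : Item} {A : Set} → p ∈ [] ⊎ A → A
    all-made (inj₂ a) = a

  meet-run : ∀ {s x} → Base s → WalksOf (arrays s 5) → vars s 7 ≡ x → x < n →
    Run w meet s 8 (λ s′ → Improved (arrays s 5 (0 * n + x)) (arrays s 5 (1 * n + x)) (vars s 5) (vars s′ 5))
  meet-run {s} {x} B W h₇ x<n =
    asg⨟ (ev-get (ev-side ev-zero (Base.q₂ B) h₇ z≤n x<n) refl)
    (asg⨟ (ev-get (ev-side ev-one (Base.q₂ B) h₇ ≤-refl x<n) refl)
    (improve-run refl refl (≤-trans (+-mono-≤ (cell-≤ 0 z≤n) (cell-≤ 1 ≤-refl)) two)))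
    where
    cell-≤ : ∀ sd → sd ≤ 1 → arrays s 5 (sd * n + x) ≤ suc t * (n * n)
    cell-≤ sd sd≤ with arrays s 5 (sd * n + x) in e≡
    ... | zero  = z≤n
    ... | suc e = ≤-trans (s≤s (proj₂ (W sd≤ x<n e≡))) suc-longest
    two : suc t * (n * n) + suc t * (n * n) ≤ 7 * (suc t * (n * n))
    two = +-monoʳ-≤ (suc t * (n * n)) (m≤m+n _ _)

  detour-run : ∀ {s x} → Base s → vars s 7 ≡ x → x < n →
    Run w detour s 10 (λ s′ → Improved (D (addr n 1 (nearest x) u)) (D (addr n 1 (nearest x) v)) (vars s 5) (vars s′ 5))
  detour-run {s} {x} B h₇ x<n =
    asg⨟ (ev-sub (ev-get (ev-addr (s≤s z≤n) (ev-const 3 (m≤m+n 4 60)) (ev-var (Base.q₂ B)) (ev-var h₇) 3<4n x<n) (cong-app (Base.qD B) _)) ev-one)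
    (asg⨟ (ev-get (ev-addr (m≤m+n 2 2) (ev-var refl) (ev-var (Base.q₂ B)) (ev-var (Base.q₀ B)) row<4n u<n) (cong-app (Base.qD B) _))
    (asg⨟ (ev-get (ev-addr (m≤m+n 2 2) (ev-var refl) (ev-var (Base.q₂ B)) (ev-var (Base.q₁ B)) row<4n v<n) (cong-app (Base.qD B) _))
    (improve-run refl refl (≤-trans (+-mono-≤ (cell-≤ u<n) (cell-≤ v<n)) four))))
    where
    3<4n : 3 < 4 * n
    3<4n = m≤m*n 4 n {{>-nonZero n≥1}}
    row<4n : nearest x < 4 * n
    row<4n = <-≤-trans (nearest-<n x<n) (m≤m+n n _)
    H : ℕ
    H = suc t * (n * n)
    cell-≤ : ∀ {z} → z < n → D (addr n 1 (nearest x) z) ≤ H + H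
    cell-≤ {z} z<n with D (addr n 1 (nearest x) z) in e≡
    ... | zero  = z≤n
    ... | suc e = +-mono-≤ (≤-trans n²≥1 (m≤m+n (n * n) longest)) (≤-trans (proj₂ (matrix (nearest-<n x<n) (nearest-≤R x<n) z<n e≡)) (m≤m+n (n * n) longest))
    four : H + H + (H + H) ≤ 7 * H
    four = ≤-trans (≤-reflexive (trans (+-assoc H H (H + H)) (cong (λ k → H + (H + (H + k))) (sym (+-identityʳ H))))) (*-monoˡ-≤ H (m≤m+n 4 3))

  -- Nothing is pruned: probes at the same vertex are expanded separately, and the search is a tree
  -- of depth `t`. `budget` bounds the queue, and `spent` charges 37 steps to each unit of weight.
  -- `meets` speaks of all vertices, visited or not, so that the two chains may arrive in either
  -- order.
  record Explore (b : ℕ) (s : State) : Set where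
    field
      {new old G} : List Probe
      split   : G ≡ new ++ old
      base    : Base s
      probes  : Probes s G
      head    : vars s 4 ≡ length old
      okay    : All Okay G
      walks   : WalksOf (arrays s 5)
      found   : WalkOf (vars s 5)
      meets   : Meets (arrays s 5) (vars s 5)
      visited : All (Visited G (arrays s 5) (vars s 5)) old
      from-u  : probe 0 u 0 t ∈ G
      from-v  : probe 1 v 0 t ∈ G
      budget  : length old + weight new ≤ room-tail
      spent   : b + 37 * weight new ≤ 37 * room-tail

  visit-cost : Probe → ℕ
  visit-cost q = 36 + 12 * length (kids q)

  module _ {b : ℕ} {s : State} (E : Explore b s) {new : List Probe} {q : Probe} (new≡ : Explore.new E ≡ new ∷ʳ q) where
    open Explore E hiding (new)

    G≡ : G ≡ new ++ q ∷ old
    G≡ = trans split (trans (cong (_++ old) new≡) (++-assoc new (q ∷ []) old))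

    q∈G : q ∈ G
    q∈G = subst (q ∈_) (sym G≡) (∈-++⁺ʳ new (here refl))

    ok : Okay q
    ok = All.lookup okay q∈G

    weight≡ : weight (Explore.new E) ≡ weight new + wt (lvl q)
    weight≡ = trans (cong weight new≡) (trans (∑-++ _ new (q ∷ [])) (cong (weight new +_) (+-identityʳ _)))

    here-at : ∀ {g arr} → Stored (λ k → k) g arr G → arr (length old) ≡ g q
    here-at {g} {arr} st = proj₁ (stored-drop {at = λ k → k} {g} {arr} new (subst (Stored _ g arr) G≡ st))

    kids-pay : suc (length (kids q)) ≤ wt (lvl q)
    kids-pay = ≤-trans (m≤m+n _ _) (kids-weight q)

    length-G : length G + length (kids q) ≤ room-tail
    length-G = begin
      length G + length (kids q)                              ≡⟨ cong (_+ length (kids q)) (trans (cong length G≡) (length-++ new)) ⟩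
      length new + suc (length old) + length (kids q)         ≡⟨ trans (cong (_+ length (kids q)) (+-suc (length new) (length old))) (trans (cong (λ z → suc z + length (kids q)) (+-comm (length new) _)) (sym (trans (+-assoc (length old) (length new) _) (trans (cong (length old +_) (+-suc (length new) _)) (trans (+-suc (length old) _) (cong suc (sym (+-assoc (length old) (length new) _)))))))) ⟩
      length old + length new + suc (length (kids q))         ≤⟨ +-mono-≤ (+-monoʳ-≤ (length old) (length-≤-weight new)) kids-pay ⟩
      length old + weight new + wt (lvl q)                    ≡⟨ trans (+-assoc (length old) _ _) (cong (length old +_) (sym weight≡)) ⟩
      length old + weight (Explore.new E)                     ≤⟨ budget ⟩
      room-tail ∎
      where open ≤-Reasoning

    old≤ : length old + 1 ≤ room-tail
    old≤ = ≤-trans (+-monoʳ-≤ (length old) (≤-trans (wt≥1 (lvl q)) (≤-trans (m≤n+m _ (weight new)) (≤-reflexive (sym weight≡))))) budget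

    T₀ : ℕ → ℕ
    T₀ = arrays s 5

    index : ℕ
    index = side q * n + at q

    relaxed-walks : ∀ {T₁} → Relaxed index (len q) T₀ T₁ → WalksOf T₁
    relaxed-walks {T₁} (change , _ , _ , same) {sd} {x} {e} sd≤ x<n e≡ with index ≟ sd * n + x
    ... | no ne = walks sd≤ x<n (trans (sym (same _ ne)) e≡)
    ... | yes i≡ with idx-injective {side q} {sd} (at<n ok) x<n i≡
    ...   | refl , refl with change
    ...     | inj₁ keep = walks sd≤ x<n (trans (sym keep) e≡)
    ...     | inj₂ set with suc-injective (trans (sym e≡) set)
    ...       | refl = walk ok , ≤-trans (m≤m+n _ _) (short ok)

    relaxed-improves : ∀ {T₁} → Relaxed index (len q) T₀ T₁ → ∀ j → Improves (T₀ j) (T₁ j)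
    relaxed-improves {T₁} (_ , _ , imp , same) j with index ≟ j
    ... | yes refl = imp
    ... | no ne    = subst (Improves (T₀ j)) (sym (same j ne)) improves-refl

    -- A visit changes a cell of the vertex `at q` alone, so only meetings there have to be tested
    -- anew.
    meets-after : ∀ {T₁ best₁} → Relaxed index (len q) T₀ T₁ →
      Improved (T₁ (0 * n + at q)) (T₁ (1 * n + at q)) (vars s 5) best₁ → Meets T₁ best₁
    meets-after {T₁} {best₁} (_ , _ , _ , same) (_ , imp , now) x a b x<n a≡ b≡ with at q ≟ x
    ... | yes refl = now a b a≡ b≡
    ... | no ne = atMost-improves (meets x a b x<n (trans (sym (same _ (apart 0))) a≡) (trans (sym (same _ (apart 1))) b≡)) imp
      where
      apart : ∀ sd → index ≢ sd * n + x
      apart sd = idx-≢ʳ {side q} {sd} (at<n ok) x<n ne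

    found-meet : ∀ {T₁ best₁} → WalksOf T₁ →
      Improved (T₁ (0 * n + at q)) (T₁ (1 * n + at q)) (vars s 5) best₁ → WalkOf best₁
    found-meet W (inj₁ keep , _) e≡ = found (trans (sym keep) e≡)
    found-meet W (inj₂ (a , b , a≡ , b≡ , set) , _) e≡ with suc-injective (trans (sym e≡) set)
    ... | refl = Path-++ (proj₁ (W z≤n (at<n ok) a≡)) (Path-reverse sy (proj₁ (W ≤-refl (at<n ok) b≡)))

    found-detour : ∀ {best best₁} → WalkOf best →
      Improved (D (addr n 1 (nearest (at q)) u)) (D (addr n 1 (nearest (at q)) v)) best best₁ → WalkOf best₁
    found-detour W (inj₁ keep , _) e≡ = W (trans (sym keep) e≡)
    found-detour W (inj₂ (a , b , a≡ , b≡ , set) , _) e≡ with suc-injective (trans (sym e≡) set)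
    ... | refl = Path-++ (proj₁ (matrix (nearest-<n (at<n ok)) (nearest-≤R (at<n ok)) u<n a≡))
                         (Path-reverse sy (proj₁ (matrix (nearest-<n (at<n ok)) (nearest-≤R (at<n ok)) v<n b≡)))

    visited-mono : ∀ {G′ T₁ best₁ p} → (∀ {r} → r ∈ G → r ∈ G′) → (∀ j → Improves (T₀ j) (T₁ j)) → Improves (vars s 5) best₁ →
      Visited G T₀ (vars s 5) p → Visited G′ T₁ best₁ p
    visited-mono up impT impB V = record
      { reached = atMost-improves (Visited.reached V) (impT _)
      ; detoured = λ a b a≡ b≡ → atMost-improves (Visited.detoured V a b a≡ b≡) impB
      ; children = λ l≡ p∈ → up (Visited.children V l≡ p∈) }

    improves-trans : ∀ {x y z} → Improves x y → Improves y z → Improves x z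
    improves-trans f g k e≡ = atMost-improves (f k e≡) g

    load-run : Run w load-probe s 7 (λ s′ → vars s′ 6 ≡ side q × vars s′ 7 ≡ at q × vars s′ 8 ≡ len q × vars s′ 9 ≡ lvl q)
    load-run = asg⨟ (ev-get (ev-var head) (here-at (Probes.sides probes))) (asg⨟ (ev-get (ev-var head) (here-at (Probes.ats probes)))
      (asg⨟ (ev-get (ev-var head) (here-at (Probes.lens probes))) (asg (ev-get (ev-var head) (here-at (Probes.lvls probes))) (refl , refl , refl , refl))))

    ev-kids : ∀ {s′} → Base s′ → vars s′ 7 ≡ at q → vars s′ 9 ≡ lvl q →
      Ev w s′ (bin mul (get 0 (addrE 2 0 (lit 1) (var 7))) (bin lt (lit 0) (var 9))) (length (kids q))
    ev-kids B h₇ h₉ = ev-≡ (kids≡ q) (ev-mul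
      (ev-get (ev-addr (s≤s z≤n) ev-one (ev-var (Base.q₂ B)) (ev-var h₇) (≤-trans (m≤m+n 2 2) (m≤m*n 4 n {{>-nonZero n≥1}})) (at<n ok))
        (trans (cong-app (Base.qD B) _) (counts (at<n ok))))
      (ev-lt 2≤2^w ev-zero (ev-var h₉))
      (fit 1 (≤-trans (≤-trans (*-monoʳ-≤ (cnt balls (at q)) (bit-≤1 (0 <ᵇ lvl q))) (≤-reflexive (*-identityʳ _)))
        (≤-trans (cnt-≤ (at q)) (≤-trans κ≤n (≤-trans n≤n³ (≤-reflexive (sym (*-identityˡ n³))))))) (m≤m+n 2 62)))
      where
      kids≡ : ∀ p → cnt balls (at p) * bit (0 <ᵇ lvl p) ≡ length (kids p)
      kids≡ (probe sd x δ zero)    = *-zeroʳ (cnt balls x)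
      kids≡ (probe sd x δ (suc l)) = *-identityʳ (cnt balls x)

    visit-time : suc (7 + suc (2 + suc (8 + suc (10 + (2 + suc (suc (∑ (λ _ → 12) (kids q)) + 1)))))) ≡ visit-cost q
    visit-time = cong (34 +_) (trans (cong suc (+-comm (∑ (λ _ → 12) (kids q)) 1)) (cong (2 +_) (trans (∑-const 12 (kids q)) (*-comm (length (kids q)) 12))))

    -- A visit with `k` children takes 37 + 12k steps, the test of the loop included. Charging 37 to
    -- the probe and 37 to each child it queues covers this and leaves the weight of the children
    -- untouched.
    pay : ∀ k l → 37 + 12 * k + 37 * (k * l) ≤ 37 * (1 + k + k * l)
    pay k l = ≤-trans (+-monoˡ-≤ (37 * (k * l)) (+-monoʳ-≤ 37 (*-monoˡ-≤ k (m≤m+n 12 25))))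
      (≤-reflexive (sym (trans (*-distribˡ-+ 37 (1 + k) (k * l)) (cong (_+ 37 * (k * l)) (*-distribˡ-+ 37 1 k)))))

    spent-after : ∀ {cs} → weight cs ≡ length (kids q) * wt (lvl q ∸ 1) →
      b + suc (visit-cost q) + 37 * weight (cs ++ new) ≤ 37 * room-tail
    spent-after {cs} cs≡ = begin
      b + suc (visit-cost q) + 37 * weight (cs ++ new)
        ≡⟨ cong (λ z → b + suc (visit-cost q) + z) (trans (cong (37 *_) (∑-++ _ cs new)) (*-distribˡ-+ 37 (weight cs) (weight new))) ⟩
      b + suc (visit-cost q) + (37 * weight cs + 37 * weight new)
        ≡⟨ trans (+-assoc b _ _) (cong (b +_) (sym (+-assoc (suc (visit-cost q)) _ _))) ⟩
      b + (suc (visit-cost q) + 37 * weight cs + 37 * weight new)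
        ≤⟨ +-monoʳ-≤ b (+-monoˡ-≤ (37 * weight new) (≤-trans (≤-reflexive (cong (λ z → suc (visit-cost q) + 37 * z) cs≡))
             (≤-trans (pay (length (kids q)) (wt (lvl q ∸ 1))) (*-monoʳ-≤ 37 (kids-weight q))))) ⟩
      b + (37 * wt (lvl q) + 37 * weight new)
        ≡⟨ cong (b +_) (trans (sym (*-distribˡ-+ 37 (wt (lvl q)) (weight new))) (cong (37 *_) (trans (+-comm (wt (lvl q)) _) (sym weight≡)))) ⟩
      b + 37 * weight (Explore.new E) ≤⟨ spent ⟩
      37 * room-tail ∎
      where open ≤-Reasoning

    budget-after : ∀ {cs} → weight cs ≡ length (kids q) * wt (lvl q ∸ 1) → suc (length old) + weight (cs ++ new) ≤ room-tail
    budget-after {cs} cs≡ = begin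
      suc (length old) + weight (cs ++ new)          ≡⟨ cong (suc (length old) +_) (∑-++ _ cs new) ⟩
      suc (length old) + (weight cs + weight new)    ≡⟨ sym (+-suc (length old) _) ⟩
      length old + suc (weight cs + weight new)      ≤⟨ +-monoʳ-≤ (length old) (+-monoˡ-≤ (weight new) (≤-trans (s≤s (≤-trans (≤-reflexive cs≡) (m≤n+m _ (length (kids q))))) (kids-weight q))) ⟩
      length old + (wt (lvl q) + weight new)         ≡⟨ cong (length old +_) (trans (+-comm (wt (lvl q)) _) (sym weight≡)) ⟩
      length old + weight (Explore.new E)            ≤⟨ budget ⟩
      room-tail ∎
      where open ≤-Reasoning

    visit-run : Run w visit s (visit-cost q) (λ s′ → Explore (b + suc (visit-cost q)) s′)
    visit-run = weaken (≤-reflexive visit-time)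
      (call⨟ load-run λ s₁ V₁ A₁ (h₆ , h₇ , h₈ , h₉) →
       let B₁ = base-cong {s} {s₁} (V₁ 0 refl) (V₁ 1 refl) (V₁ 2 refl) (A₁ 0 refl) base in
       call⨟ (relax-run B₁ h₆ h₇ h₈ (side≤1 ok) (at<n ok) (≤-trans (m≤m+n _ _) (short ok))) λ s₂ V₂ A₂ rel₂ →
       let rel : Relaxed index (len q) T₀ (arrays s₂ 5)
           rel = subst (λ T → Relaxed index (len q) T (arrays s₂ 5)) (A₁ 5 refl) rel₂
           B₂ = base-cong {s₁} {s₂} (V₂ 0 refl) (V₂ 1 refl) (V₂ 2 refl) (A₂ 0 refl) B₁ in
       call⨟ (meet-run B₂ (relaxed-walks rel) (trans (V₂ 7 refl) h₇) (at<n ok)) λ s₃ V₃ A₃ imp₃ →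
       let B₃ = base-cong {s₂} {s₃} (V₃ 0 refl) (V₃ 1 refl) (V₃ 2 refl) (A₃ 0 refl) B₂
           met : Improved (arrays s₂ 5 (0 * n + at q)) (arrays s₂ 5 (1 * n + at q)) (vars s 5) (vars s₃ 5)
           met = subst (λ z → Improved (arrays s₂ 5 (0 * n + at q)) (arrays s₂ 5 (1 * n + at q)) z (vars s₃ 5)) (trans (V₂ 5 refl) (V₁ 5 refl)) imp₃ in
       call⨟ (detour-run B₃ (trans (V₃ 7 refl) (trans (V₂ 7 refl) h₇)) (at<n ok)) λ s₄ V₄ A₄ det →
       let B₄ = base-cong {s₃} {s₄} (V₄ 0 refl) (V₄ 1 refl) (V₄ 2 refl) (A₄ 0 refl) B₃
           h₇′ = trans (V₄ 7 refl) (trans (V₃ 7 refl) (trans (V₂ 7 refl) h₇))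
           h₉′ = trans (V₄ 9 refl) (trans (V₃ 9 refl) (trans (V₂ 9 refl) h₉)) in
       asg⨟ (ev-kids B₄ h₇′ h₉′)
       (call⨟ (expand-run {q} {G} ok (base-cong {s₄} refl refl refl refl B₄)
            (probes-cong {s} (trans (A₄ 1 refl) (trans (A₃ 1 refl) (trans (A₂ 1 refl) (A₁ 1 refl))))
              (trans (A₄ 2 refl) (trans (A₃ 2 refl) (trans (A₂ 2 refl) (A₁ 2 refl))))
              (trans (A₄ 3 refl) (trans (A₃ 3 refl) (trans (A₂ 3 refl) (A₁ 3 refl))))
              (trans (A₄ 4 refl) (trans (A₃ 4 refl) (trans (A₂ 4 refl) (A₁ 4 refl))))
              (trans (V₄ 3 refl) (trans (V₃ 3 refl) (trans (V₂ 3 refl) (V₁ 3 refl)))) probes)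
            (trans (V₄ 6 refl) (trans (V₃ 6 refl) (trans (V₂ 6 refl) h₆))) h₇′
            (trans (V₄ 8 refl) (trans (V₃ 8 refl) (trans (V₂ 8 refl) h₈))) h₉′ refl length-G)
        λ s₅ V₅ A₅ X →
        asg (ev-add (ev-var (trans (V₅ 4 refl) (trans (V₄ 4 refl) (trans (V₃ 4 refl) (trans (V₂ 4 refl) (trans (V₁ 4 refl) head)))))) ev-one
              (≤-<-trans old≤ room-count))
          (after {s₂} {s₃} {s₄} {s₅} (trans (A₅ 5 refl) (trans (A₄ 5 refl) (A₃ 5 refl))) (V₅ 5 refl) rel met det X)))
      where
      after : ∀ {s₂ s₃ s₄ s₅} → arrays s₅ 5 ≡ arrays s₂ 5 → vars s₅ 5 ≡ vars s₄ 5 → Relaxed index (len q) T₀ (arrays s₂ 5) →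
        Improved (arrays s₂ 5 (0 * n + at q)) (arrays s₂ 5 (1 * n + at q)) (vars s 5) (vars s₃ 5) →
        Improved (D (addr n 1 (nearest (at q)) u)) (D (addr n 1 (nearest (at q)) v)) (vars s₃ 5) (vars s₄ 5) →
        Expanded q G s₅ → Explore (b + suc (visit-cost q)) (setVar 4 (length old + 1) s₅)
      after {s₂} {s₃} {s₄} {s₅} T≡ best≡ rel met det X = record
        { new = cs ++ new ; old = q ∷ old ; G = cs ++ G
        ; split = trans (cong (cs ++_) G≡) (sym (++-assoc cs new (q ∷ old)))
        ; base = base-cong {s₅} refl refl refl refl (Expanded.base X)
        ; probes = probes-cong {s₅} refl refl refl refl refl (Expanded.probes X)
        ; head = +-comm (length old) 1
        ; okay = AllP.++⁺ (Expanded.cs-ok X) okay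
        ; walks = subst WalksOf′ (sym T≡) (λ sd x e → relaxed-walks rel {sd} {x} {e}) _ _ _
        ; found = λ e≡ → found-detour (λ {e} → found-meet {arrays s₂ 5} (λ {sd} {x} {e} → relaxed-walks rel {sd} {x} {e}) met {e}) det (trans (sym best≡) e≡)
        ; meets = subst₂ Meets (sym T≡) (sym best≡) (λ x a c x<n a≡ c≡ → atMost-improves (meets-after rel met x a c x<n a≡ c≡) (proj₁ (proj₂ det)))
        ; visited = subst₂ (λ T best → All (Visited (cs ++ G) T best) (q ∷ old)) (sym T≡) (sym best≡) (now ∷ All.map before visited)
        ; from-u = ∈-++⁺ʳ cs from-u ; from-v = ∈-++⁺ʳ cs from-v
        ; budget = budget-after {cs} (Expanded.cs-wt X) ; spent = spent-after {cs} (Expanded.cs-wt X) }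
        where
        cs : List Probe
        cs = Expanded.cs X
        WalksOf′ : (ℕ → ℕ) → Set
        WalksOf′ T = ∀ sd x e → sd ≤ 1 → x < n → T (sd * n + x) ≡ suc e → Path arcs e (end sd) x × e ≤ longest
        now : Visited (cs ++ G) (arrays s₂ 5) (vars s₄ 5) q
        now = record { reached = proj₁ (proj₂ rel) ; detoured = proj₂ (proj₂ det) ; children = Expanded.made X }
        before : ∀ {p} → Visited G T₀ (vars s 5) p → Visited (cs ++ G) (arrays s₂ 5) (vars s₄ 5) p
        before = visited-mono (∈-++⁺ʳ cs) (relaxed-improves rel) (improves-trans (proj₁ (proj₂ met)) (proj₁ (proj₂ det)))

  record Explored (s : State) : Set where
    field
      {G}     : List Probe
      okay    : All Okay G
      found   : WalkOf (vars s 5)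
      meets   : Meets (arrays s 5) (vars s 5)
      visited : All (Visited G (arrays s 5) (vars s 5)) G
      from-u  : probe 0 u 0 t ∈ G
      from-v  : probe 1 v 0 t ∈ G

  explore-run : ∀ {s} → Explore 0 s → Run w explore s (suc (37 * room-tail)) Explored
  explore-run = while-elapsed Explore (37 * room-tail) (λ b s E → ≤-trans (m≤m+n b _) (Explore.spent E)) stp
    where
    stp : ∀ b s → Explore b s → (Ev w s (bin lt (var 4) (var 3)) 0 × Explored s)
      ⊎ (∃[ v ] ∃[ T ] (Ev w s (bin lt (var 4) (var 3)) (suc v) × Run w visit s T (Explore (b + suc T))))
    stp b s E with Explore.new E in new≡
    stp b s E | ns with initLast ns
    stp b s E | .[] | [] = inj₁ (ev-≡ (bit-≮ᵇ (λ l< → <⇒≢ l< (cong length (sym G≡old)))) (ev-lt 2≤2^w (ev-var head) (ev-var (Probes.tail probes)))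
      , record { okay = okay ; found = found ; meets = meets
               ; visited = subst (All (Visited G (arrays s 5) (vars s 5))) (sym G≡old) visited ; from-u = from-u ; from-v = from-v })
      where
      open Explore E
      G≡old : G ≡ old
      G≡old = trans split (cong (_++ old) new≡)
    stp b s E | .(new′ ∷ʳ q) | new′ ∷ʳ′ q = inj₂ (0 , visit-cost q
      , ev-≡ (bit-<ᵇ old<) (ev-lt 2≤2^w (ev-var head) (ev-var (Probes.tail probes))) , visit-run E new≡)
      where
      open Explore E
      old< : length old < length G
      old< = subst (λ G → length old < length G) (sym (G≡ E new≡))
        (≤-trans (m≤n+m (suc (length old)) (length new′)) (≤-reflexive (sym (length-++ new′))))

  Path-split : ∀ k {l u v} → Path arcs (k + l) u v → ∃[ x ] (Path arcs k u x × Path arcs l x v)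
  Path-split zero    p = _ , nil , p
  Path-split (suc k) (cons e p) with Path-split k p
  ... | x , p₁ , p₂ = x , cons e p₁ , p₂

  module _ {s : State} (E : Explored s) where
    open Explored E

    pivot-detour : ∀ {q x e₁ α β r} → q ∈ G → D (addr n 0 3 (at q)) ≡ suc r → x ≡ at q →
      (∀ {z j} → z < n → Path arcs j x z → ∃[ e ] (e ≤ e₁ + j × D (addr n 1 r z) ≡ suc e)) →
      Path arcs α x u → Path arcs β x v → AtMost (vars s 5) (e₁ + α + (e₁ + β))
    pivot-detour {q} {r = r} q∈ near≡ refl far pu pv with far u<n pu | far v<n pv
    ... | a , a≤ , a≡ | b , b≤ , b≡ = atMost-mono (+-mono-≤ a≤ b≤)
      (Visited.detoured (All.lookup visited q∈) a b (row u a≡) (row v b≡))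
      where
      row : ∀ z {c} → D (addr n 1 r z) ≡ c → D (addr n 1 (nearest (at q)) z) ≡ c
      row z {c} = subst (λ ρ → D (addr n 1 ρ z) ≡ c) (sym (cong (_∸ 1) near≡))

    -- Along a shortest walk each level advances by r, unless a pivot lies within r.
    chain : ∀ {d r} → (1 ≤ d → 1 ≤ r) → ∀ j {q y e f} → q ∈ G → lvl q ≡ j → Path arcs e (at q) y → e ≤ j * r →
      Path arcs f y (end (1 ∸ side q)) → len q + e + f ≤ d →
      AtMost (vars s 5) (d + 2 * r) ⊎ (∃[ q′ ] (q′ ∈ G × side q′ ≡ side q × at q′ ≡ y × len q′ ≤ len q + e))
    chain r≥1 j {q} q∈ l≡ nil e≤ pf le = inj₂ (q , q∈ , refl , refl , m≤m+n _ _)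
    chain r≥1 zero {q} q∈ l≡ (cons _ _) () pf le
    chain {d} {r} r≥1 (suc j) {q} {y} {suc e} {f} q∈ l≡ p e≤ pf le = advance (Path-split e₁ (subst (λ k → Path arcs k (at q) y) (sym e≡) p))
      where
      okq : Okay q
      okq = All.lookup okay q∈
      e₁ e₂ : ℕ
      -- One hop: `r` steps, or whatever is left of the way to `y`. It is positive, as `complete`
      -- demands, because `d` and therefore `r` is.
      e₁ = r ⊓ suc e
      e₂ = suc e ∸ r
      e≡ : e₁ + e₂ ≡ suc e
      e≡ = m⊓n+n∸m≡n r (suc e)
      e₂≤ : e₂ ≤ j * r
      e₂≤ = m≤n+o⇒m∸n≤o (suc e) r e≤
      positive : ∀ {r′} → 1 ≤ r′ → ∃[ e′ ] r′ ⊓ suc e ≡ suc e′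
      positive {suc r′} _ = r′ ⊓ e , refl
      Result : Set
      Result = AtMost (vars s 5) (d + 2 * r) ⊎ (∃[ q′ ] (q′ ∈ G × side q′ ≡ side q × at q′ ≡ y × len q′ ≤ len q + suc e))
      rest : ∀ {α β} → α + β ≤ d → e₁ + α + (e₁ + β) ≤ d + 2 * r
      rest {α} {β} αβ≤ = ≤-trans (≤-reflexive (+-CS.interchange e₁ α e₁ β)) (≤-trans (≤-reflexive (+-comm (e₁ + e₁) (α + β)))
        (+-mono-≤ αβ≤ (≤-trans (+-mono-≤ (m⊓n≤m r (suc e)) (m⊓n≤m r (suc e))) (≤-reflexive (cong (r +_) (sym (+-identityʳ r)))))))
      back : Path arcs (len q) (at q) (end (side q))
      back = Path-reverse sy (walk okq)
      ahead : Path arcs (suc e + f) (at q) (end (1 ∸ side q))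
      ahead = Path-++ p pf
      le′ : len q + (suc e + f) ≤ d
      le′ = ≤-trans (≤-reflexive (sym (+-assoc (len q) (suc e) f))) le
      -- The way behind and the way ahead lead to the two query vertices, in an order that depends
      -- on the side. Together they measure at most `d`, and the detour adds at most `e₁` to each.
      blocked : ∀ sd → sd ≡ side q → ∀ {ρ} → D (addr n 0 3 (at q)) ≡ suc ρ →
        (∀ {z j} → z < n → Path arcs j (at q) z → ∃[ e ] (e ≤ e₁ + j × D (addr n 1 ρ z) ≡ suc e)) → AtMost (vars s 5) (d + 2 * r)
      blocked zero sd≡ near≡ far = atMost-mono (rest {len q} {suc e + f} le′)
        (pivot-detour q∈ near≡ refl far (subst (λ z → Path arcs (len q) (at q) (end z)) (sym sd≡) back)
          (subst (λ z → Path arcs (suc e + f) (at q) (end (1 ∸ z))) (sym sd≡) ahead))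
      blocked (suc zero) sd≡ near≡ far = atMost-mono (rest {suc e + f} {len q} (≤-trans (≤-reflexive (+-comm (suc e + f) (len q))) le′))
        (pivot-detour q∈ near≡ refl far (subst (λ z → Path arcs (suc e + f) (at q) (end (1 ∸ z))) (sym sd≡) ahead)
          (subst (λ z → Path arcs (len q) (at q) (end z)) (sym sd≡) back))
      blocked (suc (suc _)) sd≡ = contradiction (subst (_≤ 1) (sym sd≡) (side≤1 okq)) λ { (s≤s ()) }
      advance : (∃[ x ] (Path arcs e₁ (at q) x × Path arcs e₂ x y)) → Result
      advance (x , p₁ , p₂) with positive (r≥1 (≤-trans (s≤s z≤n) (≤-trans (m≤n+m (suc e) (len q)) (≤-trans (m≤m+n _ f) le))))
      ... | e′ , e₁≡ with complete (at<n okq) (subst (λ k → Path arcs k (at q) x) e₁≡ p₁)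
      ...   | inj₂ (ρ , near≡ , _ , far) = inj₁ (blocked (side q) refl near≡
                (subst (λ k → ∀ {z j} → z < n → Path arcs j (at q) z → ∃[ e ] (e ≤ k + j × D (addr n 1 ρ z) ≡ suc e)) (sym e₁≡) far))
      ...   | inj₁ (k , k≤ , b∈) with chain r≥1 j {probe (side q) x (len q + k) j} {y} {e₂} {f}
                (Visited.children (All.lookup visited q∈) l≡ (∈-sel⁺ vtx b∈ refl)) refl p₂ e₂≤ pf
                (≤-trans (+-monoˡ-≤ f reach) le)
        where
        reach : len q + k + e₂ ≤ len q + suc e
        reach = ≤-trans (≤-reflexive (+-assoc (len q) k e₂)) (+-monoʳ-≤ (len q) (≤-trans (+-monoˡ-≤ e₂ (≤-trans k≤ (≤-reflexive (sym e₁≡)))) (≤-reflexive e≡)))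
      ...     | inj₁ done = inj₁ done
      ...     | inj₂ (q′ , q′∈ , sd≡ , at≡ , len≤) = inj₂ (q′ , q′∈ , sd≡ , at≡ , ≤-trans len≤
                (≤-trans (≤-reflexive (+-assoc (len q) k e₂)) (+-monoʳ-≤ (len q) (≤-trans (+-monoˡ-≤ e₂ (≤-trans k≤ (≤-reflexive (sym e₁≡)))) (≤-reflexive e≡)))))

    -- The path is cut at length `t * r` or at its end, so each part can be covered by `t` hops of
    -- length at most `r`. If no pivot intervenes, both chains end at the cut vertex `y`, and
    -- `meets` adds their lengths to at most `d`.
    estimate-complete : ∀ {d r} → (1 ≤ d → 1 ≤ r) → d ≤ t * r + t * r → Path arcs d u v → AtMost (vars s 5) (d + 2 * r)
    estimate-complete {d} {r} r≥1 d≤ p with Path-split (t * r ⊓ d) (subst (λ k → Path arcs k u v) (sym (m⊓n+n∸m≡n (t * r) d)) p)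
    ... | y , p₁ , p₂ with chain {d} r≥1 t from-u refl p₁ (m⊓n≤m (t * r) d) p₂ (≤-reflexive (m⊓n+n∸m≡n (t * r) d))
                         | chain {d} r≥1 t from-v refl (Path-reverse sy p₂) (m≤n+o⇒m∸n≤o d (t * r) d≤) (Path-reverse sy p₁)
                             (≤-reflexive (trans (+-comm (d ∸ t * r) _) (m⊓n+n∸m≡n (t * r) d)))
    ...   | inj₁ done | _ = done
    ...   | inj₂ _ | inj₁ done = done
    ...   | inj₂ (probe .0 .y a _ , q∈ , refl , refl , a≤) | inj₂ (probe .1 .y b _ , q′∈ , refl , refl , b≤)
      with Visited.reached (All.lookup visited q∈) | Visited.reached (All.lookup visited q′∈)
    ...     | a′ , a′≤ , a≡ | b′ , b′≤ , b≡ = atMost-mono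
      (≤-trans (+-mono-≤ (≤-trans a′≤ a≤) (≤-trans b′≤ b≤)) (≤-trans (≤-reflexive (m⊓n+n∸m≡n (t * r) d)) (m≤m+n d _)))
      (meets y a′ b′ (at<n (All.lookup okay q∈)) a≡ b≡)

module Launch (w n : ℕ) (n≥1 : 1 ≤ n) (room : 64 * (n * (n * n)) ≤ 2 ^ w)
  (κ : ℕ) (κ≥1 : 1 ≤ κ) (κ≤n : κ ≤ n) (R : ℕ) (R≤n : R ≤ n)
  (arcs : List (ℕ × ℕ)) (sy : ∀ {y z} → (y , z) ∈ arcs → (z , y) ∈ arcs)
  (D : ℕ → ℕ) (header : D 0 ≡ n) (table : Table n κ R arcs D)
  (u v : ℕ) (u<n : u < n) (v<n : v < n) (t : ℕ)
  (room-len : 8 * (suc t * (n * n)) ≤ 2 ^ w) (room-count : 2 * (3 * κ) ^ t < 2 ^ w) where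

  open Words w n n≥1 room
  open Query w n n≥1 room κ κ≥1 κ≤n R R≤n arcs sy D table u v u<n v<n t room-len room-count

  record Asked (s : State) : Set where
    field
      asked-u    : vars s 0 ≡ u
      asked-v    : vars s 1 ≡ v
      fresh-var  : ∀ x → 2 ≤ x → vars s x ≡ 0
      structure  : arrays s 0 ≡ D
      fresh-cell : ∀ a i → 1 ≤ a → arrays s a i ≡ 0

  -- `accurate` holds for every `r` at once, since the program does not depend on it. The rounded
  -- quotient gives the stretch, and a large `r` shows that connected vertices receive a finite
  -- estimate.
  record Answered (s : State) : Set where
    field
      {best}   : ℕ
      result   : vars s 0 ≡ best
      a-walk   : ∀ {e} → best ≡ suc e → Path arcs e u v
      accurate : ∀ {d r} → (1 ≤ d → 1 ≤ r) → d ≤ t * r + t * r → Path arcs d u v → AtMost best (d + 2 * r)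

  query-time : ℕ
  query-time = suc (9 + suc (3 + suc (suc (37 * (2 * (3 * κ) ^ t)) + 1)))

  querying-run : ∀ {s} → Asked s → Run w (querying t) s query-time Answered
  querying-run {s} A =
    call⨟ {P = λ s₁ → vars s₁ 2 ≡ n × vars s₁ 3 ≡ 2 × (arrays s₁ 1 1 ≡ 1 × arrays s₁ 1 0 ≡ 0) × (arrays s₁ 2 1 ≡ v × arrays s₁ 2 0 ≡ u)}
      (asg⨟ (ev-get ev-zero (trans (cong-app structure 0) header))
      (put⨟ ev-one ev-one
      (put⨟ ev-zero (ev-var asked-u)
      (put⨟ ev-one (ev-var asked-v)
      (asg (ev-const 2 (m≤m+n 3 61)) (refl , refl , (refl , fresh-cell 1 0 ≤-refl) , (refl , refl)))))))
    λ s₁ V₁ A₁ (h₂ , h₃ , (sd₁ , sd₀) , (at₁ , at₀)) →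
    call⨟ {P = λ s₂ → arrays s₂ 4 1 ≡ t × arrays s₂ 4 0 ≡ t}
      (put⨟ ev-zero (ev-lit t<) (put-run ev-one (ev-lit t<) (refl , refl)))
    λ s₂ V₂ A₂ (lv₁ , lv₀) →
    call⨟ (explore-run (record
      { new = G₀ ; old = [] ; G = G₀ ; split = refl
      ; base = record { q₀ = trans (V₂ 0 refl) (trans (V₁ 0 refl) asked-u) ; q₁ = trans (V₂ 1 refl) (trans (V₁ 1 refl) asked-v)
                      ; q₂ = trans (V₂ 2 refl) h₂ ; qD = trans (A₂ 0 refl) (trans (A₁ 0 refl) structure) }
      ; probes = record
          { sides = trans (cong-app (A₂ 1 refl) 1) sd₁ , trans (cong-app (A₂ 1 refl) 0) sd₀ , tt
          ; ats = trans (cong-app (A₂ 2 refl) 1) at₁ , trans (cong-app (A₂ 2 refl) 0) at₀ , tt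
          ; lens = zeros {s₁} {s₂} V₁ A₁ V₂ A₂ 3 1 (m≤m+n 1 2) refl refl , zeros {s₁} {s₂} V₁ A₁ V₂ A₂ 3 0 (m≤m+n 1 2) refl refl , tt
          ; lvls = lv₁ , lv₀ , tt
          ; tail = trans (V₂ 3 refl) h₃ }
      ; head = trans (V₂ 4 refl) (trans (V₁ 4 refl) (fresh-var 4 (m≤m+n 2 2)))
      ; okay = record { side≤1 = ≤-refl ; at<n = v<n ; walk = nil ; short = ≤-refl }
             ∷ record { side≤1 = z≤n ; at<n = u<n ; walk = nil ; short = ≤-refl } ∷ []
      ; walks = λ _ _ e≡ → contradiction (trans (sym e≡) (zeros {s₁} {s₂} V₁ A₁ V₂ A₂ 5 _ (m≤m+n 1 4) refl refl)) λ ()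
      ; found = λ e≡ → contradiction (trans (sym e≡) (trans (V₂ 5 refl) (trans (V₁ 5 refl) (fresh-var 5 (m≤m+n 2 3))))) λ ()
      ; meets = λ _ _ _ _ a≡ _ → contradiction (trans (sym a≡) (zeros {s₁} {s₂} V₁ A₁ V₂ A₂ 5 _ (m≤m+n 1 4) refl refl)) λ ()
      ; visited = [] ; from-u = there (here refl) ; from-v = here refl
      ; budget = ≤-refl ; spent = ≤-refl }))
    λ s₃ V₃ A₃ E →
    asg (ev-var refl) (record { result = refl ; a-walk = Explored.found E ; accurate = estimate-complete E })
    where
    open Asked A
    G₀ : List Probe
    G₀ = probe 1 v 0 t ∷ probe 0 u 0 t ∷ []
    t< : t < 2 ^ w
    t< = fit-len (≤-trans (≤-trans (n≤1+n t) (≤-trans (≤-reflexive (sym (*-identityʳ (suc t)))) (*-monoʳ-≤ (suc t) n²≥1))) (m≤m+n _ _))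
    zeros : ∀ {s₁ s₂} → FrameV launch s s₁ → FrameA launch s s₁ → FrameV (launch-levels t) s₁ s₂ → FrameA (launch-levels t) s₁ s₂ →
      ∀ a i → 1 ≤ a → modA launch a ≡ false → modA (launch-levels t) a ≡ false → arrays s₂ a i ≡ 0
    zeros V₁ A₁ V₂ A₂ a i a≥1 m₁ m₂ = trans (cong-app (A₂ a m₂) i) (trans (cong-app (A₁ a m₁) i) (fresh-cell a i a≥1))

-- Real exponents

cut-< : ∀ (c : ℝ) {p q} → L c p → U c q → p ℚ.< q
cut-< c {p} {q} p<c c<q with ℚ.<-cmp p q
... | tri< p<q _ _    = p<q
... | tri≈ _ refl _   = contradiction c<q (ℝ.disjoint c p<c)
... | tri> _ _ q<p    = contradiction (ℝ.U-up c q<p c<q) (ℝ.disjoint c p<c)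

fraction-< : ∀ j a b a′ b′ .{{_ : NonZero b}} .{{_ : NonZero b′}} →
  (ℤ.+ j ℚ./ 1) ℚ.- (ℤ.+ a ℚ./ b) ℚ.< ℤ.+ a′ ℚ./ b′ → j * (b′ * b) < a′ * b + a * b′
fraction-< j a (suc b) a′ (suc b′) l< = to-ℕ (ℚᵘ.drop-*<* moved)
  where
  p q r : ℚ
  p = ℤ.+ j ℚ./ 1
  q = ℤ.+ a ℚ./ suc b
  r = ℤ.+ a′ ℚ./ suc b′
  cancel : (p ℚ.- q) ℚ.+ q ≡ p
  cancel = trans (ℚ.+-assoc p (ℚ.- q) q) (trans (cong (p ℚ.+_) (ℚ.+-inverseˡ q)) (ℚ.+-identityʳ p))
  moved : mkℚᵘ (ℤ.+ j) 0 ℚᵘ.< mkℚᵘ (ℤ.+ a′) b′ ℚᵘ.+ mkℚᵘ (ℤ.+ a) b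
  moved = ℚᵘ.<-respˡ-≃ (ℚ.toℚᵘ-fromℚᵘ (mkℚᵘ (ℤ.+ j) 0))
    (ℚᵘ.<-respʳ-≃ (ℚᵘ.≃-trans (ℚ.toℚᵘ-homo-+ r q) (ℚᵘ.+-cong (ℚ.toℚᵘ-fromℚᵘ (mkℚᵘ (ℤ.+ a′) b′)) (ℚ.toℚᵘ-fromℚᵘ (mkℚᵘ (ℤ.+ a) b))))
      (ℚ.toℚᵘ-mono-< (subst (ℚ._< r ℚ.+ q) cancel (ℚ.+-monoˡ-< q l<))))
  to-ℕ : (ℤ.+ j) ℤ.* (ℤ.+ (suc b′ * suc b)) ℤ.< ((ℤ.+ a′) ℤ.* (ℤ.+ suc b) ℤ.+ (ℤ.+ a) ℤ.* (ℤ.+ suc b′)) ℤ.* (ℤ.+ 1) →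
    j * (suc b′ * suc b) < a′ * suc b + a * suc b′
  to-ℕ z< = ℤ.drop‿+<+ (subst₂ ℤ._<_ (sym (ℤ.pos-* j (suc b′ * suc b)))
    (trans (ℤ.*-identityʳ _) (sym (trans (ℤ.pos-+ (a′ * suc b) (a * suc b′)) (cong₂ ℤ._+_ (ℤ.pos-* a′ (suc b)) (ℤ.pos-* a (suc b′)))))) z<)

fraction-* : ∀ a b t .{{_ : NonZero b}} .{{_ : NonZero t}} →
  (ℤ.+ a ℚ./ b) ℚ.* (ℤ.+ 1 ℚ./ t) ≡ ℚ._/_ (ℤ.+ a) (b * t) {{m*n≢0 b t}}
fraction-* a (suc b) (suc t) = ℚ.toℚᵘ-injective
  (ℚᵘ.≃-trans (ℚ.toℚᵘ-homo-* (ℤ.+ a ℚ./ suc b) (ℤ.+ 1 ℚ./ suc t))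
  (ℚᵘ.≃-trans (ℚᵘ.*-cong (ℚ.toℚᵘ-fromℚᵘ (mkℚᵘ (ℤ.+ a) b)) (ℚ.toℚᵘ-fromℚᵘ (mkℚᵘ (ℤ.+ 1) t)))
  (ℚᵘ.≃-trans (*≡* (cong (ℤ._* (ℤ.+ (suc b * suc t))) (ℤ.*-identityʳ (ℤ.+ a))))
    (ℚᵘ.≃-sym (ℚ.toℚᵘ-fromℚᵘ (mkℚᵘ (ℤ.+ a) (t + b * suc t)))))))

^-distribʳ-* : ∀ k x y → (x * y) ^ k ≡ x ^ k * y ^ k
^-distribʳ-* zero    x y = refl
^-distribʳ-* (suc k) x y = trans (cong (x * y *_) (^-distribʳ-* k x y)) ([m*n]*[o*p]≡[m*o]*[n*p] x y (x ^ k) (y ^ k))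

root-≤ : ∀ {x y} k .{{_ : NonZero k}} → x ^ k ≤ y ^ k → x ≤ y
root-≤ {x} {y} k le with x ≤? y
... | yes x≤y = x≤y
... | no ¬x≤y = contradiction le (<⇒≱ (^-monoˡ-< k (≰⇒> ¬x≤y)))

^-comm-exp : ∀ x j k → (x ^ j) ^ k ≡ (x ^ k) ^ j
^-comm-exp x j k = trans (^-*-assoc x j k) (trans (cong (x ^_) (*-comm j k)) (sym (^-*-assoc x k j)))

-- Division by n ^ c. The hypothesis on `κ` supplies a′/b′ above c with n ^ a′ < (2κ) ^ b′, and the
-- exponent a/b satisfies j - a/b < c < a′/b′. Raise the integer inequality to the power b · b′,
-- trade the powers of 2κ for powers of n, compare exponents by j · b′ · b < a′ · b + a · b′, cancel
-- n ^ (a′ · b), and take the root of order b′.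
≤-divide : ∀ (c : ℝ) {n κ x y} j → 1 ≤ n → n ^ᵉ U c < (2 * κ) → x * (2 * κ) ≤ y * n ^ j → x ≤ y · n ^ᵉ (j −ᵉ c)
≤-divide c {n} {κ} {x} {y} j n≥1 (a′ , b′ , nz , c<q , n<) le a b p<c =
  root-≤ b′ {{nz}} (*-cancelʳ-≤ ((x ^ b) ^ b′) ((y ^ b * n ^ a) ^ b′) (n ^ (a′ * b)) {{>-nonZero (m^n>0 n {{>-nonZero n≥1}} (a′ * b))}} (begin
    (x ^ b) ^ b′ * n ^ (a′ * b)             ≤⟨ *-monoʳ-≤ ((x ^ b) ^ b′) (≤-trans (≤-reflexive (sym (^-*-assoc n a′ b))) (^-monoˡ-≤ b (<⇒≤ n<))) ⟩
    (x ^ b) ^ b′ * ((2 * κ) ^ b′) ^ b       ≡⟨ cong ((x ^ b) ^ b′ *_) (^-comm-exp (2 * κ) b′ b) ⟩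
    (x ^ b) ^ b′ * ((2 * κ) ^ b) ^ b′       ≡⟨ trans (sym (^-distribʳ-* b′ (x ^ b) ((2 * κ) ^ b))) (cong (_^ b′) (sym (^-distribʳ-* b x (2 * κ)))) ⟩
    ((x * (2 * κ)) ^ b) ^ b′                ≤⟨ ^-monoˡ-≤ b′ (^-monoˡ-≤ b le) ⟩
    ((y * n ^ j) ^ b) ^ b′                  ≡⟨ trans (cong (_^ b′) (^-distribʳ-* b y (n ^ j))) (^-distribʳ-* b′ (y ^ b) ((n ^ j) ^ b)) ⟩
    (y ^ b) ^ b′ * ((n ^ j) ^ b) ^ b′       ≡⟨ cong ((y ^ b) ^ b′ *_) (trans (cong (_^ b′) (^-*-assoc n j b)) (trans (^-*-assoc n (j * b) b′) (cong (n ^_) (trans (*-assoc j b b′) (cong (j *_) (*-comm b b′)))))) ⟩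
    (y ^ b) ^ b′ * n ^ (j * (b′ * b))       ≤⟨ *-monoʳ-≤ ((y ^ b) ^ b′) (^-monoʳ-≤ n {{>-nonZero n≥1}} (<⇒≤ (fraction-< j a b a′ b′ {{it}} {{nz}} (cut-< c p<c c<q)))) ⟩
    (y ^ b) ^ b′ * n ^ (a′ * b + a * b′)    ≡⟨ cong ((y ^ b) ^ b′ *_) (trans (cong (n ^_) (+-comm (a′ * b) (a * b′))) (^-distribˡ-+-* n (a * b′) (a′ * b))) ⟩
    (y ^ b) ^ b′ * (n ^ (a * b′) * n ^ (a′ * b)) ≡⟨ *-assoc ((y ^ b) ^ b′) (n ^ (a * b′)) (n ^ (a′ * b)) ⟨
    (y ^ b) ^ b′ * n ^ (a * b′) * n ^ (a′ * b)   ≡⟨ cong (λ z → (y ^ b) ^ b′ * z * n ^ (a′ * b)) (^-*-assoc n a b′) ⟨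
    (y ^ b) ^ b′ * (n ^ a) ^ b′ * n ^ (a′ * b)   ≡⟨ cong (_* n ^ (a′ * b)) (^-distribʳ-* b′ (y ^ b) (n ^ a)) ⟨
    (y ^ b * n ^ a) ^ b′ * n ^ (a′ * b)          ∎))
  where open ≤-Reasoning

-- A rational a/b lies above c · t in the sense of `_·ᵉ_` when a/(b · t) lies above c; so the bound
-- on `κ` is used with denominator `b * t`.
≤-power : ∀ (c : ℝ) t .{{_ : NonZero t}} {n κ x y} → κ ≤ 1 · n ^ᵉ U c → x ≤ y * κ ^ t → x ≤ y · n ^ᵉ (c ·ᵉ t)
≤-power c t {n} {κ} {x} {y} κ≤ le a b c<p = begin
  x ^ b                  ≤⟨ ^-monoˡ-≤ b le ⟩
  (y * κ ^ t) ^ b        ≡⟨ ^-distribʳ-* b y (κ ^ t) ⟩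
  y ^ b * (κ ^ t) ^ b    ≡⟨ cong (y ^ b *_) (trans (^-*-assoc κ t b) (cong (κ ^_) (*-comm t b))) ⟩
  y ^ b * κ ^ (b * t)    ≤⟨ *-monoʳ-≤ (y ^ b) (κ≤ a (b * t) {{m*n≢0 b t}} (subst (U c) (fraction-* a b t) c<p)) ⟩
  y ^ b * (1 ^ (b * t) * n ^ a) ≡⟨ cong (y ^ b *_) (trans (cong (_* n ^ a) (^-zeroˡ (b * t))) (*-identityˡ (n ^ a))) ⟩
  y ^ b * n ^ a          ∎
  where open ≤-Reasoning

-- One half is itself a rational above `c`, so it may be inserted into the defining bound of `κ`. In
-- this form c < 1/2 makes the first flood as cheap as the second.
κ²≤n : ∀ (c : ℝ) {n κ} → c <ʳ ½ → κ ≤ 1 · n ^ᵉ U c → κ * κ ≤ n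
κ²≤n c {n} {κ} c<½ κ≤ = subst₂ _≤_ (cong (κ *_) (*-identityʳ κ)) (trans (*-identityˡ (n ^ 1)) (*-identityʳ n)) (κ≤ 1 2 c<½)

κ≥1 : ∀ (c : ℝ) {n κ} → n ^ᵉ U c < (2 * κ) → 1 ≤ κ
κ≥1 c {n} {suc κ} _ = s≤s z≤n
κ≥1 c {n} {zero} (a , suc b , _ , _ , ())

-- Outputs and determinism of runs

lookupOr-map : ∀ {f : ℕ → ℕ} {z} (g : ℕ → ℕ) len {i} → i < len → lookupOr z (map f (applyUpTo g len)) i ≡ f (g i)
lookupOr-map g (suc len) {zero}  _       = refl
lookupOr-map g (suc len) {suc i} (s≤s i<) = lookupOr-map (λ k → g (suc k)) len i<

cells-output : ∀ s {i} → i < vars s 0 → cells (output s) i ≡ arrays s 2 i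
cells-output s i< = lookupOr-map (λ i → i) (vars s 0) i<

run-halted : ∀ w k s → run w k ([] , s) ≡ ([] , s)
run-halted w zero    s = refl
run-halted w (suc k) s = run-halted w k s

halted-+ : ∀ {w C s} τ k → run w τ C ≡ ([] , s) → run w (τ + k) C ≡ ([] , s)
halted-+ {w} {C} {s} τ k e≡ = trans (run-+ w τ k C) (trans (cong (run w k) e≡) (run-halted w k s))

-- Both runs, prolonged to τ + τ′ steps, are the same run. `Constructs` speaks of an arbitrary
-- halting run, and this identifies it with the analysed one.
halted-unique : ∀ {w C s s′} τ τ′ → run w τ C ≡ ([] , s) → run w τ′ C ≡ ([] , s′) → s ≡ s′
halted-unique {w} {C} τ τ′ e≡ e≡′ = cong proj₂ (trans (sym (halted-+ {w} {C} τ τ′ e≡)) (trans (cong (λ k → run w k C) (+-comm τ τ′)) (halted-+ {w} {C} τ′ τ e≡′)))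

count-zero : ∀ τ {P : Vec Bool τ → Bool} → (∀ ω → P ω ≡ false) → count τ P ≡ 0
count-zero zero    none = cong bit (none [])
count-zero (suc τ) none = cong₂ _+_ (count-zero τ (λ ω → none (false ∷ ω))) (count-zero τ (λ ω → none (true ∷ ω)))

-- Walks of the graph as paths over numbered arcs

module Translation {n : ℕ} (G : Graph n) where

  endpoints : Fin n × Fin n → ℕ × ℕ
  endpoints (a , b) = toℕ a , toℕ b

  es : List (ℕ × ℕ)
  es = map endpoints (edges G)

  es-< : All (λ e → proj₁ e < n × proj₂ e < n) es
  es-< = AllP.map⁺ (All.tabulate λ {e} _ → toℕ<n (proj₁ e) , toℕ<n (proj₂ e))

  lookup-injective : ∀ {A : Set} {xs : List A} → Unique xs → ∀ {i j} → lookup xs i ≡ lookup xs j → i ≡ j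
  lookup-injective (_ ∷ _)   {Fin.zero}  {Fin.zero}  _  = refl
  lookup-injective (x≢ ∷ _)  {Fin.zero}  {Fin.suc j} e≡ = contradiction e≡ (All.lookup x≢ (∈-lookup j))
  lookup-injective (x≢ ∷ _)  {Fin.suc i} {Fin.zero}  e≡ = contradiction (sym e≡) (All.lookup x≢ (∈-lookup i))
  lookup-injective (_ ∷ uxs) {Fin.suc i} {Fin.suc j} e≡ = cong Fin.suc (lookup-injective uxs e≡)

  es-few : length es ≤ n * n
  es-few = ≤-trans (≤-reflexive (length-map endpoints (edges G))) (injective⇒≤ {f = code} code-injective)
    where
    code : Fin (length (edges G)) → Fin (n * n)
    code i = combine (proj₁ (lookup (edges G) i)) (proj₂ (lookup (edges G) i))
    code-injective : ∀ {i j} → code i ≡ code j → i ≡ j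
    code-injective {i} {j} e≡ with combine-injective (proj₁ (lookup (edges G) i)) _ (proj₁ (lookup (edges G) j)) _ e≡
    ... | e₁ , e₂ = lookup-injective (unique G) (cong₂ _,_ e₁ e₂)

  edge⇒arcs : ∀ xs {a b} → (a , b) ∈ xs → (toℕ a , toℕ b) ∈ arcsOf (map endpoints xs) × (toℕ b , toℕ a) ∈ arcsOf (map endpoints xs)
  edge⇒arcs (_ ∷ xs) (here refl) = there (here refl) , here refl
  edge⇒arcs (_ ∷ xs) (there e∈)  = there (there (proj₁ (edge⇒arcs xs e∈))) , there (there (proj₂ (edge⇒arcs xs e∈)))

  arc⇒edge : ∀ xs {y z} → (y , z) ∈ arcsOf (map endpoints xs) →
    ∃[ a ] ∃[ b ] (toℕ a ≡ y × toℕ b ≡ z × ((a , b) ∈ xs ⊎ (b , a) ∈ xs))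
  arc⇒edge ((a , b) ∷ xs) (here refl)         = b , a , refl , refl , inj₂ (here refl)
  arc⇒edge ((a , b) ∷ xs) (there (here refl)) = a , b , refl , refl , inj₁ (here refl)
  arc⇒edge (_ ∷ xs) (there (there e∈)) with arc⇒edge xs e∈
  ... | a , b , a≡ , b≡ , inj₁ ab∈ = a , b , a≡ , b≡ , inj₁ (there ab∈)
  ... | a , b , a≡ , b≡ , inj₂ ba∈ = a , b , a≡ , b≡ , inj₂ (there ba∈)

  walk⇒path : ∀ {l a b} → Walk G l a b → Path (arcsOf es) l (toℕ a) (toℕ b)
  walk⇒path here = nil
  walk⇒path (step (inj₁ ab∈) p) = cons (proj₁ (edge⇒arcs (edges G) ab∈)) (walk⇒path p)
  walk⇒path (step (inj₂ ba∈) p) = cons (proj₂ (edge⇒arcs (edges G) ba∈)) (walk⇒path p)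

  path⇒walk : ∀ {l y z} → Path (arcsOf es) l y z → ∀ {a b} → toℕ a ≡ y → toℕ b ≡ z → Walk G l a b
  path⇒walk nil a≡ b≡ with toℕ-injective (trans a≡ (sym b≡))
  ... | refl = here
  path⇒walk (cons e p) a≡ b≡ with arc⇒edge (edges G) e
  ... | a′ , c , a′≡ , c≡ , adj with toℕ-injective (trans a≡ (sym a′≡))
  ...   | refl = step adj (path⇒walk p c≡ b≡)

  adjacent? : ∀ a b → Dec (Adjacent G a b)
  adjacent? a b = ((a , b) ∈? edges G) ⊎-dec ((b , a) ∈? edges G)
    where open import Data.List.Membership.DecPropositional (≡-dec (Data.Fin.Properties._≟_ {n}) (Data.Fin.Properties._≟_ {n})) using (_∈?_)

  walk? : ∀ l a b → Dec (Walk G l a b)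
  walk? zero a b with a Data.Fin.Properties.≟ b
  ... | yes refl = yes here
  ... | no a≢b   = no λ { here → a≢b refl }
  walk? (suc l) a b with any? (λ c → adjacent? a c ×-dec walk? l c b)
  ... | yes (c , adj , p) = yes (step adj p)
  ... | no none           = no λ { (step adj p) → none (_ , adj , p) }

  -- Whether a walk of given length exists is decidable, so a least length can be found
  -- constructively by descending from any walk. `k` only makes the descent structural.
  shortest : ∀ {a b} k l → l ≤ k → Walk G l a b → ∃[ d ] (IsDistance G a b d × d ≤ l)
  shortest {a} {b} k l l≤k p with anyUpTo? (λ j → walk? j a b) l
  ... | no none = l , (p , λ j q → ≮⇒≥ λ j<l → none (j , j<l , q)) , ≤-refl
  shortest zero    zero _   p | yes (j , () , q)
  shortest (suc k) l    l≤k p | yes (j , j<l , q) with shortest k j (s≤s⁻¹ (≤-trans j<l l≤k)) q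
  ... | d , dist , d≤j = d , dist , ≤-trans d≤j (<⇒≤ j<l)

-- Rounding, word size and the final bounds

half-steps : ∀ t .{{_ : NonZero t}} d → d ≤ t * ⌈ d /2 t ⌉ + t * ⌈ d /2 t ⌉
-- With `2 * t ∸ 1` added, `r` is an ordinary quotient by `2 * t`, and its remainder is at most the
-- amount added.
half-steps t d = +-cancelʳ-≤ (2 * t ∸ 1) d (t * r + t * r) (begin
  d + (2 * t ∸ 1)                          ≡⟨ m≡m%n+[m/n]*n (d + (2 * t ∸ 1)) (2 * t) {{m*n≢0 2 t}} ⟩
  _%_ (d + (2 * t ∸ 1)) (2 * t) {{m*n≢0 2 t}} + r * (2 * t)
    ≤⟨ +-monoˡ-≤ (r * (2 * t)) (≤-pred′ (m%n<n (d + (2 * t ∸ 1)) (2 * t) {{m*n≢0 2 t}})) ⟩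
  2 * t ∸ 1 + r * (2 * t)                  ≡⟨ trans (+-comm (2 * t ∸ 1) _) (cong (_+ (2 * t ∸ 1)) (trans (*-comm r (2 * t)) (trans (*-assoc 2 t r) (cong (t * r +_) (+-identityʳ (t * r)))))) ⟩
  t * r + t * r + (2 * t ∸ 1)              ∎)
  where
  open ≤-Reasoning
  r : ℕ
  r = ⌈ d /2 t ⌉
  ≤-pred′ : ∀ {a b} → a < b → a ≤ b ∸ 1
  ≤-pred′ (s≤s le) = le

ceiling≥1 : ∀ t .{{_ : NonZero t}} d → 1 ≤ d → 1 ≤ ⌈ d /2 t ⌉
ceiling≥1 t d d≥1 with ⌈ d /2 t ⌉ | half-steps t d
... | suc r | _  = s≤s z≤n
... | zero  | d≤ = contradiction (≤-trans d≥1 (≤-trans d≤ (≤-reflexive (cong₂ _+_ (*-zeroʳ t) (*-zeroʳ t))))) λ ()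

n<2^[1+log] : ∀ n → n < 2 ^ (1 + ⌈log₂ n ⌉)
n<2^[1+log] n with 2 ^ (1 + ⌈log₂ n ⌉) ≤? n
... | no ¬le = ≰⇒> ¬le
... | yes le = contradiction (≤-trans (≤-reflexive (sym (⌈log₂2^n⌉≡n (1 + ⌈log₂ n ⌉)))) (⌈log₂⌉-mono-≤ le)) (<⇒≱ ≤-refl)

suc-≤2^ : ∀ t → suc t ≤ 2 ^ t
suc-≤2^ zero    = ≤-refl
suc-≤2^ (suc t) = ≤-trans (s≤s (suc-≤2^ t)) (≤-trans (+-monoˡ-≤ (2 ^ t) (m^n>0 2 t)) (≤-reflexive (cong (2 ^ t +_) (sym (+-identityʳ (2 ^ t))))))

estimate-zero : ∀ s → vars s 0 ≡ 0 → estimate s ≡ nothing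
estimate-zero s e≡ with vars s 0
estimate-zero s refl | .0 = refl

estimate-suc : ∀ s {e} → vars s 0 ≡ suc e → estimate s ≡ just e
estimate-suc s e≡ with vars s 0
estimate-suc s refl | .(suc _) = refl

-- With M = 2 ^ (1 + ⌈log₂ n⌉) above n, a word holds M ^ (9 + 3t) values. Here 64 n³ is at most M ^
-- (6 + 3), and the 3t are for the (3κ) ^ t probes of a query.
oracle : ℕ → Oracle
oracle t = record { preprocess = preprocessing ; query = querying t ; wordFactor = 9 + 3 * t }

module Final (t : ℕ) .{{t≢0 : NonZero t}} (c : ℝ) (c<½ : c <ʳ ½) (I : Instance c) where

  N K r₀ w : ℕ
  N = n I
  K = κ I
  r₀ = 1 + ⌈log₂ N ⌉
  w = wordSize (oracle t) I

  open Translation (graph I)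

  N≥1 : 1 ≤ N
  N≥1 = Instance.n≥1 I

  K≥1 : 1 ≤ K
  K≥1 = κ≥1 c (Instance.κ-upper I)

  K*K≤N : K * K ≤ N
  K*K≤N = κ²≤n c c<½ (Instance.κ-lower I)

  K≤N : K ≤ N
  K≤N = ≤-trans (m≤m*n K K {{>-nonZero K≥1}}) K*K≤N

  M : ℕ
  M = 2 ^ r₀

  N<M : N < M
  N<M = n<2^[1+log] N

  2≤M : 2 ≤ M
  2≤M = *-monoʳ-≤ 2 (m^n>0 2 ⌈log₂ N ⌉)

  instance
    M≢0 : NonZero M
    M≢0 = >-nonZero (≤-trans (n≤1+n 1) 2≤M)

  2^w≡ : 2 ^ w ≡ M ^ (9 + 3 * t)
  2^w≡ = trans (cong (2 ^_) (*-comm (9 + 3 * t) r₀)) (sym (^-*-assoc 2 r₀ (9 + 3 * t)))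

  ^-⊗ : ∀ {a b i j} → a ≤ M ^ i → b ≤ M ^ j → a * b ≤ M ^ (i + j)
  ^-⊗ {i = i} {j} p q = ≤-trans (*-mono-≤ p q) (≤-reflexive (sym (^-distribˡ-+-* M i j)))

  N≤M¹ : N ≤ M ^ 1
  N≤M¹ = ≤-trans (<⇒≤ N<M) (≤-reflexive (sym (*-identityʳ M)))

  2^-≤ : ∀ k → 2 ^ k ≤ M ^ k
  2^-≤ k = ^-monoˡ-≤ k 2≤M

  room : 64 * (N * (N * N)) ≤ 2 ^ w
  room = subst (64 * (N * (N * N)) ≤_) (sym 2^w≡)
    (≤-trans (^-⊗ {i = 6} {3} (2^-≤ 6) (^-⊗ {i = 1} {2} N≤M¹ (^-⊗ {i = 1} {1} N≤M¹ N≤M¹))) (^-monoʳ-≤ M (m≤m+n 9 (3 * t))))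

  room-len : 8 * (suc t * (N * N)) ≤ 2 ^ w
  room-len = subst (8 * (suc t * (N * N)) ≤_) (sym 2^w≡)
    (≤-trans (^-⊗ {i = 3} {t + 2} (2^-≤ 3) (^-⊗ {i = t} {2} (≤-trans (suc-≤2^ t) (2^-≤ t)) (^-⊗ {i = 1} {1} N≤M¹ N≤M¹)))
      (^-monoʳ-≤ M (≤-trans (≤-reflexive (cong (3 +_) (+-comm t 2))) (+-mono-≤ {5} {9} (m≤m+n 5 4) (m≤m+n t _)))))

  room-count : 2 * (3 * K) ^ t < 2 ^ w
  room-count = subst (2 * (3 * K) ^ t <_) (sym 2^w≡)
    (≤-<-trans (^-⊗ {i = 1} {3 * t} (2^-≤ 1) (≤-trans (^-monoˡ-≤ t (^-⊗ {i = 2} {1} (≤-trans (m≤m+n 3 1) (2^-≤ 2)) (≤-trans K≤N N≤M¹))) (≤-reflexive (^-*-assoc M 3 t))))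
      (^-monoʳ-< M 2≤M (+-monoˡ-≤ (3 * t) (m≤m+n 2 7))))

  open Preprocess w N N≥1 room es es-< es-few K K≥1 K≤N r₀ N<M using (Start; Built; module Built; Rmax; pre-time; preprocessing-run; sy) public
  open EdgesRun w N N≥1 room es es-< es-few K K≥1 K≤N using (arcs)

  start : ∀ ω → Start (preStart I ω)
  start ω = record
    { s₀ = refl ; s₁ = sym (length-map endpoints (edges (graph I))) ; s₂ = refl
    ; zero-vars = λ { (suc (suc (suc zero))) _ → refl ; (suc (suc (suc (suc x)))) _ → refl ; 1 (s≤s ()) ; 2 (s≤s (s≤s ())) }
    ; e₀ = cong cells (map-∘ (edges (graph I)))
    ; e₁ = cong cells (map-∘ (edges (graph I)))
    ; zero-cells = λ { (suc (suc zero)) i _ → refl ; (suc (suc (suc a))) i _ → refl ; 1 i (s≤s ()) } }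

  built : ∀ {D} → Constructs (oracle t) I D → ∃[ s ] (Built s × D ≡ output s)
  built {D} (ω , τ , s , halts , D≡) = conclude (preprocessing-run (start ω))
    where
    conclude : Run w preprocessing (preStart I ω) pre-time Built → ∃[ s ] (Built s × D ≡ output s)
    conclude (s′ , τ′ , ex , _ , B) =
      s , subst Built (sym (halted-unique {w} {preprocessing ∷ [] , preStart I ω} τ τ′ halts (ex-sound ex []))) B , D≡

  -- The lists satisfy `K * K ≤ N` and the pivots satisfy `sparse`, so both counts are n ^ (1 - c)
  -- up to a logarithm. The product with `2 * K` is the form that `≤-divide` expects.
  R*2K≤ : ∀ {R} → R * K ≤ 2 * N * r₀ → (K + R) * (2 * K) ≤ 6 * (N * r₀)
  R*2K≤ {R} sparse = begin
    (K + R) * (2 * K)               ≡⟨ lemma K R ⟩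
    2 * (K * K + R * K)             ≤⟨ *-monoʳ-≤ 2 (+-mono-≤ (≤-trans K*K≤N (m≤m*n N r₀)) sparse) ⟩
    2 * (N * r₀ + 2 * N * r₀)       ≡⟨ lemma′ N r₀ ⟩
    6 * (N * r₀)                    ∎
    where
    open ≤-Reasoning
    lemma : ∀ k r → (k + r) * (2 * k) ≡ 2 * (k * k + r * k)
    lemma = solve-∀
    lemma′ : ∀ n r → 2 * (n * r + 2 * n * r) ≡ 6 * (n * r)
    lemma′ = solve-∀

  space : ∀ {D} → Constructs (oracle t) I D → length D ≤ polylog 56 1 N · N ^ᵉ (2 −ᵉ c)
  space {D} con = conclude (built con)
    where
    conclude : (∃[ s ] (Built s × D ≡ output s)) → length D ≤ polylog 56 1 N · N ^ᵉ (2 −ᵉ c)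
    -- 56 = 4 · (8 + 6): four classes of rows, where 8 accounts for the four fixed rows of each
    -- class and 6 for lists and pivots.
    conclude (s , B , refl) = ≤-divide c {N} {K} 2 N≥1 (Instance.κ-upper I) (begin
      length (output s) * (2 * K)               ≡⟨ cong (_* (2 * K)) (trans (length-map (arrays s 2) (upTo (vars s 0))) (trans (length-upTo (vars s 0)) (Built.size₀ B))) ⟩
      (4 + K + R) * 4 * N * (2 * K)             ≡⟨ regroup K R N ⟩
      4 * N * (8 * K + (K + R) * (2 * K))       ≤⟨ *-monoʳ-≤ (4 * N) (+-mono-≤ (*-monoʳ-≤ 8 (≤-trans K≤N (m≤m*n N r₀))) (R*2K≤ (Built.sparse B))) ⟩
      4 * N * (8 * (N * r₀) + 6 * (N * r₀))     ≡⟨ regroup′ N r₀ ⟩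
      56 * (r₀ * 1) * (N * (N * 1))             ∎)
      where
      open ≤-Reasoning
      R : ℕ
      R = Built.R B
      regroup : ∀ k r n → (4 + k + r) * 4 * n * (2 * k) ≡ 4 * n * (8 * k + (k + r) * (2 * k))
      regroup = solve-∀
      regroup′ : ∀ n r → 4 * n * (8 * (n * r) + 6 * (n * r)) ≡ 56 * (r * 1) * (n * (n * 1))
      regroup′ = solve-∀

  μ : ℕ
  μ = m I ⊔ 1

  -- Each summand of the expanded time is its coefficient times something below `W`. The
  -- coefficients add up to 380, rounded to 400.
  pre-time-≤ : pre-time ≤ 400 * (μ * ((K + Rmax) * r₀))
  pre-time-≤ = begin
    pre-time                                                                     ≡⟨ cong (λ a → time a (length es)) (length-arcsOf es) ⟩
    time (2 * length es) (length es)                                             ≡⟨ expand′ (length es) K Rmax r₀ ⟩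
    43 * 1 + 70 * (length es * 1) + 82 * (length es * K) + 6 * r₀ + 66 * (r₀ * (length es * K)) + 31 * Rmax + 82 * (length es * Rmax)
      ≤⟨ +-mono-≤ (+-mono-≤ (+-mono-≤ (+-mono-≤ (+-mono-≤ (+-mono-≤ (*-monoʳ-≤ 43 1≤W) (*-monoʳ-≤ 70 (*-mono-≤ m≤ KRr≥1)))
           (*-monoʳ-≤ 82 (*-mono-≤ m≤ K≤))) (*-monoʳ-≤ 6 r₀≤)) (*-monoʳ-≤ 66 r₀mK≤)) (*-monoʳ-≤ 31 R≤)) (*-monoʳ-≤ 82 (*-mono-≤ m≤ R≤′)) ⟩
    43 * W + 70 * W + 82 * W + 6 * W + 66 * W + 31 * W + 82 * W                  ≡⟨ collect W ⟩
    380 * W                                                                      ≤⟨ *-monoˡ-≤ W (m≤m+n 380 20) ⟩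
    400 * W                                                                      ∎
    where
    open ≤-Reasoning
    W : ℕ
    W = μ * ((K + Rmax) * r₀)
    time : ℕ → ℕ → ℕ
    time a e = suc (suc (7 + suc (suc (e * 70) + (2 + suc (41 * (a * K))))) + suc (suc (2 + suc (r₀ * suc (5 + 33 * (a * K))) + 17)
      + suc (suc (Rmax * 31) + suc (suc (41 * (a * Rmax)) + 3))))
    expand′ : ∀ e k r l → suc (suc (7 + suc (suc (e * 70) + (2 + suc (41 * (2 * e * k))))) + suc (suc (2 + suc (l * suc (5 + 33 * (2 * e * k))) + 17)
      + suc (suc (r * 31) + suc (suc (41 * (2 * e * r)) + 3)))) ≡
      43 * 1 + 70 * (e * 1) + 82 * (e * k) + 6 * l + 66 * (l * (e * k)) + 31 * r + 82 * (e * r)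
    expand′ = solve-∀
    collect : ∀ x → 43 * x + 70 * x + 82 * x + 6 * x + 66 * x + 31 * x + 82 * x ≡ 380 * x
    collect = solve-∀
    m≤ : length es ≤ μ
    m≤ = ≤-trans (≤-reflexive (length-map endpoints (edges (graph I)))) (m≤m⊔n (m I) 1)
    μ≥1 : 1 ≤ μ
    μ≥1 = m≤n⊔m (m I) 1
    KR≥1 : 1 ≤ K + Rmax
    KR≥1 = ≤-trans K≥1 (m≤m+n K Rmax)
    K≤ : K ≤ (K + Rmax) * r₀
    K≤ = ≤-trans (m≤m+n K Rmax) (m≤m*n (K + Rmax) r₀)
    R≤′ : Rmax ≤ (K + Rmax) * r₀
    R≤′ = ≤-trans (m≤n+m Rmax K) (m≤m*n (K + Rmax) r₀)
    KRr≥1 : 1 ≤ (K + Rmax) * r₀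
    KRr≥1 = ≤-trans K≥1 K≤
    times-μ : ∀ {x} → x ≤ (K + Rmax) * r₀ → x ≤ W
    times-μ le = ≤-trans le (m≤n*m _ μ {{>-nonZero μ≥1}})
    1≤W : 1 ≤ W
    1≤W = times-μ KRr≥1
    r₀≤ : r₀ ≤ W
    r₀≤ = times-μ (m≤n*m r₀ (K + Rmax) {{>-nonZero KR≥1}})
    R≤ : Rmax ≤ W
    R≤ = times-μ R≤′
    r₀mK≤ : r₀ * (length es * K) ≤ W
    r₀mK≤ = ≤-trans (≤-reflexive (swap r₀ (length es) K)) (*-mono-≤ m≤ (*-monoˡ-≤ r₀ (m≤m+n K Rmax)))
      where
      swap : ∀ a b c → a * (b * c) ≡ b * (c * a)
      swap = solve-∀

  -- One factor `r₀` counts the passes of the greedy choice and the other comes from the number of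
  -- pivots; 2400 is 400 times the 6 of `R*2K≤`.
  pre-time-bound : pre-time ≤ polylog 2400 2 N * μ · N ^ᵉ (1 −ᵉ c)
  pre-time-bound = ≤-divide c {N} {K} 1 N≥1 (Instance.κ-upper I) (begin
    pre-time * (2 * K)                                ≤⟨ *-monoˡ-≤ (2 * K) pre-time-≤ ⟩
    400 * (μ * ((K + Rmax) * r₀)) * (2 * K)           ≡⟨ regroup μ (K + Rmax) r₀ (2 * K) ⟩
    400 * (μ * r₀) * ((K + Rmax) * (2 * K))           ≤⟨ *-monoʳ-≤ (400 * (μ * r₀)) (R*2K≤ (m/n*n≤m (2 * N * r₀) K {{>-nonZero K≥1}})) ⟩
    400 * (μ * r₀) * (6 * (N * r₀))                   ≡⟨ regroup′ μ r₀ N ⟩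
    2400 * (r₀ * (r₀ * 1)) * μ * (N * 1)              ∎)
    where
    open ≤-Reasoning
    regroup : ∀ a b c d → 400 * (a * (b * c)) * d ≡ 400 * (a * c) * (b * d)
    regroup = solve-∀
    regroup′ : ∀ a b c → 400 * (a * b) * (6 * (c * b)) ≡ 2400 * (b * (b * 1)) * a * (c * 1)
    regroup′ = solve-∀

  -- Preprocessing tosses no coins, so after `pre-time` steps not a single outcome is unfinished,
  -- and the product is 0 for every `γ`.
  construction : ∀ γ → ∃[ τ ] (τ ≤ polylog 2400 2 N * μ · N ^ᵉ (1 −ᵉ c) × unfinished (oracle t) I τ * N ^ γ ≤ 2 ^ τ)
  construction γ = conclude pre-time pre-time-bound (λ ω → preprocessing-run (start ω))
    where
    -- Stated for an arbitrary T, since count would be unfolded on an explicit one.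
    conclude : ∀ T → T ≤ polylog 2400 2 N * μ · N ^ᵉ (1 −ᵉ c) → (∀ ω → Run w preprocessing (preStart I ω) T Built) →
      ∃[ τ ] (τ ≤ polylog 2400 2 N * μ · N ^ᵉ (1 −ᵉ c) × unfinished (oracle t) I τ * N ^ γ ≤ 2 ^ τ)
    conclude T bound runs = T , bound , ≤-trans (≤-reflexive (cong (_* N ^ γ) (count-zero T (λ ω → finished (runs (pad ω)))))) z≤n
      where
      finished : ∀ {ω} → Run w preprocessing (preStart I ω) T Built → running (run w T (preprocessing ∷ [] , preStart I ω)) ≡ false
      finished {ω} (s , τ , ex , τ≤ , _) = cong running (trans (cong (λ k → run w k (preprocessing ∷ [] , preStart I ω)) (sym (m+[n∸m]≡n τ≤)))
        (halted-+ {w} {preprocessing ∷ [] , preStart I ω} τ (T ∸ τ) (ex-sound ex [])))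

  module _ {s : State} (B : Built s) (u v : Fin N) where
    open Built B

    D : List ℕ
    D = output s

    cell≡ : ∀ {i} → i < (4 + K + R) * 4 * N → cells D i ≡ arrays s 2 i
    cell≡ i< = cells-output s (subst (_ <_) (sym size₀) i<)

    table′ : Table N K R arcs (cells D)
    table′ = table-cong (λ c<4 y<n ρ< _ → cell≡ (addr-< c<4 y<n ρ<)) table

    header′ : cells D 0 ≡ N
    header′ = trans (cell≡ (≤-trans N≥1 (m≤n*m N ((4 + K + R) * 4)))) header

    open Launch w N N≥1 room K K≥1 K≤N R R≤n arcs sy (cells D) header′ table′ (toℕ u) (toℕ v) (toℕ<n u) (toℕ<n v) t room-len room-count

    asked : Asked (queryStart D u v)
    asked = record
      { asked-u = refl ; asked-v = refl
      ; fresh-var = λ { (suc (suc zero)) _ → refl ; (suc (suc (suc x))) _ → refl ; 1 (s≤s ()) }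
      ; structure = refl
      ; fresh-cell = λ { (suc zero) i _ → refl ; (suc (suc a)) i _ → refl } }

    approximates : ∀ {s′} → Answered s′ → Approximates t (graph I) u v (estimate s′)
    approximates {s′} A = by (Answered.best A) refl
      where
      by : ∀ b → Answered.best A ≡ b → Approximates t (graph I) u v (estimate s′)
      -- A walk of length `l` would be covered with `r = suc l`, which forces a finite estimate. So
      -- the answer 0 means that there is none.
      by zero b≡ = subst (Approximates t (graph I) u v) (sym (estimate-zero s′ (trans (Answered.result A) b≡))) λ l p →
        let e , _ , e≡ = Answered.accurate A {l} {suc l} (λ _ → s≤s z≤n) (≤-trans (n≤1+n l) (≤-trans (m≤n*m (suc l) t) (m≤m+n _ _))) (walk⇒path p)
        in contradiction (trans (sym e≡) b≡) λ ()
      -- The estimate is the length of an actual walk, hence at least the distance. The upper bound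
      -- is `accurate` applied to a shortest walk with `r` the rounded quotient.
      by (suc e) b≡ = subst (Approximates t (graph I) u v) (sym (estimate-suc s′ (trans (Answered.result A) b≡)))
        (let found = path⇒walk (Answered.a-walk A b≡) {u} {v} refl refl
             d , dist , _ = shortest e e ≤-refl found
             e′ , e′≤ , e≡ = Answered.accurate A {d} {⌈ d /2 t ⌉} (ceiling≥1 t d) (half-steps t d) (walk⇒path (proj₁ dist))
         in d , dist , proj₂ dist e found , ≤-trans (≤-reflexive (suc-injective (trans (sym b≡) e≡))) e′≤)

    query-time-bound : query-time ≤ polylog (91 * 3 ^ t) 0 N · N ^ᵉ (c ·ᵉ t)
    -- 74 = 37 · 2 is the exploration and 17 the overhead. Since `t` is fixed, 3 ^ t joins the
    -- constant and κ ^ t remains.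
    query-time-bound = ≤-power c t {N} {K} (Instance.κ-lower I) (begin
      query-time                       ≡⟨ regroup ((3 * K) ^ t) ⟩
      17 * 1 + 74 * (3 * K) ^ t        ≤⟨ +-monoˡ-≤ _ (*-monoʳ-≤ 17 (m^n>0 (3 * K) {{m*n≢0 3 K {{_}} {{>-nonZero K≥1}}}} t)) ⟩
      17 * (3 * K) ^ t + 74 * (3 * K) ^ t ≡⟨ *-distribʳ-+ ((3 * K) ^ t) 17 74 ⟨
      91 * (3 * K) ^ t                 ≡⟨ trans (cong (91 *_) (^-distribʳ-* t 3 K)) (regroup′ (3 ^ t) (K ^ t)) ⟩
      91 * 3 ^ t * 1 * K ^ t           ∎)
      where
      open ≤-Reasoning
      regroup : ∀ x → suc (9 + suc (3 + suc (suc (37 * (2 * x)) + 1))) ≡ 17 * 1 + 74 * x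
      regroup = solve-∀
      regroup′ : ∀ a b → 91 * (a * b) ≡ 91 * a * 1 * b
      regroup′ = solve-∀

    answer : ∃[ τ ] ∃[ e ] (τ ≤ polylog (91 * 3 ^ t) 0 N · N ^ᵉ (c ·ᵉ t) × Answers (oracle t) I D u v τ e × Approximates t (graph I) u v e)
    answer = conclude query-time query-time-bound (querying-run asked)
      where
      conclude : ∀ T → T ≤ polylog (91 * 3 ^ t) 0 N · N ^ᵉ (c ·ᵉ t) → Run w (querying t) (queryStart D u v) T Answered →
        ∃[ τ ] ∃[ e ] (τ ≤ polylog (91 * 3 ^ t) 0 N · N ^ᵉ (c ·ᵉ t) × Answers (oracle t) I D u v τ e × Approximates t (graph I) u v e)
      conclude T bound (s′ , τ , ex , τ≤ , A) = T , estimate s′ , bound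
        , (s′ , trans (cong (λ k → run w k (querying t ∷ [] , queryStart D u v)) (sym (m+[n∸m]≡n τ≤)))
                  (halted-+ {w} {querying t ∷ [] , queryStart D u v} τ (T ∸ τ) (ex-sound ex [])) , refl)
        , approximates A

theorem9 : (t : ℕ) .{{_ : NonZero t}} (c : ℝ) → 0ℚ <ˡ c → c <ʳ ½ →
    Σ Oracle λ A →
    (∃[ K ] ∃[ k ] ∀ (I : Instance c) (D : List ℕ) → Constructs A I D →
    length D ≤ polylog K k (n I) · n I ^ᵉ (2 −ᵉ c))
    ×
    (∃[ K ] ∃[ k ] ∀ (I : Instance c) (D : List ℕ) → Constructs A I D →
    ∀ (u v : Fin (n I)) → ∃[ τ ] ∃[ e ]
    (τ ≤ polylog K k (n I) · n I ^ᵉ (c ·ᵉ t)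
    × Answers A I D u v τ e
    × Approximates t (graph I) u v e))
    ×
    (∀ (γ : ℕ) → ∃[ K ] ∃[ k ] ∀ (I : Instance c) → ∃[ τ ]
    (τ ≤ (polylog K k (n I) * (m I ⊔ 1)) · n I ^ᵉ (1 −ᵉ c)
    × unfinished A I τ * n I ^ γ ≤ 2 ^ τ))
theorem9 t c 0<c c<½ = oracle t
  , (56 , 1 , λ I D con → Final.space t c c<½ I con)
  , (91 * 3 ^ t , 0 , queries)
  , λ γ → 2400 , 2 , λ I → Final.construction t c c<½ I γ
  where
  queries : ∀ (I : Instance c) (D : List ℕ) → Constructs (oracle t) I D →
    ∀ (u v : Fin (n I)) → ∃[ τ ] ∃[ e ]
    (τ ≤ polylog (91 * 3 ^ t) 0 (n I) · n I ^ᵉ (c ·ᵉ t) × Answers (oracle t) I D u v τ e × Approximates t (graph I) u v e)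
  queries I D con u v = conclude (Final.built t c c<½ I con)
    where
    conclude : (∃[ s ] (Final.Built t c c<½ I s × D ≡ output s)) →
      ∃[ τ ] ∃[ e ] (τ ≤ polylog (91 * 3 ^ t) 0 (n I) · n I ^ᵉ (c ·ᵉ t) × Answers (oracle t) I D u v τ e × Approximates t (graph I) u v e)
    conclude (s , B , refl) = Final.answer t c c<½ I B u v
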